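{- The following decision problem is NP-complete: given a bipartite graph $G$ with maximum degree three, decide whether $\overleftrightarrow{\chi}(G) \leq 1$.
   Context: All graphs are finite and simple. An orientation $D$ of a graph $G$ is a digraph obtained by replacing each edge of $G$ by exactly one of the two possible arcs with the same endvertices. For a vertex $v$, $d_D^-(v)$ (in-degree) is the number of arcs with head $v$, $d_D^+(v)$ (out-degree) is the number of arcs with tail $v$, and the in-out-degree is $d_D^{\pm}(v) = d_D^-(v) - d_D^+(v)$. An orientation $D$ of $G$ is in-out-proper if $d_D^{\pm}(u) \neq d_D^{\pm}(v)$ for any two adjacent vertices $u,v$. The in-out-proper orientation number of $G$ is $\overleftrightarrow{\chi}(G) = \min_{D\in\Gamma}\max_{v\in V(G)} |d_D^{\pm}(v)|$, where $\Gamma$ is the set of in-out-proper orientations of $G$ (it is known that $\Gamma$ is nonempty for every graph $G$). -}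

module Defs where

open import Data.Bool.Base using (Bool; true; false; not; T)
open import Data.Fin.Base using (Fin)
open import Data.Fin.Subset using () renaming (∣_∣ to card)
open import Data.Integer.Base as ℤ using (ℤ; +_)
open import Data.List.Base as List using (List; []; _∷_; [_]; _++_; length; replicate)
open import Data.Maybe.Base using (Maybe; just; nothing)
open import Data.Nat.Base using (ℕ; suc; zero; _+_; _*_; _^_; _⊔_; _≤_)
open import Data.Product.Base using (Σ; ∃-syntax; _×_; _,_)
open import Data.Vec.Base as Vec using (Vec; _∷_)
open import Data.Vec.Functional using (foldr)
open import Function.Bundles using (_⇔_)
open import Relation.Binary.PropositionalEquality using (_≡_; _≢_)

------------------------------------------------------------------------
-- Deterministic multitape Turing machines

data Symbol (m : ℕ) : Set where
  blank : Symbol m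
  bit   : Bool → Symbol m
  mark  : Fin m → Symbol m

data Move : Set where
  left right stay : Move

-- A two-way infinite tape.  `before` lists the cells to the left of the head,
-- nearest first; all cells beyond the two lists are blank.
record Tape (m : ℕ) : Set where
  constructor tape
  field
    before : List (Symbol m)
    head   : Symbol m
    after  : List (Symbol m)

module _ {m : ℕ} where

  uncons : List (Symbol m) → Symbol m × List (Symbol m)
  uncons []       = blank , []
  uncons (x ∷ xs) = x , xs

  move : Move → Tape m → Tape m
  move left  (tape ls x rs) = let (y , ls′) = uncons ls in tape ls′ y (x ∷ rs)
  move right (tape ls x rs) = let (y , rs′) = uncons rs in tape (x ∷ ls) y rs′
  move stay  t              = t

  act : Symbol m × Move → Tape m → Tape m
  act (x , d) (tape ls _ rs) = move d (tape ls x rs)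

  blankTape : Tape m
  blankTape = tape [] blank []

  inputTape : List Bool → Tape m
  inputTape w = let (x , xs) = uncons (List.map bit w) in tape [] x xs

  leadingBits : List (Symbol m) → List Bool
  leadingBits (bit b ∷ xs) = b ∷ leadingBits xs
  leadingBits _            = []

  outputTape : Tape m → List Bool
  outputTape (tape _ x rs) = leadingBits (x ∷ rs)

-- There are `suc work` tapes; the first one carries both input and output.
-- The machine halts when `δ` yields `nothing`.
record TM : Set where
  field
    states marks work : ℕ
    start             : Fin states
    δ                 : Fin states → Vec (Symbol marks) (suc work) →
                        Maybe (Fin states × Vec (Symbol marks × Move) (suc work))

module _ (M : TM) where
  open TM M

  Config : Set
  Config = Fin states × Vec (Tape marks) (suc work)

  transition : Config → Maybe (Fin states × Vec (Symbol marks × Move) (suc work))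
  transition (q , ts) = δ q (Vec.map Tape.head ts)

  Halted : Config → Set
  Halted c = transition c ≡ nothing

  -- Halted configurations are fixed by `step`, so being halted after `run t`
  -- means halting within `t` steps.
  step : Config → Config
  step c@(_ , ts) with transition c
  ... | nothing       = c
  ... | just (q , as) = q , Vec.zipWith act as ts

  run : ℕ → Config → Config
  run zero    c = c
  run (suc t) c = run t (step c)

  initial : List Bool → Config
  initial w = start , inputTape w ∷ Vec.replicate work blankTape

  output : Config → List Bool
  output (_ , ts) = outputTape (Vec.head ts)

------------------------------------------------------------------------
-- Polynomial time, NP and NP-completeness

-- Every polynomial with natural coefficients is dominated by one of these.
poly : ℕ → ℕ → ℕ → ℕ
poly c k n = c * n ^ k + c

PolyTime : (List Bool → List Bool) → Set
PolyTime f = Σ TM λ M → ∃[ c ] ∃[ k ] ∀ w →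
  let final = run M (poly c k (length w)) (initial M w) in
  Halted M final × output M final ≡ f w

Language : Set₁
Language = List Bool → Set

-- Self-delimiting pairing: the bits of the first component are doubled, and
-- the first pair of unequal bits separates it from the second component.
pair : List Bool → List Bool → List Bool
pair []      u = true ∷ false ∷ u
pair (b ∷ x) u = b ∷ b ∷ pair x u

NP : Language → Set
NP L = Σ (List Bool → List Bool) λ V → PolyTime V × ∃[ c ] ∃[ k ] ∀ x →
  L x ⇔ (∃[ u ] length u ≤ poly c k (length x) × V (pair x u) ≡ [ true ])

-- Polynomial-time many-one (Karp) reducibility.
_≤ₚ_ : Language → Language → Set
L ≤ₚ L′ = Σ (List Bool → List Bool) λ f → PolyTime f × (∀ x → L x ⇔ L′ (f x))

NPHard : Language → Set₁
NPHard L = ∀ L′ → NP L′ → L′ ≤ₚ L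

NPComplete : Language → Set₁
NPComplete L = NP L × NPHard L

------------------------------------------------------------------------
-- Graphs and in-out-proper orientations

record Graph (n : ℕ) : Set where
  field
    adj       : Fin n → Fin n → Bool
    symmetric : ∀ u v → adj u v ≡ adj v u
    loopless  : ∀ v → adj v v ≡ false

module _ {n : ℕ} where

  -- Zero if there are no vertices.
  maxOver : (Fin n → ℕ) → ℕ
  maxOver = foldr _⊔_ 0

  count : (Fin n → Bool) → ℕ
  count p = card (Vec.tabulate p)

module _ {n : ℕ} (G : Graph n) where
  open Graph G

  degree : Fin n → ℕ
  degree v = count (adj v)

  maxDegree : ℕ
  maxDegree = maxOver degree

  Bipartite : Set
  Bipartite = Σ (Fin n → Bool) λ side → ∀ u v → T (adj u v) → side u ≢ side v

  record Orientation : Set where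
    field
      arc        : Fin n → Fin n → Bool
      arc⇒adj    : ∀ u v → T (arc u v) → T (adj u v)
      exactlyOne : ∀ u v → T (adj u v) → arc v u ≡ not (arc u v)

    indegree outdegree : Fin n → ℕ
    indegree  v = count (λ u → arc u v)
    outdegree v = count (λ u → arc v u)

    inOutDegree : Fin n → ℤ
    inOutDegree v = + indegree v ℤ.- + outdegree v

    InOutProper : Set
    InOutProper = ∀ u v → T (adj u v) → inOutDegree u ≢ inOutDegree v

    maxAbsInOutDegree : ℕ
    maxAbsInOutDegree = maxOver (λ v → ℤ.∣ inOutDegree v ∣)

  open Orientation

  IsInOutProperOrientationNumber : ℕ → Set
  IsInOutProperOrientationNumber k =
    (Σ Orientation λ D → InOutProper D × maxAbsInOutDegree D ≡ k) ×
    (∀ D → InOutProper D → k ≤ maxAbsInOutDegree D)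

  InOutProperOrientationNumber≤ : ℕ → Set
  InOutProperOrientationNumber≤ b = ∃[ k ] IsInOutProperOrientationNumber k × k ≤ b

  -- The number of vertices in unary, a separator, and the adjacency matrix
  -- row by row.
  encode : List Bool
  encode = replicate n true ++ false ∷
           List.concat (List.tabulate λ u → List.tabulate λ v → adj u v)

------------------------------------------------------------------------
-- The decision problem

BipartiteMaxDegree3InOut≤1 : Language
BipartiteMaxDegree3InOut≤1 w = Σ ℕ λ n → Σ (Graph n) λ G →
  w ≡ encode G ×
  Bipartite G × maxDegree G ≡ 3 × InOutProperOrientationNumber≤ G 1

{-# OPTIONS --safe #-}

-- An orientation whose in-out-degrees all lie in {-1, 0, 1} passes straight
-- through every vertex of degree 2, and no vertex of degree 3 is a source or a
-- sink.  So a vertex of degree 3 with neighbours of degree 2 is a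
-- not-all-equal constraint on three directions.  A variable is an even cycle
-- with a leaf at every other vertex: its in-out-degrees alternate in sign, and
-- therefore the edges which leave it at the remaining vertices are all
-- directed into the cycle or all directed out of it.
--
-- Not-all-equal formulas express polynomial-time verification as in the
-- Cook–Levin theorem.  The cells of a tape are numbered relative to its head,
-- so that a step of the machine is described by Horn clauses that do not
-- mention the position of the head, and the certificate is guessed by the
-- only clauses that are not Horn.  A clause becomes a chain of not-all-equal
-- constraints with a fixed variable for falsity.
--
-- All functions that have to be computed in polynomial time, namely the
-- adjacency matrix produced by the reduction and the verifier, are built from
-- bounded sums, truncated subtraction and lookups in the input.  Sums are
-- loops over counters, and a counter is the position of a head on its tape.

module Submission where

open import Defs
open import Data.Bool.Base using (Bool; true; false; not; T; if_then_else_; _∧_; _∨_; _xor_)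
import Data.Bool.Properties as Bool
open import Data.Empty using (⊥; ⊥-elim)
open import Data.Fin.Base as Fin using (Fin; toℕ; fromℕ<) renaming (zero to fz; suc to fs)
import Data.Fin.Properties as Fin
open import Data.Integer.Base as ℤ using (ℤ)
import Data.Integer.Properties as ℤ
open import Data.Integer.Tactic.RingSolver renaming (solve-∀ to ℤ-solve-∀)
open import Data.List.Base as List using (List; []; _∷_; _++_; _ʳ++_; length; reverse; replicate)
open import Data.List.Membership.Propositional using (_∈_)
open import Data.List.Membership.Propositional.Properties using (∈-allFin; ∈-map⁺; ∈-concatMap⁺)
import Data.List.Properties as List
open import Data.List.Relation.Unary.All as All using (All; []; _∷_)
import Data.List.Relation.Unary.All.Properties as All
open import Data.List.Relation.Unary.AllPairs using ([]; _∷_)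
open import Data.List.Relation.Unary.Any as Any using (Any; here; there)
open import Data.List.Relation.Unary.Unique.Propositional using (Unique)
open import Data.Maybe.Base as Maybe using (Maybe; just; nothing; maybe)
open import Data.Nat.Base
open import Data.Nat.DivMod using (_/_; _%_; /-monoˡ-≤; m/n*n≤m; m/n≤m; m%n≡m∸m/n*n; m≡m%n+[m/n]*n; m%n<n; m<n*o⇒m/o<n; m*n/n≡m; m<n⇒m/n≡0;
  +-distrib-/-∣ʳ; m<n⇒m%n≡m)
open import Data.Nat.Divisibility using (divides-refl)
open import Data.Nat.Properties
open import Data.Nat.Tactic.RingSolver using (solve-∀)
open import Data.Product.Base using (∃-syntax; _×_; _,_; proj₁; proj₂)
open import Data.Sum.Base as Sum using (_⊎_; inj₁; inj₂)
open import Data.Sum.Function.Propositional using (_⊎-↔_)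
open import Data.Unit.Base using (⊤; tt)
open import Data.Vec.Base as Vec using (Vec; []; _∷_)
import Data.Vec.Properties as Vec
open import Function.Base using (_∘_; id)
open import Function.Bundles using (_⇔_; _↔_; mk⇔; Equivalence; Inverse)
open import Function.Properties.Inverse using (↔-sym; ↔-trans)
open import Relation.Binary.Definitions using (DecidableEquality; tri<; tri≈; tri>)
open import Relation.Binary.PropositionalEquality
open import Relation.Nullary using (¬_; Dec; yes; no; does)
open import Relation.Nullary.Decidable using (dec-false; ⌊_⌋; map′)

-- Structured programs for Turing machines

-- In the variable gadget, alternating signs alone do not fix the directions of the outgoing edges,
-- since the cycle itself might change direction. At a vertex with a leaf it cannot: two cycle edges
-- that both enter or both leave would force the pendant edge the other way, and the vertex would
-- get the in-out-degree of its leaf. At the other vertices the majority of the three edges is a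
-- constant `σ`, and a cycle edge that opposes `σ` there forces the next one to oppose it as well.
-- Hence the direction is constant around the cycle, the two cycle edges cancel at each of these
-- vertices, and the third edge shows `σ`.
--
-- The clauses for a computation never say that a cell holds at most one symbol.
--
-- Formula and graph are computed without data structures. Clauses, literals and vertices are
-- numbered in mixed radix, so that each bit of the adjacency matrix is an arithmetic function of
-- its two indices and of the input.

Sym : Set
Sym = Symbol 1

pattern ⊢ = mark fz

data Prog : Set where
  write  : ℕ → (Sym → Sym × Move) → Prog
  _⨾_    : Prog → Prog → Prog
  while  : ℕ → (Sym → Bool) → Prog → Prog
  branch : ℕ → (Sym → Bool) → Prog → Prog → Prog

infixr 5 _⨾_

Tapes : Set
Tapes = ℕ → Tape 1

headOf : Tapes → ℕ → Sym
headOf s i = Tape.head (s i)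

update : ℕ → Tape 1 → Tapes → Tapes
update i t s j = if i ≡ᵇ j then t else s j

-- `Run P s s′ t`: started on the tapes s, the program P ends on s′ after
-- exactly t steps of the machine compiled from it.
data Run : Prog → Tapes → Tapes → ℕ → Set where
  write  : ∀ {i g s} →
           Run (write i g) s (update i (act (g (headOf s i)) (s i)) s) 1
  _⨾_    : ∀ {P Q s s′ s″ t t′} → Run P s s′ t → Run Q s′ s″ t′ → Run (P ⨾ Q) s s″ (t + t′)
  done   : ∀ {i p P s} → p (headOf s i) ≡ false → Run (while i p P) s s 1
  again  : ∀ {i p P s s′ s″ t t′} → p (headOf s i) ≡ true →
           Run P s s′ t → Run (while i p P) s′ s″ t′ → Run (while i p P) s s″ (suc (t + t′))
  then-  : ∀ {i p P Q s s′ t} → p (headOf s i) ≡ true →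
           Run P s s′ t → Run (branch i p P Q) s s′ (suc t)
  else-  : ∀ {i p P Q s s′ t} → p (headOf s i) ≡ false →
           Run Q s s′ t → Run (branch i p P Q) s s′ (suc t)

-- Compilation into a multitape machine

lastTape : Prog → ℕ
lastTape (write i _)      = i
lastTape (P ⨾ Q)          = lastTape P ⊔ lastTape Q
lastTape (while i _ P)    = i ⊔ lastTape P
lastTape (branch i _ P Q) = i ⊔ (lastTape P ⊔ lastTape Q)

-- The control states of the compiled machine: one for each `write` and one for each test.
-- Sequencing has none of its own, so leaving `P` and arriving at the entry of `Q` is a single
-- transition; this makes the step counts of `Run` exact.
Location : Prog → Set
Location (write _ _)      = ⊤
Location (P ⨾ Q)          = Location P ⊎ Location Q
Location (while _ _ P)    = ⊤ ⊎ Location P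
Location (branch _ _ P Q) = ⊤ ⊎ (Location P ⊎ Location Q)

#locations : Prog → ℕ
#locations (write _ _)      = 1
#locations (P ⨾ Q)          = #locations P + #locations Q
#locations (while _ _ P)    = 1 + #locations P
#locations (branch _ _ P Q) = 1 + (#locations P + #locations Q)

location↔ : ∀ P → Location P ↔ Fin (#locations P)
location↔ (write _ _)      = ↔-sym Fin.1↔⊤
location↔ (P ⨾ Q)          = ↔-trans (location↔ P ⊎-↔ location↔ Q) (↔-sym Fin.+↔⊎)
location↔ (while _ _ P)    = ↔-trans (↔-sym Fin.1↔⊤ ⊎-↔ location↔ P) (↔-sym Fin.+↔⊎)
location↔ (branch _ _ P Q) =
  ↔-trans (↔-sym Fin.1↔⊤ ⊎-↔ ↔-trans (location↔ P ⊎-↔ location↔ Q) (↔-sym Fin.+↔⊎)) (↔-sym Fin.+↔⊎)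

entry : ∀ P → Location P
entry (write _ _)      = tt
entry (P ⨾ Q)          = inj₁ (entry P)
entry (while _ _ _)    = inj₁ tt
entry (branch _ _ _ _) = inj₁ tt

at : ∀ {k} → Vec Sym k → ℕ → Sym
at []       _       = blank
at (x ∷ _)  zero    = x
at (_ ∷ xs) (suc i) = at xs i

at-toℕ : ∀ {k} (xs : Vec Sym k) j → at xs (toℕ j) ≡ Vec.lookup xs j
at-toℕ (_ ∷ _)  fz     = refl
at-toℕ (_ ∷ xs) (fs j) = at-toℕ xs j

module Compile (work : ℕ) where

  Heads Actions Store : Set
  Heads   = Vec Sym (suc work)
  Actions = Vec (Sym × Move) (suc work)
  Store   = Vec (Tape 1) (suc work)

  heads : Store → Heads
  heads = Vec.map Tape.head

  actions : (Fin (suc work) → Sym → Sym × Move) → Heads → Actions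
  actions f hs = Vec.tabulate λ j → f j (Vec.lookup hs j)

  only : ℕ → (Sym → Sym × Move) → Fin (suc work) → Sym → Sym × Move
  only i g j = if i ≡ᵇ toℕ j then g else _, stay

  idle : Heads → Actions
  idle = actions λ _ → _, stay

  then′ : ∀ {A B : Set} → (A → B) → Maybe B → Maybe A × Actions → Maybe B × Actions
  then′ f e (l , as) = maybe (just ∘ f) e l , as

  -- `nothing` is the exit of the program.
  next : ∀ P → Location P → Heads → Maybe (Location P) × Actions
  next (write i g)      _               hs = nothing , actions (only i g) hs
  next (P ⨾ Q)          (inj₁ l)        hs = then′ inj₁ (just (inj₂ (entry Q))) (next P l hs)
  next (P ⨾ Q)          (inj₂ l)        hs = then′ inj₂ nothing (next Q l hs)
  next (while i p P)    (inj₁ _)        hs = (if p (at hs i) then just (inj₂ (entry P)) else nothing) , idle hs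
  next (while i p P)    (inj₂ l)        hs = then′ inj₂ (just (inj₁ tt)) (next P l hs)
  next (branch i p P Q) (inj₁ _)        hs =
    just (inj₂ (if p (at hs i) then inj₁ (entry P) else inj₂ (entry Q))) , idle hs
  next (branch i p P Q) (inj₂ (inj₁ l)) hs = then′ (inj₂ ∘ inj₁) nothing (next P l hs)
  next (branch i p P Q) (inj₂ (inj₂ l)) hs = then′ (inj₂ ∘ inj₂) nothing (next Q l hs)

  -- Executions seen from the control graph of the program itself. Unlike runs of a finished machine
  -- they can be transported into a larger program, as the induction in `simulate` requires.
  data Path (P : Prog) : Location P → Store → ℕ → Store → Set where
    exit : ∀ {l ts as} → next P l (heads ts) ≡ (nothing , as) →
           Path P l ts 1 (Vec.zipWith act as ts)
    _◅_  : ∀ {l l′ ts as t ts′} → next P l (heads ts) ≡ (just l′ , as) →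
           Path P l′ (Vec.zipWith act as ts) t ts′ → Path P l ts (suc t) ts′

  infixr 5 _◅_

  module _ {P R : Prog} (f : Location P → Location R) where

    path-then : ∀ {e} → (∀ l hs → next R (f l) hs ≡ then′ f (just e) (next P l hs)) →
                ∀ {l ts t ts′ t′ ts″} → Path P l ts t ts′ → Path R e ts′ t′ ts″ →
                Path R (f l) ts (t + t′) ts″
    path-then eq {l} {ts} (exit q) path = trans (eq l (heads ts)) (cong (then′ f _) q) ◅ path
    path-then eq {l} {ts} (q ◅ p) path =
      trans (eq l (heads ts)) (cong (then′ f _) q) ◅ path-then eq p path

    path-last : (∀ l hs → next R (f l) hs ≡ then′ f nothing (next P l hs)) →
                ∀ {l ts t ts′} → Path P l ts t ts′ → Path R (f l) ts t ts′
    path-last eq {l} {ts} (exit q) = exit (trans (eq l (heads ts)) (cong (then′ f _) q))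
    path-last eq {l} {ts} (q ◅ p) = trans (eq l (heads ts)) (cong (then′ f _) q) ◅ path-last eq p

  -- Programs act on infinitely many tapes, the machine on `suc work` of them. Agreement is asked on
  -- the latter, whence the hypothesis `lastTape P ≤ work` of `simulate`.
  record _∼_ (ts : Store) (s : Tapes) : Set where
    constructor agree
    field tape-at : ∀ j → Vec.lookup ts j ≡ s (toℕ j)

  open _∼_

  lookup-act : ∀ f ts j → Vec.lookup (Vec.zipWith act (actions f (heads ts)) ts) j ≡
               act (f j (Tape.head (Vec.lookup ts j))) (Vec.lookup ts j)
  lookup-act f ts j = begin
    Vec.lookup (Vec.zipWith act (actions f (heads ts)) ts) j
      ≡⟨ Vec.lookup-zipWith act j (actions f (heads ts)) ts ⟩
    act (Vec.lookup (actions f (heads ts)) j) (Vec.lookup ts j)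
      ≡⟨ cong (λ a → act a (Vec.lookup ts j)) (Vec.lookup∘tabulate (λ j → f j (Vec.lookup (heads ts) j)) j) ⟩
    act (f j (Vec.lookup (heads ts) j)) (Vec.lookup ts j)
      ≡⟨ cong (λ h → act (f j h) (Vec.lookup ts j)) (Vec.lookup-map j Tape.head ts) ⟩
    act (f j (Tape.head (Vec.lookup ts j))) (Vec.lookup ts j) ∎
    where open ≡-Reasoning

  idle-∼ : ∀ {ts s} → ts ∼ s → Vec.zipWith act (idle (heads ts)) ts ∼ s
  idle-∼ {ts} ts∼s .tape-at j = trans (lookup-act (λ _ → _, stay) ts j) (tape-at ts∼s j)

  only-∼ : ∀ {ts s} i g → ts ∼ s →
           Vec.zipWith act (actions (only i g) (heads ts)) ts ∼ update i (act (g (headOf s i)) (s i)) s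
  only-∼ {ts} {s} i g ts∼s .tape-at j with i ≡ᵇ toℕ j in eq | lookup-act (only i g) ts j
  ... | false | q = trans q (tape-at ts∼s j)
  ... | true  | q rewrite ≡ᵇ⇒≡ i (toℕ j) (subst T (sym eq) tt) =
    trans q (cong (λ t → act (g (Tape.head t)) t) (tape-at ts∼s j))

  at-heads : ∀ {ts s i} → ts ∼ s → i ≤ work → at (heads ts) i ≡ headOf s i
  at-heads {ts} {s} {i} ts∼s i≤work = begin
    at (heads ts) i                ≡⟨ cong (at (heads ts)) (Fin.toℕ-fromℕ< (s≤s i≤work)) ⟨
    at (heads ts) (toℕ j)          ≡⟨ at-toℕ (heads ts) j ⟩
    Vec.lookup (heads ts) j        ≡⟨ Vec.lookup-map j Tape.head ts ⟩
    Tape.head (Vec.lookup ts j)    ≡⟨ cong Tape.head (tape-at ts∼s j) ⟩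
    headOf s (toℕ j)               ≡⟨ cong (headOf s) (Fin.toℕ-fromℕ< (s≤s i≤work)) ⟩
    headOf s i                     ∎
    where
    open ≡-Reasoning
    j = fromℕ< (s≤s i≤work)

  simulate : ∀ {P s s′ t ts} → Run P s s′ t → lastTape P ≤ work → ts ∼ s →
             ∃[ ts′ ] Path P (entry P) ts t ts′ × ts′ ∼ s′
  simulate {write i g} write ≤w ts∼s = _ , exit refl , only-∼ i g ts∼s
  simulate {P ⨾ Q} (r ⨾ r′) ≤w ts∼s =
    let (_ , p , ∼′)  = simulate r (m⊔n≤o⇒m≤o (lastTape P) _ ≤w) ts∼s
        (_ , p′ , ∼″) = simulate r′ (m⊔n≤o⇒n≤o (lastTape P) _ ≤w) ∼′
    in _ , path-then inj₁ (λ _ _ → refl) p (path-last inj₂ (λ _ _ → refl) p′) , ∼″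
  simulate {while i p P} {ts = ts} (done f) ≤w ts∼s =
    _ , exit (cong (λ b → (if b then just _ else nothing) , idle (heads ts))
               (trans (cong p (at-heads ts∼s (m⊔n≤o⇒m≤o i _ ≤w))) f)) , idle-∼ ts∼s
  simulate {while i p P} {ts = ts} (again e r r′) ≤w ts∼s =
    let (_ , q , ∼′)  = simulate r (m⊔n≤o⇒n≤o i _ ≤w) (idle-∼ ts∼s)
        (_ , q′ , ∼″) = simulate r′ ≤w ∼′
    in _ , cong (λ b → (if b then just _ else nothing) , idle (heads ts))
             (trans (cong p (at-heads ts∼s (m⊔n≤o⇒m≤o i _ ≤w))) e)
           ◅ path-then inj₂ (λ _ _ → refl) q q′ , ∼″
  simulate {branch i p P Q} {ts = ts} (then- e r) ≤w ts∼s =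
    let (_ , q , ∼′) = simulate r (m⊔n≤o⇒m≤o (lastTape P) _ (m⊔n≤o⇒n≤o i _ ≤w)) (idle-∼ ts∼s)
    in _ , cong (λ b → just (inj₂ (if b then inj₁ _ else inj₂ _)) , idle (heads ts))
             (trans (cong p (at-heads ts∼s (m⊔n≤o⇒m≤o i _ ≤w))) e)
           ◅ path-last (inj₂ ∘ inj₁) (λ _ _ → refl) q , ∼′
  simulate {branch i p P Q} {ts = ts} (else- e r) ≤w ts∼s =
    let (_ , q , ∼′) = simulate r (m⊔n≤o⇒n≤o (lastTape P) _ (m⊔n≤o⇒n≤o i _ ≤w)) (idle-∼ ts∼s)
    in _ , cong (λ b → just (inj₂ (if b then inj₁ _ else inj₂ _)) , idle (heads ts))
             (trans (cong p (at-heads ts∼s (m⊔n≤o⇒m≤o i _ ≤w))) e)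
           ◅ path-last (inj₂ ∘ inj₂) (λ _ _ → refl) q , ∼′

halted-run : ∀ M t {c} → Halted M c → run M t c ≡ c
halted-run M zero h = refl
halted-run M (suc t) {c} h = trans (cong (run M t) (halted-step h)) (halted-run M t h)
  where
  halted-step : Halted M c → step M c ≡ c
  halted-step h with transition M c | h
  ... | nothing | _ = refl

step-just : ∀ M {c q as} → transition M c ≡ just (q , as) →
            step M c ≡ (q , Vec.zipWith act as (proj₂ c))
step-just M {c} eq with transition M c | eq
... | just _ | refl = refl

run-+ : ∀ M s t c → run M (s + t) c ≡ run M t (run M s c)
run-+ M zero    t c = refl
run-+ M (suc s) t c = run-+ M s t (step M c)

run-halted : ∀ M {s t c c′} → run M s c ≡ c′ → Halted M c′ → s ≤ t → run M t c ≡ c′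
run-halted M {s} {t} {c} {c′} eq h s≤t = begin
  run M t c                   ≡⟨ cong (λ u → run M u c) (m+[n∸m]≡n s≤t) ⟨
  run M (s + (t ∸ s)) c       ≡⟨ run-+ M s (t ∸ s) c ⟩
  run M (t ∸ s) (run M s c)   ≡⟨ cong (run M (t ∸ s)) eq ⟩
  run M (t ∸ s) c′            ≡⟨ halted-run M (t ∸ s) h ⟩
  c′                          ∎
  where open ≡-Reasoning

module Machine (P : Prog) where
  private
    w = lastTape P
    open Compile w
    open _∼_
    open Inverse (location↔ P) using (to; from; strictlyInverseʳ)

    code : Maybe (Location P) → Fin (suc (#locations P))
    code nothing  = fz
    code (just l) = fs (to l)

  machine : TM
  machine = record
    { states = suc (#locations P) ; marks = 1 ; work = w ; start = code (just (entry P))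
    -- State `fz` is the exit and the only state without a transition: every location of the program
    -- acts, if only idly.
    ; δ = λ { fz _ → nothing
            ; (fs q) hs → let (l , as) = next P (from q) hs in just (code l , as) } }

  private
    transition-just : ∀ {l ts l′ as} → next P l (heads ts) ≡ (l′ , as) →
                      transition machine (code (just l) , ts) ≡ just (code l′ , as)
    transition-just {l} {ts} eq rewrite strictlyInverseʳ l | eq = refl

    path⇒run : ∀ {l ts t ts′} → Path P l ts t ts′ →
               run machine t (code (just l) , ts) ≡ (code nothing , ts′)
    path⇒run {ts = ts} (exit {as = as} eq) = step-just machine (transition-just {ts = ts} eq)
    path⇒run {ts = ts} (_◅_ {t = t} eq path) =
      trans (cong (run machine t) (step-just machine (transition-just {ts = ts} eq))) (path⇒run path)

  initialTapes : List Bool → Tapes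
  initialTapes x zero    = inputTape x
  initialTapes x (suc _) = blankTape

  -- The tapes `s₀` are compared with the initial ones up to `lastTape P` only, so the program may
  -- be analysed as if the tapes that it never touches had any convenient content.
  machine-correct : ∀ {x s₀ s t T} → (∀ i → i ≤ lastTape P → initialTapes x i ≡ s₀ i) →
    Run P s₀ s t → t ≤ T →
    let final = run machine T (initial machine x) in
    Halted machine final × output machine final ≡ outputTape (s 0)
  machine-correct {x} {s₀} {s} {t} {T} s₀≡ r t≤T =
    let (ts , path , final∼) = simulate r ≤-refl initial∼
        eq = run-halted machine (path⇒run path) refl t≤T
    in subst (λ c → Halted machine c × output machine c ≡ outputTape (s 0)) (sym eq)
         (refl , cong outputTape (trans (head≡lookup ts) (tape-at final∼ fz)))
    where
    head≡lookup : (ts : Store) → Vec.head ts ≡ Vec.lookup ts fz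
    head≡lookup (_ ∷ _) = refl

    initial∼ : proj₂ (initial machine x) ∼ s₀
    initial∼ .tape-at fz     = s₀≡ 0 z≤n
    initial∼ .tape-at (fs j) = trans (Vec.lookup-replicate j blankTape) (s₀≡ (suc (toℕ j)) (Fin.toℕ<n j))

-- Bounded sums

sumTo : ℕ → (ℕ → ℕ) → ℕ
sumTo zero    f = 0
sumTo (suc n) f = f 0 + sumTo n (f ∘ suc)

sumTo-last : ∀ n f → sumTo (suc n) f ≡ sumTo n f + f n
sumTo-last zero    f = +-comm (f 0) 0
sumTo-last (suc n) f = trans (cong (f 0 +_) (sumTo-last n (f ∘ suc))) (sym (+-assoc (f 0) _ _))

sumTo-cong : ∀ n {f g} → (∀ i → i < n → f i ≡ g i) → sumTo n f ≡ sumTo n g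
sumTo-cong zero    eq = refl
sumTo-cong (suc n) eq = cong₂ _+_ (eq 0 (s≤s z≤n)) (sumTo-cong n λ i i<n → eq (suc i) (s≤s i<n))

sumTo-mono : ∀ n {f g} → (∀ i → i < n → f i ≤ g i) → sumTo n f ≤ sumTo n g
sumTo-mono zero    le = z≤n
sumTo-mono (suc n) le = +-mono-≤ (le 0 (s≤s z≤n)) (sumTo-mono n λ i i<n → le (suc i) (s≤s i<n))

sumTo-const : ∀ n c → sumTo n (λ _ → c) ≡ n * c
sumTo-const zero    c = refl
sumTo-const (suc n) c = cong (c +_) (sumTo-const n c)

≡ᵇ-refl : ∀ n → (n ≡ᵇ n) ≡ true
≡ᵇ-refl zero    = refl
≡ᵇ-refl (suc n) = ≡ᵇ-refl n

≢⇒≡ᵇ : ∀ {m n} → m ≢ n → (m ≡ᵇ n) ≡ false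
≢⇒≡ᵇ {m} {n} m≢n with m ≡ᵇ n in eq
... | false = refl
... | true  = ⊥-elim (m≢n (≡ᵇ⇒≡ m n (subst T (sym eq) tt)))

≡ᵇ-true : ∀ {m n} → (m ≡ᵇ n) ≡ true → m ≡ n
≡ᵇ-true {m} {n} eq = ≡ᵇ⇒≡ m n (subst T (sym eq) tt)

-- Counters and a program logic for them

-- Tape 0 holds the output.  Every other tape consists of ⊢ followed by a word
-- that is never overwritten (the input on tape 1, nothing on the others), and
-- the position of its head is the value of a counter; counter i lives on tape 1 + i.

cell : List Bool → ℕ → Sym
nth  : List Bool → ℕ → Sym
cell w zero    = ⊢
cell w (suc n) = nth w n
nth []      _       = blank
nth (b ∷ _) zero    = bit b
nth (_ ∷ w) (suc n) = nth w n

peek : List Sym → ℕ → Sym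
peek []       _       = blank
peek (x ∷ _)  zero    = x
peek (_ ∷ xs) (suc n) = peek xs n

leftOf : List Bool → ℕ → List Sym
leftOf w zero    = []
leftOf w (suc n) = cell w n ∷ leftOf w n

-- The cells to the right are compared through `peek` rather than as lists, because moving right and
-- back can leave explicit blanks behind. The cells to the left are determined by the position
-- alone.
record Counter (w : List Bool) (n : ℕ) (t : Tape 1) : Set where
  field
    before-≡ : Tape.before t ≡ leftOf w n
    head-≡   : Tape.head t ≡ cell w n
    after-≡  : ∀ i → peek (Tape.after t) i ≡ cell w (suc (n + i))

open Counter

go-right : ∀ {w n t} → Counter w n t → Counter w (suc n) (act (Tape.head t , right) t)
go-right {w} {n} {tape ls x rs} c = record
  { before-≡ = cong₂ _∷_ (head-≡ c) (before-≡ c)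
  ; head-≡   = trans (peek-uncons rs) (trans (after-≡ c 0) (cong (cell w ∘ suc) (+-identityʳ n)))
  ; after-≡  = λ i → trans (peek-rest rs i) (trans (after-≡ c (suc i)) (cong (cell w ∘ suc) (+-suc n i))) }
  where
  peek-uncons : ∀ rs → proj₁ (uncons rs) ≡ peek rs 0
  peek-uncons []      = refl
  peek-uncons (_ ∷ _) = refl
  peek-rest : ∀ rs i → peek (proj₂ (uncons rs)) i ≡ peek rs (suc i)
  peek-rest []      i = refl
  peek-rest (_ ∷ _) i = refl

go-left : ∀ {w n t} → Counter w (suc n) t → Counter w n (act (Tape.head t , left) t)
go-left {w} {n} {tape (l ∷ ls) x rs} c = record
  { before-≡ = List.∷-injectiveʳ (before-≡ c)
  ; head-≡   = List.∷-injectiveˡ (before-≡ c)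
  ; after-≡  = λ { zero    → trans (head-≡ c) (cong (cell w ∘ suc) (sym (+-identityʳ n)))
                 ; (suc i) → trans (after-≡ c i) (cong (cell w ∘ suc) (sym (+-suc n i))) } }

isBottom isBlank isTrue : Sym → Bool
isBottom (mark _) = true
isBottom _        = false
isBlank blank = true
isBlank _     = false
isTrue (bit b) = b
isTrue _       = false

isBottom-nth : ∀ w n → isBottom (nth w n) ≡ false
isBottom-nth []      n       = refl
isBottom-nth (_ ∷ _) zero    = refl
isBottom-nth (_ ∷ w) (suc n) = isBottom-nth w n

-- Staying on the marker turns a decrement at zero into a no-op, so that repeated decrements compute
-- truncated subtraction.
downwards : Sym → Sym × Move
downwards x = x , (if isBottom x then stay else left)

inc dec : ℕ → Prog
inc i = write (suc i) (_, right)
dec i = write (suc i) downwards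

skip : Prog
skip = write 0 (_, stay)

put : Bool → Prog
put b = write 0 λ _ → bit b , right

-- A loop consumes its counter: the body sees the number of iterations that remain, and the counter
-- is zero at the end. Clearing a counter is a loop with an empty body.
loop : ℕ → Prog → Prog
loop i P = while (suc i) (not ∘ isBottom) (dec i ⨾ P)

Counters : Set
Counters = ℕ → ℕ

single : ℕ → ℕ → Counters
single d v i = if d ≡ᵇ i then v else 0

-- States are written as sums of contributions to single counters. Contributions commute and merge,
-- so two descriptions of a state are compared by ring arithmetic instead of by cases on which
-- counters coincide.
add : ℕ → ℕ → Counters → Counters
add d v p i = single d v i + p i

add-same : ∀ d v p → add d v p d ≡ v + p d
add-same d v p rewrite ≡ᵇ-refl d = refl

add-other : ∀ {d i} v p → d ≢ i → add d v p i ≡ p i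
add-other v p d≢i rewrite ≢⇒≡ᵇ d≢i = refl

single-+ : ∀ d m n i → single d (m + n) i ≡ single d m i + single d n i
single-+ d m n i with d ≡ᵇ i
... | true  = refl
... | false = refl

single-0 : ∀ d i → single d 0 i ≡ 0
single-0 d i with d ≡ᵇ i
... | true  = refl
... | false = refl

add-0 : ∀ d p → add d 0 p ≗ p
add-0 d p i = cong (_+ p i) (single-0 d i)

add-+ : ∀ d m n p → add d m (add d n p) ≗ add d (m + n) p
add-+ d m n p i = trans (sym (+-assoc (single d m i) _ _)) (cong (_+ p i) (sym (single-+ d m n i)))

add-swap : ∀ d m e n p → add d m (add e n p) ≗ add e n (add d m p)
add-swap d m e n p i = lemma (single d m i) (single e n i) (p i)
  where
  lemma : ∀ a b c → a + (b + c) ≡ b + (a + c)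
  lemma = solve-∀

add-cong : ∀ d v {p q} → p ≗ q → add d v p ≗ add d v q
add-cong d v eq i = cong (single d v i +_) (eq i)

≗-trans : {p q r : Counters} → p ≗ q → q ≗ r → p ≗ r
≗-trans e f i = trans (e i) (f i)

≗-sym : {p q : Counters} → p ≗ q → q ≗ p
≗-sym e i = sym (e i)

module Semantics (x : List Bool) where

  content : ℕ → List Bool
  content zero    = x
  content (suc _) = []

  -- `written` is the output produced so far, last bit first.
  record Represents (p : Counters) (written : List Bool) (s : Tapes) : Set where
    field
      counters : ∀ i → Counter (content i) (p i) (s (suc i))
      garbage  : List Sym
      output-≡ : s 0 ≡ tape (List.map bit written ++ ⊢ ∷ garbage) blank []

  open Represents

  -- A Hoare triple of total correctness with a time bound. It relates abstract states, because the
  -- tapes that represent a state are not unique.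
  record _∶_⟶_within_ (P : Prog) (A B : Counters × List Bool) (T : ℕ) : Set where
    constructor triple
    field
      execute : ∀ {s} → Represents (proj₁ A) (proj₂ A) s →
                ∃[ s′ ] ∃[ t ] t ≤ T × Run P s s′ t × Represents (proj₁ B) (proj₂ B) s′

  infix 4 _∶_⟶_within_

  open _∶_⟶_within_

  represents-≗ : ∀ {p q ω s} → p ≗ q → Represents p ω s → Represents q ω s
  represents-≗ {s = s} eq r = record
    { counters = λ i → subst (λ n → Counter (content i) n (s (suc i))) (eq i) (counters r i)
    ; garbage = garbage r ; output-≡ = output-≡ r }

  pre : ∀ {P p q ω B T} → p ≗ q → P ∶ q , ω ⟶ B within T → P ∶ p , ω ⟶ B within T
  pre eq h .execute r = execute h (represents-≗ eq r)

  post : ∀ {P A p q ω T} → P ∶ A ⟶ p , ω within T → p ≗ q → P ∶ A ⟶ q , ω within T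
  post h eq .execute r =
    let (s , t , t≤ , run , r′) = execute h r in s , t , t≤ , run , represents-≗ eq r′

  within-≡ : ∀ {P A B T T′} → P ∶ A ⟶ B within T → T ≡ T′ → P ∶ A ⟶ B within T′
  within-≡ h refl = h

  infixr 5 _⨾ᵗ_

  _⨾ᵗ_ : ∀ {P Q A B C T T′} → P ∶ A ⟶ B within T → Q ∶ B ⟶ C within T′ →
         P ⨾ Q ∶ A ⟶ C within T + T′
  (h ⨾ᵗ h′) .execute r =
    let (_ , _ , t≤ , run , r′)   = execute h r
        (_ , _ , t≤′ , run′ , r″) = execute h′ r′
    in _ , _ , +-mono-≤ t≤ t≤′ , run ⨾ run′ , r″

  tape-of : ∀ {p ω s} i → Represents p ω s → headOf s (suc i) ≡ cell (content i) (p i)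
  tape-of i r = head-≡ (counters r i)

  inc-triple : ∀ i {p ω} → inc i ∶ p , ω ⟶ add i 1 p , ω within 1
  inc-triple i {p} .execute {s} r = _ , 1 , ≤-refl , write , record
    { counters = new ; garbage = garbage r ; output-≡ = output-≡ r }
    where
    new : ∀ j → Counter (content j) (add i 1 p j) (update (suc i) (act (headOf s (suc i) , right) (s (suc i))) s (suc j))
    new j with i ≡ᵇ j in eq
    ... | false = counters r j
    ... | true rewrite ≡ᵇ-true {i} {j} eq = go-right (counters r j)

  -- The shape `add i 1 p` of the precondition expresses that the counter is positive; the other
  -- case is `dec-zero`.
  dec-triple : ∀ i {p ω} → dec i ∶ add i 1 p , ω ⟶ p , ω within 1
  dec-triple i {p} .execute {s} r = _ , 1 , ≤-refl , write , record
    { counters = new ; garbage = garbage r ; output-≡ = output-≡ r }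
    where
    direction : isBottom (headOf s (suc i)) ≡ false
    direction rewrite tape-of i r | ≡ᵇ-refl i = isBottom-nth (content i) (p i)
    new : ∀ j → Counter (content j) (p j) (update (suc i) (act (downwards (headOf s (suc i))) (s (suc i))) s (suc j))
    new j with i ≡ᵇ j in eq
    ... | false = subst (λ b → Counter (content j) ((if b then 1 else 0) + p j) (s (suc j))) eq (counters r j)
    ... | true rewrite direction | ≡ᵇ-true {i} {j} eq =
      go-left (subst (λ b → Counter (content j) ((if b then 1 else 0) + p j) (s (suc j))) (≡ᵇ-refl j) (counters r j))

  dec-zero : ∀ i {p ω} → p i ≡ 0 → dec i ∶ p , ω ⟶ p , ω within 1
  dec-zero i {p} z .execute {s} r = _ , 1 , ≤-refl , write , record
    { counters = new ; garbage = garbage r ; output-≡ = output-≡ r }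
    where
    direction : isBottom (headOf s (suc i)) ≡ true
    direction rewrite tape-of i r | z = refl
    new : ∀ j → Counter (content j) (p j) (update (suc i) (act (downwards (headOf s (suc i))) (s (suc i))) s (suc j))
    new j with i ≡ᵇ j in eq
    ... | false = counters r j
    ... | true rewrite direction | ≡ᵇ-true {i} {j} eq = counters r j

  skip-triple : ∀ {p ω} → skip ∶ p , ω ⟶ p , ω within 1
  skip-triple .execute r = _ , 1 , ≤-refl , write , record
    { counters = counters r ; garbage = garbage r ; output-≡ = output-≡ r }

  put-triple : ∀ b {p ω} → put b ∶ p , ω ⟶ p , b ∷ ω within 1
  put-triple b .execute r = _ , 1 , ≤-refl , write , record
    { counters = counters r ; garbage = garbage r ; output-≡ = cong (act (bit b , right)) (output-≡ r) }

  branch-triple : ∀ i f {P Q A B T T′} →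
    (f (cell (content i) (proj₁ A i)) ≡ true → P ∶ A ⟶ B within T) →
    (f (cell (content i) (proj₁ A i)) ≡ false → Q ∶ A ⟶ B within T′) →
    branch (suc i) f P Q ∶ A ⟶ B within suc (T + T′)
  branch-triple i f {A = A} h h′ .execute {s} r with f (cell (content i) (proj₁ A i)) in eq
  ... | true  = let (_ , t , t≤ , run , r′) = execute (h refl) r in
                _ , suc t , s≤s (m≤n⇒m≤n+o _ t≤) , then- (trans (cong f (tape-of i r)) eq) run , r′
  ... | false = let (_ , t , t≤ , run , r′) = execute (h′ refl) r in
                _ , suc t , s≤s (m≤n⇒m≤o+n _ t≤) , else- (trans (cong f (tape-of i r)) eq) run , r′

  -- `τ j` and `ω j` are the counters apart from `i` and the output after `j` rounds. Counter `i`
  -- holds the number `m` of remaining rounds, which the body has to preserve whatever it is. The 2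
  -- pays for the test and the decrement of each round.
  loop-triple : ∀ i n {P} {T : ℕ → ℕ} (τ : ℕ → Counters) (ω : ℕ → List Bool) →
    (∀ j → j ≤ n → τ j i ≡ 0) →
    (∀ j m → j < n → P ∶ add i m (τ j) , ω j ⟶ add i m (τ (suc j)) , ω (suc j) within T j) →
    loop i P ∶ add i n (τ 0) , ω 0 ⟶ τ n , ω n within suc (sumTo n λ j → 2 + T j)
  loop-triple i zero τ ω z body .execute {s} r =
    _ , 1 , ≤-refl , done (cong (not ∘ isBottom) at-bottom) , represents-≗ (add-0 i (τ 0)) r
    where
    at-bottom : headOf s (suc i) ≡ ⊢
    at-bottom = trans (tape-of i r) (cong (cell (content i)) (trans (add-0 i (τ 0) i) (z 0 z≤n)))
  loop-triple i (suc n) {P} {T} τ ω z body .execute {s} r =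
    let (_ , _ , t≤ , run , r′) = execute (dec-triple i ⨾ᵗ body 0 n (s≤s z≤n)) (represents-≗ (≗-sym (add-+ i 1 n (τ 0))) r)
        (_ , _ , t≤′ , run′ , r″) = execute (loop-triple i n {T = T ∘ suc} (τ ∘ suc) (ω ∘ suc) (λ j j≤n → z (suc j) (s≤s j≤n))
                                      (λ j m j<n → body (suc j) m (s≤s j<n))) r′
    in _ , _ , ≤-trans (s≤s (+-mono-≤ t≤ t≤′)) (≤-reflexive (lemma (T 0) _)) ,
       again (cong not not-bottom) run run′ , r″
    where
    not-bottom : isBottom (headOf s (suc i)) ≡ false
    not-bottom rewrite tape-of i r | ≡ᵇ-refl i = isBottom-nth (content i) (n + τ 0 i)
    lemma : ∀ a b → suc (1 + a + suc b) ≡ suc (2 + a + b)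
    lemma = solve-∀

  clear-triple : ∀ i n {p ω} → p i ≡ 0 → loop i skip ∶ add i n p , ω ⟶ p , ω within suc (n * 3)
  clear-triple i n z = within-≡ (loop-triple i n {T = λ _ → 1} (λ _ → _) (λ _ → _) (λ _ _ → z) (λ _ _ _ → skip-triple))
                         (cong suc (sumTo-const n 3))

-- Polynomial-time functions

Env : ℕ → Set
Env n = Fin n → ℕ

infixr 5 _◂_

_◂_ : ∀ {n} → ℕ → Env n → Env (suc n)
(v ◂ env) fz     = v
(v ◂ env) (fs i) = env i

bool : Bool → ℕ
bool true  = 1
bool false = 0

-- 0 and 1 for the two bits, 2 beyond the end of the word.
look : List Bool → ℕ → ℕ
look []      _       = 2
look (b ∷ _) zero    = bool b
look (_ ∷ x) (suc n) = look x n

infixl 6 _⊕_ _⊖_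

-- Numerical functions of a word and n numbers.  All of them are computable
-- in polynomial time, because `sum` is the only source of iteration.
data Comp : (n : ℕ) → (List Bool → Env n → ℕ) → Set where
  one : ∀ {n} → Comp n λ _ _ → 1
  var : ∀ {n} i → Comp n λ _ env → env i
  _⊕_ : ∀ {n f g} → Comp n f → Comp n g → Comp n λ x env → f x env + g x env
  _⊖_ : ∀ {n f g} → Comp n f → Comp n g → Comp n λ x env → f x env ∸ g x env
  sum : ∀ {n f g} → Comp n f → Comp (suc n) g →
        Comp n λ x env → sumTo (f x env) λ i → g x (i ◂ env)
  inp : ∀ {n f} → Comp n f → Comp n λ x env → look x (f x env)
  ren : ∀ {m n f} (r : Fin m → Fin n) → Comp m f → Comp n λ x env → f x (env ∘ r)
  ext : ∀ {n f g} → (∀ x env → f x env ≡ g x env) → Comp n f → Comp n g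

-- Adds the value of the function to the counter d, given its arguments in the
-- counters ρ; the counters from ℓ on are free.
append : ∀ {n f} → Comp n f → ℕ → ℕ → (Fin n → ℕ) → Prog
append one         d ℓ ρ = inc d
-- Reading a counter empties it, so the variable is moved to `ℓ` and restored while it is copied to
-- `d`.
append (var i)     d ℓ ρ = loop (ρ i) (inc ℓ) ⨾ loop ℓ (inc d ⨾ inc (ρ i))
append (c ⊕ c′)    d ℓ ρ = append c d ℓ ρ ⨾ append c′ d ℓ ρ
append (c ⊖ c′)    d ℓ ρ = append c ℓ (2 + ℓ) ρ ⨾ append c′ (suc ℓ) (2 + ℓ) ρ ⨾ loop (suc ℓ) (dec ℓ) ⨾ loop ℓ (inc d)
append (sum c c′)  d ℓ ρ =
  append c ℓ (2 + ℓ) ρ ⨾ loop ℓ (append c′ d (2 + ℓ) (suc ℓ ◂ ρ) ⨾ inc (suc ℓ)) ⨾ loop (suc ℓ) skip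
-- Counter 0 is the position of the head on the input tape. Cell 0 carries the marker, hence the
-- additional `inc 0`; the head is brought back afterwards, so that it rests at 0 between lookups.
append (inp c)     d ℓ ρ = append c ℓ (suc ℓ) ρ ⨾ inc 0 ⨾ loop ℓ (inc 0) ⨾
  branch 1 isTrue (inc d) (branch 1 isBlank (inc d ⨾ inc d) skip) ⨾ loop 0 skip
append (ren r c)   d ℓ ρ = append c d ℓ (ρ ∘ r)
append (ext _ c)   d ℓ ρ = append c d ℓ ρ

cost : ∀ {n f} → Comp n f → List Bool → Env n → ℕ
cost one                   x env = 1
cost (var i)               x env = suc (env i * 3) + suc (env i * 4)
cost (c ⊕ c′)              x env = cost c x env + cost c′ x env
cost (_⊖_ {f = f} {g} c c′) x env =
  cost c x env + (cost c′ x env + (suc (g x env * 3) + suc ((f x env ∸ g x env) * 3)))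
cost (sum {f = f} c c′)    x env = cost c x env +
  (suc (sumTo (f x env) λ i → 2 + (cost c′ x (i ◂ env) + 1)) + suc (f x env * 3))
cost (inp {f = f} c)       x env =
  cost c x env + (1 + (suc (f x env * 3) + (6 + suc (suc (f x env) * 3))))
cost (ren r c)             x env = cost c x (env ∘ r)
cost (ext _ c)             x env = cost c x env

record Frame {n} (ℓ : ℕ) (ρ : Fin n → ℕ) (env : Env n) (p : Counters) : Set where
  field
    ℓ-pos  : 0 < ℓ
    ρ-<    : ∀ i → ρ i < ℓ
    input₀ : p 0 ≡ 0
    fresh  : ∀ i → ℓ ≤ i → p i ≡ 0
    values : ∀ i → p (ρ i) ≡ env i

-- The target lies below the scratch counters and is no variable, since part of the result is added
-- before all arguments have been read. Counter 0 is excluded because it is the head on the input.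
record Target {n} (d ℓ : ℕ) (ρ : Fin n → ℕ) : Set where
  field
    d-pos : 0 < d
    d-<   : d < ℓ
    ρ-≢   : ∀ i → d ≢ ρ i

open Frame
open Target

module _ {n} {ℓ : ℕ} {ρ : Fin n → ℕ} where

  target-raise : ∀ {d} k → Target d ℓ ρ → Target d (k + ℓ) ρ
  target-raise k t = record { d-pos = d-pos t ; d-< = <-≤-trans (d-< t) (m≤n+m ℓ k) ; ρ-≢ = ρ-≢ t }

  target-bind : ∀ {d e} → d ≢ e → Target d ℓ ρ → Target d ℓ (e ◂ ρ)
  target-bind ne t = record
    { d-pos = d-pos t ; d-< = d-< t ; ρ-≢ = λ { fz → ne ; (fs i) → ρ-≢ t i } }

module _ {n} {ℓ : ℕ} {ρ : Fin n → ℕ} {env : Env n} where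

  frame-add : ∀ {d v p} → Target d ℓ ρ → Frame ℓ ρ env p → Frame ℓ ρ env (add d v p)
  frame-add {d} {v} {p} t f = record
    { ℓ-pos = ℓ-pos f
    ; ρ-< = ρ-< f
    ; input₀ = trans (add-other v p (>⇒≢ (d-pos t))) (input₀ f)
    ; fresh = λ i ℓ≤i → trans (add-other v p (<⇒≢ (<-≤-trans (d-< t) ℓ≤i))) (fresh f i ℓ≤i)
    ; values = λ i → trans (add-other v p (ρ-≢ t i)) (values f i) }

  frame-raise : ∀ {p} k → Frame ℓ ρ env p → Frame (k + ℓ) ρ env p
  frame-raise k f = record
    { ℓ-pos = <-≤-trans (ℓ-pos f) (m≤n+m ℓ k)
    ; ρ-< = λ i → <-≤-trans (ρ-< f i) (m≤n+m ℓ k)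
    ; input₀ = input₀ f
    ; fresh = λ i le → fresh f i (≤-trans (m≤n+m ℓ k) le)
    ; values = values f }

  target-fresh : ∀ {p} j k → j < k → Frame ℓ ρ env p → Target (j + ℓ) (k + ℓ) ρ
  target-fresh j k j<k f = record
    { d-pos = <-≤-trans (ℓ-pos f) (m≤n+m ℓ j)
    ; d-< = +-monoˡ-< ℓ j<k
    ; ρ-≢ = λ i → >⇒≢ (<-≤-trans (ρ-< f i) (m≤n+m ℓ j)) }

  frame-bind : ∀ {e v p} → e < ℓ → p e ≡ v → Frame ℓ ρ env p → Frame ℓ (e ◂ ρ) (v ◂ env) p
  frame-bind e< eq f = record
    { ℓ-pos = ℓ-pos f ; ρ-< = λ { fz → e< ; (fs i) → ρ-< f i } ; input₀ = input₀ f ; fresh = fresh f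
    ; values = λ { fz → eq ; (fs i) → values f i } }

frame-ren : ∀ {m n ℓ} {ρ : Fin n → ℕ} {env p} (r : Fin m → Fin n) → Frame ℓ ρ env p → Frame ℓ (ρ ∘ r) (env ∘ r) p
frame-ren r f = record
  { ℓ-pos = ℓ-pos f ; ρ-< = ρ-< f ∘ r ; input₀ = input₀ f ; fresh = fresh f ; values = values f ∘ r }

target-ren : ∀ {m n d ℓ} {ρ : Fin n → ℕ} (r : Fin m → Fin n) → Target d ℓ ρ → Target d ℓ (ρ ∘ r)
target-ren r t = record { d-pos = d-pos t ; d-< = d-< t ; ρ-≢ = ρ-≢ t ∘ r }

module _ (x : List Bool) where
  open Semantics x

  const-loop : ∀ i n k {P} (τ : ℕ → Counters) {ω} →
    (∀ j → j ≤ n → τ j i ≡ 0) →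
    (∀ j m → j < n → P ∶ add i m (τ j) , ω ⟶ add i m (τ (suc j)) , ω within k) →
    loop i P ∶ add i n (τ 0) , ω ⟶ τ n , ω within suc (n * (2 + k))
  const-loop i n k τ z body = within-≡ (loop-triple i n {T = λ _ → k} τ (λ _ → _) z body)
    (cong suc (sumTo-const n (2 + k)))

  append-correct : ∀ {n f} (c : Comp n f) {d ℓ ρ env p ω} → Frame ℓ ρ env p → Target d ℓ ρ →
    append c d ℓ ρ ∶ p , ω ⟶ add d (f x env) p , ω within cost c x env
  append-correct one {d} F D = inc-triple d
  append-correct (var i) {d} {ℓ} {ρ} {env} {p} {ω} F D =
    pre unload (const-loop (ρ i) (env i) 1 (λ j → add ℓ j q) q-zero move₁) ⨾ᵗ
    post (pre (add-cong ℓ (env i) (≗-sym (≗-trans (add-0 (ρ i) _) (add-0 d q))))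
           (const-loop ℓ (env i) 2 (λ j → add (ρ i) j (add d j q)) fresh₂ move₂)) reload
    where
    -- The state with the variable emptied, relative to which both moves are described.
    q : Counters
    q j = if ρ i ≡ᵇ j then 0 else p j
    unload : p ≗ add (ρ i) (env i) (add ℓ 0 q)
    unload j rewrite single-0 ℓ j with ρ i ≡ᵇ j in eq
    ... | false = refl
    ... | true rewrite sym (≡ᵇ-true {ρ i} {j} eq) = trans (values F i) (sym (+-identityʳ _))
    ℓ≢ρ : ℓ ≢ ρ i
    ℓ≢ρ = >⇒≢ (ρ-< F i)
    q-zero : ∀ j → j ≤ env i → add ℓ j q (ρ i) ≡ 0
    q-zero j _ rewrite add-other j q ℓ≢ρ | ≡ᵇ-refl (ρ i) = refl
    move₁ : ∀ j m → j < env i → inc ℓ ∶ add (ρ i) m (add ℓ j q) , ω ⟶ add (ρ i) m (add ℓ (suc j) q) , ω within 1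
    move₁ j m _ = post (inc-triple ℓ) (≗-trans (add-swap ℓ 1 (ρ i) m _) (add-cong (ρ i) m (add-+ ℓ 1 j q)))
    qℓ : q ℓ ≡ 0
    qℓ rewrite ≢⇒≡ᵇ (≢-sym ℓ≢ρ) = fresh F ℓ ≤-refl
    fresh₂ : ∀ j → j ≤ env i → add (ρ i) j (add d j q) ℓ ≡ 0
    fresh₂ j _ = trans (add-other j (add d j q) (≢-sym ℓ≢ρ)) (trans (add-other j q (<⇒≢ (d-< D))) qℓ)
    move₂ : ∀ j m → j < env i → inc d ⨾ inc (ρ i) ∶ add ℓ m (add (ρ i) j (add d j q)) , ω ⟶
            add ℓ m (add (ρ i) (suc j) (add d (suc j) q)) , ω within 2
    move₂ j m _ = post (inc-triple d ⨾ᵗ inc-triple (ρ i)) λ k → trans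
      (lemma (single (ρ i) 1 k) (single d 1 k) (single ℓ m k) (single (ρ i) j k) (single d j k) (q k))
      (cong₂ (λ a b → single ℓ m k + (a + (b + q k))) (sym (single-+ (ρ i) 1 j k)) (sym (single-+ d 1 j k)))
      where
      lemma : ∀ a b c e f g → a + (b + (c + (e + (f + g)))) ≡ c + ((a + e) + ((b + f) + g))
      lemma = solve-∀
    reload : add (ρ i) (env i) (add d (env i) q) ≗ add d (env i) p
    reload j = trans (add-swap (ρ i) (env i) d (env i) q j)
      (cong (single d (env i) j +_) (sym (trans (unload j) (cong (single (ρ i) (env i) j +_) (add-0 ℓ q j)))))
  append-correct (_⊕_ {f = f} {g} c c′) {d} {p = p} F D =
    post (append-correct c F D ⨾ᵗ append-correct c′ (frame-add D F) D)
      (≗-trans (add-+ d _ _ p) λ i → cong (λ v → add d v p i) (+-comm (g x _) (f x _)))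
  append-correct (_⊖_ {f = f} {g} c c′) {d} {ℓ} {ρ} {env} {p} {ω} F D =
    append-correct c (frame-raise 2 F) target₀ ⨾ᵗ
    append-correct c′ (frame-add target₀ (frame-raise 2 F)) (target-fresh 1 2 ≤-refl F) ⨾ᵗ
    const-loop (suc ℓ) (g x env) 1 (λ j → add ℓ (f x env ∸ j) p)
      (λ j _ → trans (add-other _ p (<⇒≢ ≤-refl)) (fresh F (suc ℓ) (n≤1+n ℓ)))
      (λ j m _ → post (pre (add-swap (suc ℓ) m ℓ _ p) (pred-triple (f x env ∸ j)
                  (trans (add-other m p (>⇒≢ ≤-refl)) (fresh F ℓ ≤-refl))))
                  (≗-trans (add-swap ℓ _ (suc ℓ) m p)
                    (add-cong (suc ℓ) m λ i → cong (λ v → add ℓ v p i) (pred[m∸n]≡m∸[1+n] (f x env) j)))) ⨾ᵗ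
    pre (add-cong ℓ (f x env ∸ g x env) (≗-sym (add-0 d p)))
      (const-loop ℓ (f x env ∸ g x env) 1 (λ j → add d j p)
        (λ j _ → trans (add-other j p (<⇒≢ (d-< D))) (fresh F ℓ ≤-refl))
        (λ j m _ → post (inc-triple d) (≗-trans (add-swap d 1 ℓ m _) (add-cong ℓ m (add-+ d 1 j p)))))
    where
    target₀ : Target ℓ (2 + ℓ) ρ
    target₀ = target-fresh 0 2 (s≤s z≤n) F
    pred-triple : ∀ k {q} → q ℓ ≡ 0 → dec ℓ ∶ add ℓ k q , ω ⟶ add ℓ (pred k) q , ω within 1
    pred-triple zero    {q} z = dec-zero ℓ (trans (add-0 ℓ q ℓ) z)
    pred-triple (suc k)     z = pre (≗-sym (add-+ ℓ 1 k _)) (dec-triple ℓ)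
  append-correct (sum {f = f} {g} c c′) {d} {ℓ} {ρ} {env} {p} {ω} F D =
    append-correct c (frame-raise 2 F) (target-fresh 0 2 (s≤s z≤n) F) ⨾ᵗ
    pre (add-cong ℓ v (≗-sym (≗-trans (add-0 (suc ℓ) _) (add-0 d p))))
      (loop-triple ℓ v τ (λ _ → ω)
        (λ j _ → trans (add-other {suc ℓ} {ℓ} j (add d (sumTo j h) p) (>⇒≢ ≤-refl)) (d-zero ℓ ≤-refl))
        body) ⨾ᵗ
    clear-triple (suc ℓ) v (d-zero (suc ℓ) (n≤1+n ℓ))
    where
    v = f x env
    h : ℕ → ℕ
    h j = g x (j ◂ env)
    -- After `j` rounds the bound variable, on counter `suc ℓ`, is `j`, and the target has received
    -- the first `j` summands.
    τ : ℕ → Counters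
    τ j = add (suc ℓ) j (add d (sumTo j h) p)
    d-zero : ∀ {u} i → ℓ ≤ i → add d u p i ≡ 0
    d-zero i ℓ≤i = trans (add-other _ p (<⇒≢ (<-≤-trans (d-< D) ℓ≤i))) (fresh F i ℓ≤i)
    bound-value : ∀ j m → add ℓ m (τ j) (suc ℓ) ≡ j
    bound-value j m = trans (add-other {ℓ} m (τ j) (<⇒≢ ≤-refl)) (trans (add-same (suc ℓ) j (add d (sumTo j h) p))
      (trans (cong (j +_) (d-zero {sumTo j h} (suc ℓ) (n≤1+n ℓ))) (+-identityʳ j)))
    frame : ∀ j m → Frame (2 + ℓ) (suc ℓ ◂ ρ) (j ◂ env) (add ℓ m (τ j))
    frame j m = frame-bind ≤-refl (bound-value j m)
      (frame-add {v = m} (target-fresh 0 2 (s≤s z≤n) F) (frame-add {v = j} {p = add d (sumTo j h) p} (target-fresh 1 2 ≤-refl F)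
        (frame-raise 2 (frame-add D F))))
    body : ∀ j m → j < v → append c′ d (2 + ℓ) (suc ℓ ◂ ρ) ⨾ inc (suc ℓ) ∶
           add ℓ m (τ j) , ω ⟶ add ℓ m (τ (suc j)) , ω within cost c′ x (j ◂ env) + 1
    body j m _ = post (append-correct c′ (frame j m) (target-bind (<⇒≢ (<-trans (d-< D) ≤-refl)) (target-raise 2 D))
                       ⨾ᵗ inc-triple (suc ℓ)) λ k → trans
      (lemma (single (suc ℓ) 1 k) (single d (h j) k) (single ℓ m k) (single (suc ℓ) j k) (single d (sumTo j h) k) (p k))
      (cong₂ (λ a b → single ℓ m k + (a + (b + p k))) (sym (single-+ (suc ℓ) 1 j k))
        (sym (trans (cong (λ u → single d u k) (sumTo-last j h)) (single-+ d (sumTo j h) (h j) k))))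
      where
      lemma : ∀ a b c e f g → a + (b + (c + (e + (f + g)))) ≡ c + ((a + e) + ((f + b) + g))
      lemma = solve-∀
  append-correct (inp {f = f} c) {d} {ℓ} {ρ} {env} {p} {ω} F D =
    append-correct c (frame-raise 1 F) (target-fresh 0 1 ≤-refl F) ⨾ᵗ
    inc-triple 0 ⨾ᵗ
    pre (add-swap 0 1 ℓ v p) (const-loop ℓ v 1 (λ j → add 0 (suc j) p)
      (λ j _ → trans (add-other _ p (<⇒≢ (ℓ-pos F))) (fresh F ℓ ≤-refl))
      (λ j m _ → post (inc-triple 0) (≗-trans (add-swap 0 1 ℓ m _) (add-cong ℓ m (add-+ 0 1 (suc j) p))))) ⨾ᵗ
    branch-triple 0 isTrue (λ t → post (inc-triple d) (look-≗ (look-true x v (trans (sym (cong isTrue head₀)) t))))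
      (λ f → branch-triple 0 isBlank
        (λ t → post (inc-triple d ⨾ᵗ inc-triple d) (≗-trans (add-+ d 1 1 _)
                 (look-≗ (look-blank x v (trans (sym (cong isBlank head₀)) t)))))
        (λ f′ → post skip-triple (≗-trans (≗-sym (add-0 d _))
                 (look-≗ (look-false x v (trans (sym (cong isTrue head₀)) f) (trans (sym (cong isBlank head₀)) f′)))))) ⨾ᵗ
    pre (add-swap d _ 0 _ p) (clear-triple 0 (suc v) (trans (add-other _ p (>⇒≢ (d-pos D))) (input₀ F)))
    where
    v = f x env
    head₀ : cell x (suc v + p 0) ≡ nth x v
    head₀ = cong (nth x) (trans (cong (v +_) (input₀ F)) (+-identityʳ v))
    look-≗ : ∀ {a b q} → a ≡ b → add d a q ≗ add d b q
    look-≗ refl i = refl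
    look-true : ∀ x n → isTrue (nth x n) ≡ true → 1 ≡ look x n
    look-true (true ∷ x) zero    eq = refl
    look-true (_ ∷ x)    (suc n) eq = look-true x n eq
    look-blank : ∀ x n → isBlank (nth x n) ≡ true → 2 ≡ look x n
    look-blank []      n       eq = refl
    look-blank (_ ∷ x) (suc n) eq = look-blank x n eq
    look-false : ∀ x n → isTrue (nth x n) ≡ false → isBlank (nth x n) ≡ false → 0 ≡ look x n
    look-false (false ∷ x) zero    eq eq′ = refl
    look-false (_ ∷ x)     (suc n) eq eq′ = look-false x n eq eq′
  append-correct (ren r c) F D = append-correct c (frame-ren r F) (target-ren r D)
  append-correct (ext eq c) {d} {p = p} F D =
    post (append-correct c F D) λ i → cong (λ v → add d v p i) (eq x _)

-- Polynomial bounds on values and running times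

-- A record, so that the exponent can be inferred.
infix 4 _≤_↑_

record _≤_↑_ (v N e : ℕ) : Set where
  constructor bounded
  field unbounded : v ≤ N ^ e

open _≤_↑_

module Power {N} (2≤N : 2 ≤ N) where

  private instance
    N-nonZero : NonZero N
    N-nonZero = >-nonZero (<-trans (s≤s z≤n) 2≤N)

  below : ∀ {v w a} → v ≤ w → w ≤ N ↑ a → v ≤ N ↑ a
  below v≤w le = bounded (≤-trans v≤w (unbounded le))

  itself : N ≤ N ↑ 1
  itself = bounded (≤-reflexive (sym (^-identityʳ N)))

  -- Doubling costs at most one factor `N`, as `2 ≤ N`; the same estimate gives `plus`.
  const : ∀ c → c ≤ N ↑ c
  const zero    = bounded z≤n
  const (suc c) = bounded (begin
    1 + c         ≤⟨ +-mono-≤ (m^n>0 N c) (unbounded (const c)) ⟩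
    N ^ c + N ^ c ≡⟨ cong (N ^ c +_) (+-identityʳ (N ^ c)) ⟨
    2 * N ^ c     ≤⟨ *-monoˡ-≤ (N ^ c) 2≤N ⟩
    N * N ^ c     ∎)
    where open ≤-Reasoning

  times : ∀ {v w a b} → v ≤ N ↑ a → w ≤ N ↑ b → v * w ≤ N ↑ (a + b)
  times {a = a} {b} le le′ =
    bounded (≤-trans (*-mono-≤ (unbounded le) (unbounded le′)) (≤-reflexive (sym (^-distribˡ-+-* N a b))))

  plus : ∀ {v w a b} → v ≤ N ↑ a → w ≤ N ↑ b → v + w ≤ N ↑ suc (a + b)
  plus {v} {w} {a} {b} le le′ = bounded (begin
    v + w                     ≤⟨ +-mono-≤ (≤-trans (unbounded le) (^-monoʳ-≤ N (m≤m+n a b)))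
                                          (≤-trans (unbounded le′) (^-monoʳ-≤ N (m≤n+m b a))) ⟩
    N ^ (a + b) + N ^ (a + b) ≡⟨ cong (N ^ (a + b) +_) (+-identityʳ _) ⟨
    2 * N ^ (a + b)           ≤⟨ *-monoˡ-≤ (N ^ (a + b)) 2≤N ⟩
    N ^ suc (a + b)           ∎)
    where open ≤-Reasoning

  sums : ∀ {f a b} n → n ≤ N ↑ a → (∀ i → i < n → f i ≤ N ↑ b) → sumTo n f ≤ N ↑ (a + b)
  sums {b = b} n le le′ = below
    (≤-trans (sumTo-mono n λ i i<n → unbounded (le′ i i<n)) (≤-reflexive (sumTo-const n (N ^ b))))
    (times {b = b} le (bounded ≤-refl))

-- The exponent is uniform in the word, whose length does not enter because `look` returns at most
-- 2; only the variables have to be bounded by `N`.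
Bound : ∀ {n} → (List Bool → Env n → ℕ) → Set
Bound {n} f = ∃[ e ] ∀ x env N → 2 ≤ N → (∀ i → env i ≤ N) → f x env ≤ N ↑ e

-- The bound variable stays below a power of `N`, so the bound for the body is applied with that
-- power as its base. The exponent is `suc a` in order that the base also dominates the old
-- variables, even if `a` is 0.
bound-bind : ∀ {n f} {g : List Bool → Env (suc n) → ℕ} → Bound f → Bound g →
  ∃[ e ] ∀ x env N → 2 ≤ N → (∀ i → env i ≤ N) → ∀ i → i < f x env → g x (i ◂ env) ≤ N ↑ e
bound-bind (a , F) (b , G) = suc a * b , λ x env N 2≤N env≤ i i< →
  let instance _ = >-nonZero (<-trans (s≤s z≤n) 2≤N)
      N≤ = ≤-trans (≤-reflexive (sym (^-identityʳ N))) (^-monoʳ-≤ N {1} {suc a} (s≤s z≤n))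
      i≤ = ≤-trans (<⇒≤ i<) (≤-trans (unbounded (F x env N 2≤N env≤)) (^-monoʳ-≤ N (n≤1+n a)))
  in bounded (≤-trans
       (unbounded (G x _ (N ^ suc a) (≤-trans 2≤N N≤) λ { fz → i≤ ; (fs j) → ≤-trans (env≤ j) N≤ }))
       (≤-reflexive (^-*-assoc N (suc a) b)))

value-bound : ∀ {n f} → Comp n f → Bound f
value-bound one       = 1 , λ x env N 2≤N env≤ → Power.const 2≤N 1
value-bound (var i)   = 1 , λ x env N 2≤N env≤ → Power.below 2≤N (env≤ i) (Power.itself 2≤N)
value-bound (c ⊕ c′)  =
  let (_ , F) = value-bound c ; (_ , G) = value-bound c′
  in _ , λ x env N 2≤N env≤ → Power.plus 2≤N (F x env N 2≤N env≤) (G x env N 2≤N env≤)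
value-bound (_⊖_ {f = f} {g} c c′) =
  let (_ , F) = value-bound c
  in _ , λ x env N 2≤N env≤ → Power.below 2≤N (m∸n≤m (f x env) (g x env)) (F x env N 2≤N env≤)
value-bound (sum {f = f} c c′) =
  let (_ , F) = value-bound c ; (_ , G) = bound-bind (value-bound c) (value-bound c′)
  in _ , λ x env N 2≤N env≤ → Power.sums 2≤N (f x env) (F x env N 2≤N env≤) (G x env N 2≤N env≤)
value-bound (inp {f = f} c) = 2 , λ x env N 2≤N env≤ → Power.below 2≤N (look-≤ x (f x env)) (Power.const 2≤N 2)
  where
  look-≤ : ∀ x n → look x n ≤ 2
  look-≤ []          n       = ≤-refl
  look-≤ (false ∷ _) zero    = z≤n
  look-≤ (true ∷ _)  zero    = s≤s z≤n
  look-≤ (_ ∷ x)     (suc n) = look-≤ x n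
value-bound (ren r c) =
  let (_ , F) = value-bound c in _ , λ x env N 2≤N env≤ → F x (env ∘ r) N 2≤N (env≤ ∘ r)
value-bound (ext eq c) =
  let (_ , F) = value-bound c
  in _ , λ x env N 2≤N env≤ → Power.below 2≤N (≤-reflexive (sym (eq x env))) (F x env N 2≤N env≤)

cost-bound : ∀ {n f} (c : Comp n f) → Bound (cost c)
cost-bound one       = 1 , λ x env N 2≤N env≤ → Power.const 2≤N 1
cost-bound (var i)   = _ , λ x env N 2≤N env≤ →
  let open Power 2≤N ; v≤ = below (env≤ i) itself
  in plus (plus (const 1) (times v≤ (const 3))) (plus (const 1) (times v≤ (const 4)))
cost-bound (c ⊕ c′)  =
  let (_ , F) = cost-bound c ; (_ , G) = cost-bound c′
  in _ , λ x env N 2≤N env≤ → Power.plus 2≤N (F x env N 2≤N env≤) (G x env N 2≤N env≤)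
cost-bound (c ⊖ c′)  =
  let (_ , F) = cost-bound c ; (_ , G) = cost-bound c′ ; (_ , V) = value-bound c′ ; (_ , W) = value-bound (c ⊖ c′)
  in _ , λ x env N 2≤N env≤ → let open Power 2≤N in
    plus (F x env N 2≤N env≤) (plus (G x env N 2≤N env≤)
      (plus (plus (const 1) (times (V x env N 2≤N env≤) (const 3)))
            (plus (const 1) (times (W x env N 2≤N env≤) (const 3)))))
cost-bound (sum {f = f} c c′) =
  let (_ , F) = cost-bound c ; (_ , V) = value-bound c ; (_ , G) = bound-bind (value-bound c) (cost-bound c′)
  in _ , λ x env N 2≤N env≤ → let open Power 2≤N in
    plus (F x env N 2≤N env≤)
      (plus (plus (const 1) (sums (f x env) (V x env N 2≤N env≤)
                    λ i i< → plus (const 2) (plus (G x env N 2≤N env≤ i i<) (const 1))))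
            (plus (const 1) (times (V x env N 2≤N env≤) (const 3))))
cost-bound (inp c)   =
  let (_ , F) = cost-bound c ; (_ , V) = value-bound c
  in _ , λ x env N 2≤N env≤ → let open Power 2≤N in
    plus (F x env N 2≤N env≤) (plus (const 1)
      (plus (plus (const 1) (times (V x env N 2≤N env≤) (const 3)))
        (plus (const 6) (plus (const 1) (times (plus (const 1) (V x env N 2≤N env≤)) (const 3))))))
cost-bound (ren r c) =
  let (_ , F) = cost-bound c in _ , λ x env N 2≤N env≤ → F x (env ∘ r) N 2≤N (env≤ ∘ r)
cost-bound (ext _ c) = cost-bound c

-- Printing words

data Out (n : ℕ) : Set where
  emit : ∀ {f} → Comp n f → Out n
  for  : ∀ {f} → Comp n f → Out (suc n) → Out n
  _▷_  : Out n → Out n → Out n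

infixr 5 _▷_

concatTo : ℕ → (ℕ → List Bool) → List Bool
concatTo zero    f = []
concatTo (suc n) f = f 0 ++ concatTo n (f ∘ suc)

concatTo-last : ∀ n f → concatTo (suc n) f ≡ concatTo n f ++ f n
concatTo-last zero    f = List.++-identityʳ (f 0)
concatTo-last (suc n) f = trans (cong (f 0 ++_) (concatTo-last n (f ∘ suc))) (sym (List.++-assoc (f 0) _ _))

length-concatTo : ∀ n f → length (concatTo n f) ≡ sumTo n (length ∘ f)
length-concatTo zero    f = refl
length-concatTo (suc n) f = trans (List.length-++ (f 0)) (cong (length (f 0) +_) (length-concatTo n (f ∘ suc)))

positive : ℕ → Bool
positive zero    = false
positive (suc _) = true

⟦_⟧ : ∀ {n} → Out n → List Bool → Env n → List Bool
⟦ emit {f} c ⟧  x env = positive (f x env) ∷ []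
⟦ for {f} c o ⟧ x env = concatTo (f x env) λ i → ⟦ o ⟧ x (i ◂ env)
⟦ o ▷ o′ ⟧      x env = ⟦ o ⟧ x env ++ ⟦ o′ ⟧ x env

print : ∀ {n} → Out n → ℕ → (Fin n → ℕ) → Prog
print (emit c)  ℓ ρ = append c ℓ (suc ℓ) ρ ⨾ branch (suc ℓ) isBottom (put false) (put true) ⨾ loop ℓ skip
print (for c o) ℓ ρ =
  append c ℓ (2 + ℓ) ρ ⨾ loop ℓ (print o (2 + ℓ) (suc ℓ ◂ ρ) ⨾ inc (suc ℓ)) ⨾ loop (suc ℓ) skip
print (o ▷ o′)  ℓ ρ = print o ℓ ρ ⨾ print o′ ℓ ρ

print-cost : ∀ {n} → Out n → List Bool → Env n → ℕ
print-cost (emit {f} c)  x env = cost c x env + (3 + suc (f x env * 3))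
print-cost (for {f} c o) x env = cost c x env +
  (suc (sumTo (f x env) λ i → 2 + (print-cost o x (i ◂ env) + 1)) + suc (f x env * 3))
print-cost (o ▷ o′)      x env = print-cost o x env + print-cost o′ x env

print-cost-bound : ∀ {n} (o : Out n) → Bound (print-cost o)
print-cost-bound (emit c)  =
  let (_ , F) = cost-bound c ; (_ , V) = value-bound c
  in _ , λ x env N 2≤N env≤ → let open Power 2≤N in
    plus (F x env N 2≤N env≤) (plus (const 3) (plus (const 1) (times (V x env N 2≤N env≤) (const 3))))
print-cost-bound (for {f} c o) =
  let (_ , F) = cost-bound c ; (_ , V) = value-bound c ; (_ , G) = bound-bind (value-bound c) (print-cost-bound o)
  in _ , λ x env N 2≤N env≤ → let open Power 2≤N in
    plus (F x env N 2≤N env≤)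
      (plus (plus (const 1) (sums (f x env) (V x env N 2≤N env≤)
                    λ i i< → plus (const 2) (plus (G x env N 2≤N env≤ i i<) (const 1))))
            (plus (const 1) (times (V x env N 2≤N env≤) (const 3))))
print-cost-bound (o ▷ o′) =
  let (_ , F) = print-cost-bound o ; (_ , G) = print-cost-bound o′
  in _ , λ x env N 2≤N env≤ → Power.plus 2≤N (F x env N 2≤N env≤) (G x env N 2≤N env≤)

-- Bounds the time that `finish` takes to rewind the output.
length-≤-cost : ∀ {n} (o : Out n) x env → length (⟦ o ⟧ x env) ≤ print-cost o x env
length-≤-cost (emit c)      x env = ≤-trans (s≤s z≤n) (m≤n+m _ (cost c x env))
length-≤-cost (for {f} c o) x env = begin
  length (concatTo (f x env) _)                                  ≡⟨ length-concatTo (f x env) _ ⟩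
  sumTo (f x env) (λ i → length (⟦ o ⟧ x (i ◂ env)))             ≤⟨ sumTo-mono (f x env) (λ i _ →
      ≤-trans (length-≤-cost o x (i ◂ env)) (≤-trans (m≤m+n _ 1) (m≤n+m _ 2))) ⟩
  sumTo (f x env) (λ i → 2 + (print-cost o x (i ◂ env) + 1))     ≤⟨ n≤1+n _ ⟩
  suc (sumTo (f x env) λ i → 2 + (print-cost o x (i ◂ env) + 1)) ≤⟨ m≤m+n _ _ ⟩
  _                                                              ≤⟨ m≤n+m _ (cost c x env) ⟩
  print-cost (for c o) x env                                     ∎
  where open ≤-Reasoning
length-≤-cost (o ▷ o′)      x env = ≤-trans (≤-reflexive (List.length-++ (⟦ o ⟧ x env)))
  (+-mono-≤ (length-≤-cost o x env) (length-≤-cost o′ x env))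

module _ (x : List Bool) where
  open Semantics x

  written-≡ : ∀ {P A p ω ω′ T} → ω ≡ ω′ → P ∶ A ⟶ p , ω within T → P ∶ A ⟶ p , ω′ within T
  written-≡ refl h = h

  print-correct : ∀ {n} (o : Out n) {ℓ ρ env p ω} → Frame ℓ ρ env p →
    print o ℓ ρ ∶ p , ω ⟶ p , ⟦ o ⟧ x env ʳ++ ω within print-cost o x env
  print-correct (emit {f} c) {ℓ} {ρ} {env} {p} {ω} F =
    append-correct x c (frame-raise 1 F) (target-fresh 0 1 ≤-refl F) ⨾ᵗ
    branch-triple ℓ isBottom
      (λ b → written-≡ (cong (_∷ ω) (sym (bottom (f x env) (trans (cong (isBottom ∘ cell (content ℓ)) (sym value)) b)))) (put-triple false))
      (λ b → written-≡ (cong (_∷ ω) (sym (above (f x env) (trans (cong (isBottom ∘ cell (content ℓ)) (sym value)) b)))) (put-triple true)) ⨾ᵗ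
    clear-triple ℓ (f x env) (Frame.fresh F ℓ ≤-refl)
    where
    value : add ℓ (f x env) p ℓ ≡ f x env
    value = trans (add-same ℓ _ p) (trans (cong (f x env +_) (Frame.fresh F ℓ ≤-refl)) (+-identityʳ _))
    bottom : ∀ n → isBottom (cell (content ℓ) n) ≡ true → positive n ≡ false
    bottom zero    _  = refl
    bottom (suc n) eq with trans (sym eq) (isBottom-nth (content ℓ) n)
    ... | ()
    above : ∀ n → isBottom (cell (content ℓ) n) ≡ false → positive n ≡ true
    above (suc n) _ = refl
  print-correct (for {f} c o) {ℓ} {ρ} {env} {p} {ω} F =
    append-correct x c (frame-raise 2 F) (target-fresh 0 2 (s≤s z≤n) F) ⨾ᵗ
    pre (add-cong ℓ v (≗-sym (add-0 (suc ℓ) p)))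
      (loop-triple ℓ v (λ j → add (suc ℓ) j p) (λ j → concatTo j h ʳ++ ω)
        (λ j _ → trans (add-other j p (>⇒≢ ≤-refl)) (Frame.fresh F ℓ ≤-refl))
        body) ⨾ᵗ
    clear-triple (suc ℓ) v (Frame.fresh F (suc ℓ) (n≤1+n ℓ))
    where
    v = f x env
    h : ℕ → List Bool
    h j = ⟦ o ⟧ x (j ◂ env)
    bound-value : ∀ j m → add ℓ m (add (suc ℓ) j p) (suc ℓ) ≡ j
    bound-value j m = trans (add-other {ℓ} m (add (suc ℓ) j p) (<⇒≢ ≤-refl)) (trans (add-same (suc ℓ) j p)
      (trans (cong (j +_) (Frame.fresh F (suc ℓ) (n≤1+n ℓ))) (+-identityʳ j)))
    frame : ∀ j m → Frame (2 + ℓ) (suc ℓ ◂ ρ) (j ◂ env) (add ℓ m (add (suc ℓ) j p))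
    frame j m = frame-bind ≤-refl (bound-value j m)
      (frame-add (target-fresh 0 2 (s≤s z≤n) F) (frame-add (target-fresh 1 2 ≤-refl F) (frame-raise 2 F)))
    body : ∀ j m → j < v → print o (2 + ℓ) (suc ℓ ◂ ρ) ⨾ inc (suc ℓ) ∶
           add ℓ m (add (suc ℓ) j p) , concatTo j h ʳ++ ω ⟶
           add ℓ m (add (suc ℓ) (suc j) p) , concatTo (suc j) h ʳ++ ω within print-cost o x (j ◂ env) + 1
    body j m _ = written-≡ (sym (trans (cong (_ʳ++ ω) (concatTo-last j h)) (List.++-ʳ++ (concatTo j h))))
      (post (print-correct o (frame j m) ⨾ᵗ inc-triple (suc ℓ))
        (≗-trans (add-swap (suc ℓ) 1 ℓ m _) (add-cong ℓ m (add-+ (suc ℓ) 1 j p))))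
  print-correct (o ▷ o′) {ω = ω} F =
    written-≡ (sym (List.++-ʳ++ (⟦ o ⟧ x _))) (print-correct o F ⨾ᵗ print-correct o′ F)

-- Preparation of the tapes and the complete machine

isBit : Sym → Bool
isBit (bit _) = true
isBit _       = false

-- The input arrives on the tape that also carries the output. It is copied to tape 1, while counter
-- 1, on tape 2, records its length. The marker that is then written behind it on tape 0 separates
-- it from the output and lets `finish` find the start of the output.
copyBits setup finish : Prog
copyBits = while 0 isBit
  (branch 0 isTrue (write 1 λ _ → bit true , right) (write 1 λ _ → bit false , right) ⨾ inc 1 ⨾ write 0 (_, right))
setup    = inc 0 ⨾ copyBits ⨾ write 0 (λ _ → ⊢ , right) ⨾ loop 0 skip
finish   = while 0 (not ∘ isBottom) (write 0 (_, left)) ⨾ write 0 (_, right)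

bottoms : ℕ → Prog
bottoms zero    = skip
bottoms (suc k) = write (suc k) (λ _ → ⊢ , stay) ⨾ bottoms k

bottomTape : Tape 1
bottomTape = tape [] ⊢ []

bottoms-correct : ∀ k s → (∀ j → j < k → s (suc j) ≡ blankTape) → (∀ j → k ≤ j → s (suc j) ≡ bottomTape) →
  ∃[ s′ ] Run (bottoms k) s s′ (suc k) × s′ 0 ≡ s 0 × (∀ j → s′ (suc j) ≡ bottomTape)
bottoms-correct zero    s _  bs = _ , write , refl , λ j → bs j z≤n
bottoms-correct (suc k) s bl bs =
  let (s′ , run , z , h) = bottoms-correct k _ below above in s′ , write ⨾ run , z , h
  where
  s₁ = update (suc k) (act (⊢ , stay) (s (suc k))) s
  below : ∀ j → j < k → s₁ (suc j) ≡ blankTape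
  below j j<k rewrite ≢⇒≡ᵇ (>⇒≢ j<k) = bl j (<-trans j<k ≤-refl)
  above : ∀ j → k ≤ j → s₁ (suc j) ≡ bottomTape
  above j k≤j with k ≡ᵇ j in eq
  ... | true  = cong (act (⊢ , stay)) (bl k ≤-refl)
  ... | false = bs j (≤∧≢⇒< k≤j λ k≡j → case-⊥ (trans (sym (≡ᵇ-refl k)) (trans (cong (k ≡ᵇ_) k≡j) eq)))
    where
    case-⊥ : ∀ {A : Set} → true ≡ false → A
    case-⊥ ()

bottom-counter : Counter [] 0 bottomTape
bottom-counter = record { before-≡ = refl ; head-≡ = refl ; after-≡ = λ _ → refl }

scan : List Sym → List Bool → Tape 1
scan g r = let (y , ys) = uncons (List.map bit r) in tape g y ys

module _ (x : List Bool) where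

  record Copied (j : ℕ) (s : Tapes) : Set where
    field
      input-tape  : s 1 ≡ tape (leftOf x (suc j)) blank []
      length-tape : Counter [] j (s 2)
      other-tapes : ∀ i → s (3 + i) ≡ bottomTape

  open Copied

  copyBits-correct : ∀ r j g {s} → j + length r ≡ length x → (∀ i → nth x (j + i) ≡ nth r i) →
    s 0 ≡ scan g r → Copied j s →
    ∃[ s′ ] ∃[ g′ ] Run copyBits s s′ (suc (length r * 5)) × s′ 0 ≡ tape g′ blank [] ×
                    Copied (length x) s′ × (∀ i → nth x (length x + i) ≡ blank)
  copyBits-correct [] j g {s} len rest out c =
    s , g , done (cong (isBit ∘ Tape.head) out) , out , subst (λ n → Copied n s) len′ c ,
    λ i → trans (cong (λ n → nth x (n + i)) (sym len′)) (rest i)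
    where
    len′ : j ≡ length x
    len′ = trans (sym (+-identityʳ j)) len
  copyBits-correct (b ∷ r) j g {s} len rest out c =
    let (s′ , g′ , run , h) = copyBits-correct r (suc j) (bit b ∷ g) {s₃}
                                (trans (sym (+-suc j _)) len)
                                (λ i → trans (cong (nth x) (sym (+-suc j i))) (rest (suc i)))
                                (cong (λ t → act (Tape.head t , right) t) out)
                                (record { input-tape = input′ ; length-tape = go-right (length-tape c)
                                        ; other-tapes = other-tapes c })
    in s′ , g′ , again (cong (isBit ∘ Tape.head) out) (copy b (cong (isTrue ∘ Tape.head) out) ⨾ write ⨾ write) run , h
    where
    s₁ = update 1 (act (bit b , right) (s 1)) s
    s₂ = update 2 (act (headOf s₁ 2 , right) (s₁ 2)) s₁
    s₃ = update 0 (act (headOf s₂ 0 , right) (s₂ 0)) s₂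
    copy : ∀ b → isTrue (headOf s 0) ≡ b →
           Run (branch 0 isTrue (write 1 λ _ → bit true , right) (write 1 λ _ → bit false , right)) s
               (update 1 (act (bit b , right) (s 1)) s) 2
    copy true  e = then- e write
    copy false e = else- e write
    input′ : act (bit b , right) (s 1) ≡ tape (leftOf x (suc (suc j))) blank []
    input′ = trans (cong (act (bit b , right)) (input-tape c))
      (cong (λ y → tape (y ∷ leftOf x (suc j)) blank []) (trans (sym (rest 0)) (cong (nth x) (+-identityʳ j))))

  startCounters : Counters
  startCounters = add 1 (length x) (λ _ → 0)

  open Semantics x

  copied-input : ∀ {s} → Copied (length x) s → (∀ i → nth x (length x + i) ≡ blank) → Counter x (suc (length x)) (s 1)
  copied-input c end = record
    { before-≡ = cong Tape.before (input-tape c)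
    ; head-≡   = trans (cong Tape.head (input-tape c)) (sym (trans (cong (nth x) (sym (+-identityʳ _))) (end 0)))
    ; after-≡  = λ i → trans (cong (λ t → peek (Tape.after t) i) (input-tape c))
                   (sym (trans (cong (nth x) (sym (+-suc (length x) i))) (end (suc i)))) }

  setup-correct : ∀ {s} → s 0 ≡ inputTape x → (∀ j → s (suc j) ≡ bottomTape) →
    ∃[ s′ ] ∃[ t ] t ≤ 20 * (1 + length x) × Run setup s s′ t × Represents startCounters [] s′
  setup-correct {s} in₀ bs =
    let (s₂ , g , run , out , c , end) = copyBits-correct x 0 [] refl (λ _ → refl) in₀ copied₀
        s₃ = update 0 (act (⊢ , right) (s₂ 0)) s₂
        rep = record
          { counters = λ
              { 0 → subst (λ n → Counter x (suc n) (s₃ 1)) (sym (+-identityʳ _)) (copied-input c end)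
              ; 1 → subst (λ n → Counter [] n (s₃ 2)) (sym (+-identityʳ _)) (length-tape c)
              ; (suc (suc i)) → subst (Counter [] 0) (sym (other-tapes c i)) bottom-counter }
          ; garbage = g ; output-≡ = cong (act (⊢ , right)) out }
        (s₄ , t , t≤ , run′ , rep′) = _∶_⟶_within_.execute (clear-triple 0 (suc (length x)) {startCounters} refl) {s₃} rep
    in s₄ , _ , ≤-trans (s≤s (s≤s (+-monoʳ-≤ (length x * 5) (s≤s t≤)))) (bound (length x)) , write ⨾ run ⨾ write ⨾ run′ , rep′
    where
    bound : ∀ n → 2 + (n * 5 + (1 + suc (suc n * 3))) ≤ 20 * (1 + n)
    bound n = ≤-trans (m≤m+n _ (13 + 12 * n)) (≤-reflexive (lemma n))
      where
      lemma : ∀ n → 2 + (n * 5 + (1 + suc (suc n * 3))) + (13 + 12 * n) ≡ 20 * (1 + n)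
      lemma = solve-∀
    copied₀ : Copied 0 (update 1 (act (headOf s 1 , right) (s 1)) s)
    copied₀ = record
      { input-tape = cong (λ t → act (Tape.head t , right) t) (bs 0)
      ; length-tape = subst (Counter [] 0) (sym (bs 1)) bottom-counter
      ; other-tapes = λ i → bs (2 + i) }

rewind-correct : ∀ ω v {g y ys s} → s 0 ≡ tape (List.map bit ω ++ ⊢ ∷ g) y ys → isBottom y ≡ false →
  y ∷ ys ≡ List.map bit v ++ blank ∷ [] →
  ∃[ s′ ] Run (while 0 (not ∘ isBottom) (write 0 (_, left))) s s′ (suc (suc (length ω) * 2)) ×
          s′ 0 ≡ tape g ⊢ (List.map bit (ω ʳ++ v) ++ blank ∷ [])
rewind-correct [] v {g} {s = s} out nb eq =
  _ , again (cong not (trans (cong (isBottom ∘ Tape.head) out) nb)) write (done (cong (not ∘ isBottom ∘ Tape.head) out′)) ,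
  trans out′ (cong (tape g ⊢) eq)
  where
  out′ = cong (λ t → act (Tape.head t , left) t) out
rewind-correct (b ∷ ω) v out nb eq =
  let (s′ , run , h) = rewind-correct ω (b ∷ v) (cong (λ t → act (Tape.head t , left) t) out) refl (cong (bit b ∷_) eq)
  in s′ , again (cong not (trans (cong (isBottom ∘ Tape.head) out) nb)) write run , h

finish-correct : ∀ ω {g s} → s 0 ≡ tape (List.map bit ω ++ ⊢ ∷ g) blank [] →
  ∃[ s′ ] Run finish s s′ (suc (suc (length ω) * 2) + 1) × outputTape (s′ 0) ≡ reverse ω
finish-correct ω {g} out =
  let (s′ , run , eq) = rewind-correct ω [] out refl refl
  in _ , run ⨾ write , trans (cong (λ t → outputTape (act (Tape.head t , right) t)) eq) (bits (reverse ω))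
  where
  leading : ∀ v → leadingBits {1} (List.map bit v ++ blank ∷ []) ≡ v
  leading []      = refl
  leading (b ∷ v) = cong (b ∷_) (leading v)
  bits : ∀ v → outputTape (act (⊢ , right) (tape g ⊢ (List.map bit v ++ blank ∷ []))) ≡ v
  bits []      = refl
  bits (b ∷ v) = cong (b ∷_) (leading v)

^-distribʳ-* : ∀ e m n → (m * n) ^ e ≡ m ^ e * n ^ e
^-distribʳ-* zero    m n = refl
^-distribʳ-* (suc e) m n = trans (cong (m * n *_) (^-distribʳ-* e m n)) (lemma m n (m ^ e) (n ^ e))
  where
  lemma : ∀ a b c d → a * b * (c * d) ≡ a * c * (b * d)
  lemma = solve-∀

-- For `n > 0` by `2 + n ≤ 3 * n`; the additive constant of `poly` covers `n = 0`.
^-poly : ∀ e n → (2 + n) ^ e ≤ poly (3 ^ e) e n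
^-poly e zero    = ≤-trans (^-monoˡ-≤ e (s≤s (s≤s z≤n))) (m≤n+m (3 ^ e) (3 ^ e * 0 ^ e))
^-poly e (suc n) = begin
  (3 + n) ^ e                     ≤⟨ ^-monoˡ-≤ e (≤-trans (m≤m+n (3 + n) (2 * n)) (≤-reflexive (lemma n))) ⟩
  (3 * suc n) ^ e                 ≡⟨ ^-distribʳ-* e 3 (suc n) ⟩
  3 ^ e * suc n ^ e               ≤⟨ m≤m+n _ _ ⟩
  poly (3 ^ e) e (suc n)          ∎
  where
  open ≤-Reasoning
  lemma : ∀ n → 3 + n + 2 * n ≡ 3 * suc n
  lemma = solve-∀

module _ (o : Out 1) where
  private
    body whole : Prog
    body  = setup ⨾ print o 2 (λ _ → 1) ⨾ finish
    whole = bottoms (lastTape body) ⨾ body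

    K : ℕ
    K = lastTape body

    result : List Bool → List Bool
    result x = ⟦ o ⟧ x λ _ → length x

    -- `Represents` speaks of all counters, but `bottoms` marks only the tapes up to `K`. The tapes
    -- beyond, which the machine does not have, are taken to be marked from the start.
    virtual : List Bool → Tapes
    virtual x zero    = inputTape x
    virtual x (suc j) = if j <ᵇ K then blankTape else bottomTape

    lastTape-bottoms : ∀ k → lastTape (bottoms k) ≤ k
    lastTape-bottoms zero    = z≤n
    lastTape-bottoms (suc k) = ⊔-lub ≤-refl (m≤n⇒m≤1+n (lastTape-bottoms k))

    virtual-initial : ∀ x i → i ≤ lastTape whole → Machine.initialTapes whole x i ≡ virtual x i
    virtual-initial x zero    _  = refl
    virtual-initial x (suc j) j< with j <ᵇ K | <⇒<ᵇ (≤-trans j< (⊔-lub (lastTape-bottoms K) ≤-refl))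
    ... | true | _ = refl

    runtime : List Bool → ℕ
    runtime x = suc K + (20 * (1 + length x) + (print-cost o x (λ _ → length x) +
                  (suc (suc (print-cost o x (λ _ → length x)) * 2) + 1)))

    whole-run : ∀ x → ∃[ s ] ∃[ t ] t ≤ runtime x × Run whole (virtual x) s t × outputTape (s 0) ≡ result x
    whole-run x =
      let (s₁ , run₁ , in₀ , bs)   = bottoms-correct K (virtual x) blanks bottoms′
          (s₂ , t₂ , t₂≤ , run₂ , rep₂) = setup-correct x in₀ bs
          (s₃ , t₃ , t₃≤ , run₃ , rep₃) = Semantics._∶_⟶_within_.execute (print-correct x o frame) rep₂
          (s₄ , run₄ , out) = finish-correct (result x ʳ++ []) (Semantics.Represents.output-≡ rep₃)
      in s₄ , _ , +-monoʳ-≤ (suc K) (+-mono-≤ t₂≤ (+-mono-≤ t₃≤ (+-monoˡ-≤ 1 (s≤s (*-monoˡ-≤ 2 (s≤s written≤)))))) ,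
         run₁ ⨾ run₂ ⨾ run₃ ⨾ run₄ , trans out (List.reverse-involutive (result x))
      where
      blanks : ∀ j → j < K → virtual x (suc j) ≡ blankTape
      blanks j j<K with j <ᵇ K | <⇒<ᵇ j<K
      ... | true | _ = refl
      bottoms′ : ∀ j → K ≤ j → virtual x (suc j) ≡ bottomTape
      bottoms′ j K≤j with j <ᵇ K in eq
      ... | false = refl
      ... | true  = ⊥-elim (<⇒≱ (<ᵇ⇒< j K (subst T (sym eq) tt)) K≤j)
      frame : Frame 2 (λ _ → 1) (λ _ → length x) (startCounters x)
      frame = record
        { ℓ-pos = s≤s z≤n ; ρ-< = λ _ → ≤-refl ; input₀ = refl
        ; fresh = λ { (suc (suc _)) _ → refl ; (suc zero) (s≤s ()) }
        ; values = λ _ → +-identityʳ (length x) }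
      written≤ : length (result x ʳ++ []) ≤ print-cost o x (λ _ → length x)
      written≤ = ≤-trans (≤-reflexive (List.length-reverse (result x))) (length-≤-cost o x _)

  out-polyTime : PolyTime λ x → ⟦ o ⟧ x λ _ → length x
  out-polyTime = Machine.machine whole , 3 ^ proj₁ bound , proj₁ bound , λ x →
    let (s , t , t≤ , run , out) = whole-run x
        (halted , eq) = Machine.machine-correct whole (virtual-initial x) run
                          (≤-trans t≤ (≤-trans (unbounded (proj₂ bound x)) (^-poly (proj₁ bound) (length x))))
    in halted , trans eq out
    where
    bound : ∃[ e ] ∀ x → runtime x ≤ (2 + length x) ↑ e
    bound = let (_ , C) = print-cost-bound o in _ , λ x →
      let open Power {2 + length x} (s≤s (s≤s z≤n))
          C≤ = C x _ _ (s≤s (s≤s z≤n)) λ _ → m≤n+m _ 2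
          n≤ = below (n≤1+n _) itself
      in plus (const (suc K)) (plus (times (const 20) n≤) (plus C≤
           (plus (plus (const 1) (times (plus (const 1) C≤) (const 2))) (const 1))))

-- Tests, bounded search and division as computable functions

bool-≡ᵇ : ∀ a b → 1 ∸ ((a ∸ b) + (b ∸ a)) ≡ bool (a ≡ᵇ b)
bool-≡ᵇ zero    zero    = refl
bool-≡ᵇ zero    (suc b) = 0∸n≡0 b
bool-≡ᵇ (suc a) zero    = 0∸n≡0 (a + 0)
bool-≡ᵇ (suc a) (suc b) = bool-≡ᵇ a b

bool-<ᵇ : ∀ a b → 1 ∸ (1 ∸ (b ∸ a)) ≡ bool (a <ᵇ b)
bool-<ᵇ zero    zero    = refl
bool-<ᵇ (suc a) zero    = refl
bool-<ᵇ zero    (suc b) = cong (1 ∸_) (0∸n≡0 b)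
bool-<ᵇ (suc a) (suc b) = bool-<ᵇ a b

bool-≤ᵇ : ∀ a b → 1 ∸ (a ∸ b) ≡ bool (a ≤ᵇ b)
bool-≤ᵇ zero          b       = cong (1 ∸_) (0∸n≡0 b)
bool-≤ᵇ (suc a)       zero    = 0∸n≡0 a
bool-≤ᵇ (suc zero)    (suc b) = cong (1 ∸_) (0∸n≡0 b)
bool-≤ᵇ (suc (suc a)) (suc b) = bool-≤ᵇ (suc a) b

positive-bool : ∀ b → positive (bool b) ≡ b
positive-bool true  = refl
positive-bool false = refl

allTo anyTo : ℕ → (ℕ → Bool) → Bool
allTo zero    p = true
allTo (suc n) p = p 0 ∧ allTo n (p ∘ suc)
anyTo n p = not (allTo n (not ∘ p))

leading : ℕ → (ℕ → Bool) → ℕ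
leading zero    p = 0
leading (suc n) p = if p 0 then suc (leading n (p ∘ suc)) else 0

bool-allTo : ∀ n p → 1 ∸ sumTo n (λ i → 1 ∸ bool (p i)) ≡ bool (allTo n p)
bool-allTo zero    p = refl
bool-allTo (suc n) p with p 0
... | true  = bool-allTo n (p ∘ suc)
... | false = 0∸n≡0 (sumTo n λ i → 1 ∸ bool (p (suc i)))

-- `allTo (suc i) p` holds exactly for the `i` before the first failure of `p`, so summing these
-- truth values performs a bounded search.
leading-sum : ∀ n p → sumTo n (λ i → bool (allTo (suc i) p)) ≡ leading n p
leading-sum zero    p = refl
leading-sum (suc n) p with p 0
... | true  = cong suc (leading-sum n (p ∘ suc))
... | false = trans (sumTo-const n 0) (*-zeroʳ n)

leading-≡ : ∀ n k p → k ≤ n → (∀ i → i < k → p i ≡ true) → (k < n → p k ≡ false) → leading n p ≡ k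
leading-≡ zero    zero    p k≤n t f = refl
leading-≡ (suc n) zero    p k≤n t f rewrite f (s≤s z≤n) = refl
leading-≡ (suc n) (suc k) p (s≤s k≤n) t f rewrite t 0 (s≤s z≤n) =
  cong suc (leading-≡ n k (p ∘ suc) k≤n (λ i i<k → t (suc i) (s≤s i<k)) (f ∘ s≤s))

leading-< : ∀ n p i → i < leading n p → p i ≡ true
leading-< (suc n) p i i< with p 0 in eq
leading-< (suc n) p zero    i<       | true = eq
leading-< (suc n) p (suc i) (s≤s i<) | true = leading-< n (p ∘ suc) i i<

leading-fails : ∀ n p → leading n p < n → p (leading n p) ≡ false
leading-fails (suc n) p l< with p 0 in eq
leading-fails (suc n) p (s≤s l<) | true  = leading-fails n (p ∘ suc) l<
leading-fails (suc n) p l<       | false = eq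

allTo⇒ : ∀ {n p} → T (allTo n p) → ∀ i → i < n → T (p i)
allTo⇒ {suc n} {p} h zero    _         = proj₁ (Equivalence.to (Bool.T-∧ {p 0}) h)
allTo⇒ {suc n} {p} h (suc i) (s≤s i<n) = allTo⇒ (proj₂ (Equivalence.to (Bool.T-∧ {p 0}) h)) i i<n

allTo⇐ : ∀ {n p} → (∀ i → i < n → T (p i)) → T (allTo n p)
allTo⇐ {zero}  h = tt
allTo⇐ {suc n} h = Equivalence.from Bool.T-∧ (h 0 (s≤s z≤n) , allTo⇐ λ i i<n → h (suc i) (s≤s i<n))

anyTo⇒ : ∀ {n p} → T (anyTo n p) → ∃[ i ] i < n × T (p i)
anyTo⇒ {suc n} {p} h with p 0 in eq
... | true  = 0 , s≤s z≤n , subst T (sym eq) tt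
... | false = let (i , i<n , t) = anyTo⇒ {n} h in suc i , s≤s i<n , t

anyTo⇐ : ∀ {n p} i → i < n → T (p i) → T (anyTo n p)
anyTo⇐ {n} {p} i i<n t with allTo n (not ∘ p) in eq
... | false = tt
... | true  = ⊥-elim (contra (p i) t (allTo⇒ {n} (subst T (sym eq) tt) i i<n))
  where
  contra : ∀ b → T b → T (not b) → ⊥
  contra true _ ()

-- Division counts the positive multiples of `b` up to `a`, because sums are the only iteration that
-- a `Comp` has. It is total in `b`.
quot rem : ℕ → ℕ → ℕ
quot a b = sumTo a λ i → bool (suc i * b ≤ᵇ a)
rem a b = a ∸ quot a b * b

T-≡-bool : ∀ {a b} → (T a → T b) → (T b → T a) → a ≡ b
T-≡-bool {true}  {true}  f g = refl
T-≡-bool {false} {false} f g = refl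
T-≡-bool {true}  {false} f g = ⊥-elim (f tt)
T-≡-bool {false} {true}  f g = ⊥-elim (g tt)

quot-≡ : ∀ a b .{{_ : NonZero b}} → quot a b ≡ a / b
quot-≡ a b = trans
  (sumTo-cong a λ i _ → cong bool (T-≡-bool {suc i * b ≤ᵇ a} {i <ᵇ a / b}
    (λ t → <⇒<ᵇ (≤-trans (≤-reflexive (sym (m*n/n≡m (suc i) b))) (/-monoˡ-≤ b (≤ᵇ⇒≤ (suc i * b) a t))))
    (λ t → ≤⇒≤ᵇ (≤-trans (*-monoˡ-≤ b (<ᵇ⇒< i (a / b) t)) (m/n*n≤m a b)))))
  (below-count (a / b) a (m/n≤m a b))
  where
  below-count : ∀ m a → m ≤ a → sumTo a (λ i → bool (i <ᵇ m)) ≡ m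
  below-count zero    a       _        = trans (sumTo-const a 0) (*-zeroʳ a)
  below-count (suc m) (suc a) (s≤s le) = cong suc (below-count m a le)

rem-≡ : ∀ a b .{{_ : NonZero b}} → rem a b ≡ a % b
rem-≡ a b = trans (cong (λ q → a ∸ q * b) (quot-≡ a b)) (sym (m%n≡m∸m/n*n a b))

quot-unique : ∀ q b r → r < b → quot (q * b + r) b ≡ q
quot-unique q b@(suc _) r r<b = trans (quot-≡ (q * b + r) b) (begin
  (q * b + r) / b   ≡⟨ cong (_/ b) (+-comm (q * b) r) ⟩
  (r + q * b) / b   ≡⟨ +-distrib-/-∣ʳ r (divides-refl q) ⟩
  r / b + q * b / b ≡⟨ cong₂ _+_ (m<n⇒m/n≡0 r<b) (m*n/n≡m q b) ⟩
  q                 ∎)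
  where open ≡-Reasoning

rem-unique : ∀ q b r → r < b → rem (q * b + r) b ≡ r
rem-unique q b r r<b = trans (cong (λ u → q * b + r ∸ u * b) (quot-unique q b r r<b)) (m+n∸m≡n (q * b) r)

quot-rem : ∀ a b → 0 < b → quot a b * b + rem a b ≡ a
quot-rem a b@(suc _) _ = trans (cong₂ (λ u v → u * b + v) (quot-≡ a b) (rem-≡ a b))
  (trans (+-comm (a / b * b) (a % b)) (sym (m≡m%n+[m/n]*n a b)))

rem-< : ∀ a b → 0 < b → rem a b < b
rem-< a b@(suc _) _ = subst (_< b) (sym (rem-≡ a b)) (m%n<n a b)

quot-< : ∀ a m b → a < m * b → quot a b < m
quot-< a m zero    a< = ⊥-elim (n≮0 (subst (a <_) (*-zeroʳ m) a<))
quot-< a m b@(suc _) a< = subst (_< m) (sym (quot-≡ a b)) (m<n*o⇒m/o<n a<)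

const : ∀ {n} k → Comp n λ _ _ → k
const zero    = one ⊖ one
const (suc k) = one ⊕ const k

wk : ∀ {n f} → Comp n f → Comp (suc n) λ x env → f x (env ∘ fs)
wk = ren fs

-- Environments are functions, and those produced by nested binders agree with the intended ones
-- only pointwise.
comp-cong : ∀ {n f} → Comp n f → ∀ x {env env′ : Env n} → env ≗ env′ → f x env ≡ f x env′
comp-cong one      x eq = refl
comp-cong (var i)  x eq = eq i
comp-cong (c ⊕ c′) x eq = cong₂ _+_ (comp-cong c x eq) (comp-cong c′ x eq)
comp-cong (c ⊖ c′) x eq = cong₂ _∸_ (comp-cong c x eq) (comp-cong c′ x eq)
comp-cong (sum {f = f} c c′) x {env} eq = trans
  (sumTo-cong (f x env) λ i _ → comp-cong c′ x λ { fz → refl ; (fs j) → eq j })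
  (cong (λ n → sumTo n _) (comp-cong c x eq))
comp-cong (inp c)   x eq = cong (look x) (comp-cong c x eq)
comp-cong (ren r c) x eq = comp-cong c x (eq ∘ r)
comp-cong (ext e c) x {env} {env′} eq = trans (sym (e x env)) (trans (comp-cong c x eq) (e x env′))

record Test (n : ℕ) (p : List Bool → Env n → Bool) : Set where
  constructor test
  field comp : Comp n λ x env → bool (p x env)

open Test

variable
  α : ℕ
  φ ψ : List Bool → Env α → ℕ
  π π′ : List Bool → Env α → Bool

infixl 7 _⊗_
infix 4 _≡ᶜ_ _<ᶜ_ _≤ᶜ_
infixr 6 _∧ᶜ_
infixr 5 _∨ᶜ_

_⊗_ : Comp α φ → Comp α ψ → Comp α λ x env → φ x env * ψ x env
_⊗_ {φ = φ} c c′ = ext (λ x env → sumTo-const (φ x env) _) (sum c (wk c′))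

_≡ᶜ_ : Comp α φ → Comp α ψ → Test α λ x env → φ x env ≡ᵇ ψ x env
_≡ᶜ_ {φ = φ} {ψ} c c′ = test (ext (λ x env → bool-≡ᵇ (φ x env) (ψ x env)) (one ⊖ ((c ⊖ c′) ⊕ (c′ ⊖ c))))

_<ᶜ_ : Comp α φ → Comp α ψ → Test α λ x env → φ x env <ᵇ ψ x env
_<ᶜ_ {φ = φ} {ψ} c c′ = test (ext (λ x env → bool-<ᵇ (φ x env) (ψ x env)) (one ⊖ (one ⊖ (c′ ⊖ c))))

_≤ᶜ_ : Comp α φ → Comp α ψ → Test α λ x env → φ x env ≤ᵇ ψ x env
_≤ᶜ_ {φ = φ} {ψ} c c′ = test (ext (λ x env → bool-≤ᵇ (φ x env) (ψ x env)) (one ⊖ (c ⊖ c′)))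

notᶜ : Test α π → Test α λ x env → not (π x env)
notᶜ {π = π} (test c) = test (ext (λ x env → lemma (π x env)) (one ⊖ c))
  where
  lemma : ∀ b → 1 ∸ bool b ≡ bool (not b)
  lemma true  = refl
  lemma false = refl

_∧ᶜ_ : Test α π → Test α π′ → Test α λ x env → π x env ∧ π′ x env
_∧ᶜ_ {π = π} {π′} (test c) (test c′) = test (ext (λ x env → lemma (π x env) (π′ x env)) (c ⊗ c′))
  where
  lemma : ∀ a b → bool a * bool b ≡ bool (a ∧ b)
  lemma true  b = *-identityˡ (bool b)
  lemma false b = refl

_∨ᶜ_ : Test α π → Test α π′ → Test α λ x env → π x env ∨ π′ x env
_∨ᶜ_ {π = π} {π′} t t′ = test (ext (λ x env → cong bool (lemma (π x env) (π′ x env))) (comp (notᶜ (notᶜ t ∧ᶜ notᶜ t′))))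
  where
  lemma : ∀ a b → not (not a ∧ not b) ≡ a ∨ b
  lemma true  b     = refl
  lemma false true  = refl
  lemma false false = refl

ifᶜ : Test α π → Comp α φ → Comp α ψ → Comp α λ x env → if π x env then φ x env else ψ x env
ifᶜ {π = π} {φ} {ψ} t c c′ =
  ext (λ x env → lemma (π x env) (φ x env) (ψ x env)) (comp t ⊗ c ⊕ comp (notᶜ t) ⊗ c′)
  where
  lemma : ∀ b u v → bool b * u + bool (not b) * v ≡ (if b then u else v)
  lemma true  u v = trans (+-identityʳ _) (*-identityˡ u)
  lemma false u v = *-identityˡ v

_≡ᵗ_ : Test α π → Test α π′ → Test α λ x env → not (π x env xor π′ x env)
_≡ᵗ_ {π = π} {π′} (test c) (test c′) = test (ext (λ x env → cong bool (lemma (π x env) (π′ x env))) (comp (c ≡ᶜ c′)))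
  where
  lemma : ∀ a b → (bool a ≡ᵇ bool b) ≡ not (a xor b)
  lemma true  true  = refl
  lemma true  false = refl
  lemma false true  = refl
  lemma false false = refl

allᶜ : Comp α φ → Test (suc α) π → Test α λ x env → allTo (φ x env) λ i → π x (i ◂ env)
allᶜ {φ = φ} c (test c′) = test (ext (λ x env → bool-allTo (φ x env) _) (one ⊖ sum c (one ⊖ c′)))

anyᶜ : Comp α φ → Test (suc α) π → Test α λ x env → anyTo (φ x env) λ i → π x (i ◂ env)
anyᶜ c t = notᶜ (allᶜ c (notᶜ t))

quotᶜ : Comp α φ → Comp α ψ → Comp α λ x env → quot (φ x env) (ψ x env)
quotᶜ c c′ = sum c (comp ((one ⊕ var fz) ⊗ wk c′ ≤ᶜ wk c))

remᶜ : Comp α φ → Comp α ψ → Comp α λ x env → rem (φ x env) (ψ x env)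
remᶜ c c′ = c ⊖ quotᶜ c c′ ⊗ c′

polyᶜ : ∀ a k → Comp α φ → Comp α λ x env → poly a k (φ x env)
polyᶜ {φ = φ} a k c = const a ⊗ power k ⊕ const a
  where
  power : ∀ k → Comp _ λ x env → φ x env ^ k
  power zero    = one
  power (suc k) = c ⊗ power k

-- The summand i = φ selects the value of ψ at φ.
letᶜ : {ψ : List Bool → Env (suc α) → ℕ} → Comp α φ → Comp (suc α) ψ → Comp α λ x env → ψ x (φ x env ◂ env)
letᶜ {φ = φ} {ψ} c c′ = ext (λ x env → pick (φ x env) λ i → ψ x (i ◂ env))
  (sum (one ⊕ c) (comp (var fz ≡ᶜ wk c) ⊗ c′))
  where
  pick : ∀ v (h : ℕ → ℕ) → sumTo (suc v) (λ i → bool (i ≡ᵇ v) * h i) ≡ h v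
  pick zero    h = trans (+-identityʳ _) (+-identityʳ (h 0))
  pick (suc v) h = pick v (h ∘ suc)

leadingᶜ : ∀ {π : List Bool → Env α → ℕ → Bool} → Comp α φ →
  Test (suc (suc α)) (λ x env → π x (env ∘ fs ∘ fs) (env fz)) → Comp α λ x env → leading (φ x env) (π x env)
leadingᶜ {φ = φ} {π} c t = ext (λ x env → leading-sum (φ x env) (π x env)) (sum c (comp (allᶜ (one ⊕ var fz) t)))

-- The problem is in NP

count-sum : ∀ {n} {r : Fin n → Bool} (q : ℕ → Bool) → (∀ i → r i ≡ q (toℕ i)) → count r ≡ sumTo n (bool ∘ q)
count-sum {zero}      q eq = refl
count-sum {suc n} {r} q eq with r fz | q 0 | eq fz
... | true  | _ | refl = cong suc (count-sum (q ∘ suc) (eq ∘ fs))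
... | false | _ | refl = count-sum (q ∘ suc) (eq ∘ fs)

maxOver-lub : ∀ {n b} {f : Fin n → ℕ} → (∀ i → f i ≤ b) → maxOver f ≤ b
maxOver-lub {zero}  h = z≤n
maxOver-lub {suc n} h = ⊔-lub (h fz) (maxOver-lub (h ∘ fs))

maxOver-ub : ∀ {n} (f : Fin n → ℕ) i → f i ≤ maxOver f
maxOver-ub f fz     = m≤m⊔n _ _
maxOver-ub f (fs i) = ≤-trans (maxOver-ub (f ∘ fs) i) (m≤n⊔m _ _)

difference-≡ : ∀ a b c d → ℤ.+ a ℤ.- ℤ.+ b ≡ ℤ.+ c ℤ.- ℤ.+ d → a + d ≡ c + b
difference-≡ a b c d eq = ℤ.+-injective (trans (lemma (ℤ.+ a) (ℤ.+ b) (ℤ.+ d))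
  (trans (cong (λ e → (e ℤ.+ ℤ.+ b) ℤ.+ ℤ.+ d) eq) (lemma′ (ℤ.+ c) (ℤ.+ d) (ℤ.+ b))))
  where
  lemma : ∀ i j k → i ℤ.+ k ≡ ((i ℤ.- j) ℤ.+ j) ℤ.+ k
  lemma = ℤ-solve-∀
  lemma′ : ∀ i j k → ((i ℤ.- j) ℤ.+ k) ℤ.+ j ≡ i ℤ.+ k
  lemma′ = ℤ-solve-∀

≡-difference : ∀ a b c d → a + d ≡ c + b → ℤ.+ a ℤ.- ℤ.+ b ≡ ℤ.+ c ℤ.- ℤ.+ d
≡-difference a b c d eq = trans (lemma (ℤ.+ a) (ℤ.+ b) (ℤ.+ d))
  (trans (cong (λ e → e ℤ.- ℤ.+ d ℤ.- ℤ.+ b) (cong ℤ.+_ eq)) (lemma′ (ℤ.+ c) (ℤ.+ d) (ℤ.+ b)))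
  where
  lemma : ∀ i j k → i ℤ.- j ≡ i ℤ.+ k ℤ.- k ℤ.- j
  lemma = ℤ-solve-∀
  lemma′ : ∀ i j k → i ℤ.+ k ℤ.- j ℤ.- k ≡ i ℤ.- j
  lemma′ = ℤ-solve-∀

∣difference∣≤1⇒ : ∀ a b → ℤ.∣ ℤ.+ a ℤ.- ℤ.+ b ∣ ≤ 1 → a ≤ suc b
∣difference∣≤1⇒ a b h with ≤-total a b
... | inj₁ a≤b = m≤n⇒m≤1+n a≤b
... | inj₂ b≤a = begin
  a             ≡⟨ m∸n+n≡m b≤a ⟨
  (a ∸ b) + b   ≡⟨ cong (_+ b) (ℤ.∣⊖∣-≤ b≤a) ⟨
  ℤ.∣ b ℤ.⊖ a ∣ + b ≡⟨ cong (_+ b) (trans (ℤ.∣m⊖n∣≡∣n⊖m∣ b a) (cong ℤ.∣_∣ (sym (ℤ.m-n≡m⊖n a b)))) ⟩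
  ℤ.∣ ℤ.+ a ℤ.- ℤ.+ b ∣ + b ≤⟨ +-monoˡ-≤ b h ⟩
  suc b         ∎
  where open ≤-Reasoning

∣difference∣-swap : ∀ a b → ℤ.∣ ℤ.+ a ℤ.- ℤ.+ b ∣ ≡ ℤ.∣ ℤ.+ b ℤ.- ℤ.+ a ∣
∣difference∣-swap a b = trans (cong ℤ.∣_∣ (ℤ.m-n≡m⊖n a b))
  (trans (ℤ.∣m⊖n∣≡∣n⊖m∣ a b) (cong ℤ.∣_∣ (sym (ℤ.m-n≡m⊖n b a))))

⇒∣difference∣≤1 : ∀ a b → a ≤ suc b → b ≤ suc a → ℤ.∣ ℤ.+ a ℤ.- ℤ.+ b ∣ ≤ 1
⇒∣difference∣≤1 a b h h′ with ≤-total a b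
... | inj₁ a≤b = ≤-trans (≤-reflexive (trans (cong ℤ.∣_∣ (ℤ.m-n≡m⊖n a b)) (ℤ.∣⊖∣-≤ a≤b)))
                   (m≤n+o⇒m∸n≤o b a (≤-trans h′ (≤-reflexive (+-comm 1 a))))
... | inj₂ b≤a = ≤-trans (≤-reflexive (trans (∣difference∣-swap a b) (trans (cong ℤ.∣_∣ (ℤ.m-n≡m⊖n b a)) (ℤ.∣⊖∣-≤ b≤a))))
                   (m≤n+o⇒m∸n≤o a b (≤-trans h (≤-reflexive (+-comm 1 b))))

module _ {n} (G : Graph n) where
  open Graph G
  open Orientation

  -- An edge forces the in-out-degree of one of its ends to be nonzero, so 1 is the least possible value.
  number-≤1 : ∀ {u v} → T (adj u v) → (D : Orientation G) → InOutProper D → maxAbsInOutDegree D ≤ 1 →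
              InOutProperOrientationNumber≤ G 1
  number-≤1 {u} {v} uv D proper le = maxAbsInOutDegree D , ((D , proper , refl) ,
    λ D′ proper′ → ≤-trans le (n≢0⇒n>0 λ max≡0 → proper′ u v uv
      (trans (zero-at D′ max≡0 u) (sym (zero-at D′ max≡0 v))))) , le
    where
    zero-at : ∀ D → maxAbsInOutDegree D ≡ 0 → ∀ v → inOutDegree D v ≡ ℤ.+ 0
    zero-at D eq v = ℤ.∣i∣≡0⇒i≡0 (n≤0⇒n≡0 (≤-trans (maxOver-ub (λ v → ℤ.∣ inOutDegree D v ∣) v) (≤-reflexive eq)))

allFin⇐ : ∀ {n p} → (∀ (u : Fin n) → T (p (toℕ u))) → T (allTo n p)
allFin⇐ {p = p} h = allTo⇐ λ i i<n → subst (T ∘ p) (Fin.toℕ-fromℕ< i<n) (h (fromℕ< i<n))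

allFin⇒ : ∀ {n p} → T (allTo n p) → ∀ (u : Fin n) → T (p (toℕ u))
allFin⇒ h u = allTo⇒ h (toℕ u) (Fin.toℕ<n u)

T-∧⇒ : ∀ {a b} → T (a ∧ b) → T a × T b
T-∧⇒ = Equivalence.to Bool.T-∧

T-∧⇐ : ∀ {a b} → T a → T b → T (a ∧ b)
T-∧⇐ t t′ = Equivalence.from Bool.T-∧ (t , t′)

infixr 5 _⇒ᵇ_

_⇒ᵇ_ : Bool → Bool → Bool
a ⇒ᵇ b = not a ∨ b

⇒ᵇ-intro : ∀ {a b} → (T a → T b) → T (a ⇒ᵇ b)
⇒ᵇ-intro {true}  f = f tt
⇒ᵇ-intro {false} f = tt

⇒ᵇ-elim : ∀ {a b} → T (a ⇒ᵇ b) → T a → T b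
⇒ᵇ-elim {true} t _ = t

T-not : ∀ {a} → ¬ T a → T (not a)
T-not {true}  f = ⊥-elim (f tt)
T-not {false} f = tt

not-T : ∀ {a} → T (not a) → ¬ T a
not-T {true} () _

module Checks (n : ℕ) (adj : ℕ → ℕ → Bool) (side : ℕ → Bool) (arc : ℕ → ℕ → Bool) where

  degrees into out : ℕ → ℕ
  degrees u = sumTo n λ v → bool (adj u v)
  into u    = sumTo n λ v → bool (arc v u)
  out u     = sumTo n λ v → bool (arc u v)

  vertexCheck : ℕ → Bool
  vertexCheck u = not (adj u u) ∧ (degrees u ≤ᵇ 3) ∧ (into u ≤ᵇ suc (out u)) ∧ (out u ≤ᵇ suc (into u))

  edgeCheck pairCheck : ℕ → ℕ → Bool
  -- The last conjunct compares two differences with the subtracted terms moved across, which keeps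
  -- it within the natural numbers.
  edgeCheck u v = (side u xor side v) ∧ (arc u v xor arc v u) ∧ not (into u + out v ≡ᵇ into v + out u)
  pairCheck u v = not (adj u v xor adj v u) ∧ (arc u v ⇒ᵇ adj u v) ∧ (adj u v ⇒ᵇ edgeCheck u v)

  checks : Bool
  checks = allTo n vertexCheck ∧ allTo n (λ u → allTo n (pairCheck u)) ∧ anyTo n (λ u → degrees u ≡ᵇ 3)

xor-≢ : ∀ {a b} → T (a xor b) → a ≢ b
xor-≢ {true}  {true}  () _
xor-≢ {false} {false} () _

≢-xor : ∀ {a b} → a ≢ b → T (a xor b)
≢-xor {true}  {true}  ne = ⊥-elim (ne refl)
≢-xor {true}  {false} ne = tt
≢-xor {false} {true}  ne = tt
≢-xor {false} {false} ne = ⊥-elim (ne refl)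

≢-not : ∀ {a b} → a ≢ b → b ≡ not a
≢-not {true}  {true}  ne = ⊥-elim (ne refl)
≢-not {true}  {false} ne = refl
≢-not {false} {true}  ne = refl
≢-not {false} {false} ne = ⊥-elim (ne refl)

≢-not⇐ : ∀ {a b} → b ≡ not a → a ≢ b
≢-not⇐ {true}  refl ()
≢-not⇐ {false} refl ()

¬xor-≡ : ∀ {a b} → T (not (a xor b)) → a ≡ b
¬xor-≡ {true}  {true}  _ = refl
¬xor-≡ {false} {false} _ = refl

≡-¬xor : ∀ {a b} → a ≡ b → T (not (a xor b))
≡-¬xor {true}  refl = tt
≡-¬xor {false} refl = tt

IsSolution : ∀ {n} → Graph n → Set
IsSolution G = Bipartite G × maxDegree G ≡ 3 × InOutProperOrientationNumber≤ G 1

record Agrees {n} (f : ℕ → ℕ → Bool) (g : Fin n → Fin n → Bool) : Set where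
  constructor agrees
  field agree : ∀ u v → g u v ≡ f (toℕ u) (toℕ v)

open Agrees

module _ {n} {G : Graph n} {a : ℕ → ℕ → Bool} {s : ℕ → Bool} {r : ℕ → ℕ → Bool} where
  open Graph G
  open Checks n a s r
  open Orientation

  checks-complete : Agrees a adj → (D : Orientation G) (S : Bipartite G) → Agrees r (arc D) →
    (∀ u → proj₁ S u ≡ s (toℕ u)) →
    InOutProper D → maxDegree G ≡ 3 → maxAbsInOutDegree D ≤ 1 → T checks
  checks-complete ha D S hr hs proper deg le = T-∧⇐
    (allFin⇐ λ u → T-∧⇐ (T-not (subst (¬_ ∘ T) (trans (sym (loopless u)) (agree ha u u)) id))
      (T-∧⇐ (≤⇒≤ᵇ (≤-trans (≤-reflexive (sym (degree-≡ u))) (≤-trans (maxOver-ub (degree G) u) (≤-reflexive deg))))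
      (T-∧⇐ (≤⇒≤ᵇ (∣difference∣≤1⇒ (into (toℕ u)) (out (toℕ u)) (abs≤ u)))
            (≤⇒≤ᵇ (∣difference∣≤1⇒ (out (toℕ u)) (into (toℕ u)) (subst (_≤ 1) (∣difference∣-swap (into (toℕ u)) (out (toℕ u))) (abs≤ u)))))))
    (T-∧⇐ (allFin⇐ λ u → allFin⇐ λ v → T-∧⇐
      (≡-¬xor (trans (sym (agree ha u v)) (trans (symmetric u v) (agree ha v u))))
      (T-∧⇐ (⇒ᵇ-intro λ t → subst T (agree ha u v) (arc⇒adj D u v (subst T (sym (agree hr u v)) t)))
        (⇒ᵇ-intro λ t → let uv = subst T (sym (agree ha u v)) t in
          T-∧⇐ (≢-xor (subst₂ _≢_ (hs u) (hs v) (proj₂ S u v uv)))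
          (T-∧⇐ (≢-xor (subst₂ _≢_ (agree hr u v) (agree hr v u) (≢-not⇐ (exactlyOne D u v uv))))
            (T-not λ e → proper u v uv (trans (net-≡ u) (trans
              (≡-difference (into (toℕ u)) (out (toℕ u)) (into (toℕ v)) (out (toℕ v)) (≡ᵇ⇒≡ _ _ e)) (sym (net-≡ v)))))))))
      (some-3 deg))
    where
    degree-≡ : ∀ u → degree G u ≡ degrees (toℕ u)
    degree-≡ u = count-sum (a (toℕ u)) (agree ha u)
    net-≡ : ∀ u → inOutDegree D u ≡ ℤ.+ into (toℕ u) ℤ.- ℤ.+ out (toℕ u)
    net-≡ u = cong₂ (λ i o → ℤ.+ i ℤ.- ℤ.+ o) (count-sum (λ v → r v (toℕ u)) (λ v → agree hr v u))
                (count-sum (r (toℕ u)) (agree hr u))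
    abs≤ : ∀ u → ℤ.∣ ℤ.+ into (toℕ u) ℤ.- ℤ.+ out (toℕ u) ∣ ≤ 1
    abs≤ u = subst (λ i → ℤ.∣ i ∣ ≤ 1) (net-≡ u) (≤-trans (maxOver-ub (λ v → ℤ.∣ inOutDegree D v ∣) u) le)
    attained : ∀ {m} (f : Fin (suc m) → ℕ) → ∃[ i ] f i ≡ maxOver f
    attained {zero} f = fz , sym (⊔-identityʳ (f fz))
    attained {suc m} f with ⊔-sel (f fz) (maxOver (f ∘ fs))
    ... | inj₁ eq = fz , sym eq
    ... | inj₂ eq = let (i , eq′) = attained (f ∘ fs) in fs i , trans eq′ (sym eq)
    some-3 : maxDegree G ≡ 3 → T (anyTo n λ u → degrees u ≡ᵇ 3)
    some-3 deg = let (u , eq) = attained′ (degree G) deg in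
      anyTo⇐ (toℕ u) (Fin.toℕ<n u) (≡⇒≡ᵇ _ 3 (trans (sym (degree-≡ u)) eq))
      where
      attained′ : ∀ {m} (f : Fin m → ℕ) → maxOver f ≡ 3 → ∃[ i ] f i ≡ 3
      attained′ {suc m} f eq = let (i , eq′) = attained f in i , trans eq′ eq

module _ {n a s r} (ok : T (Checks.checks n a s r)) where
  open Checks n a s r

  private
    vertex-ok : ∀ (u : Fin n) → T (vertexCheck (toℕ u))
    vertex-ok = allFin⇒ (proj₁ (T-∧⇒ ok))
    pair-ok : ∀ (u v : Fin n) → T (pairCheck (toℕ u) (toℕ v))
    pair-ok u v = allFin⇒ (allFin⇒ (proj₁ (T-∧⇒ (proj₂ (T-∧⇒ {allTo n vertexCheck} ok)))) u) v
    edge-ok : ∀ (u v : Fin n) → T (a (toℕ u) (toℕ v)) → T (edgeCheck (toℕ u) (toℕ v))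
    edge-ok u v = ⇒ᵇ-elim (proj₂ (T-∧⇒ {r (toℕ u) (toℕ v) ⇒ᵇ _} (proj₂ (T-∧⇒ {not (a (toℕ u) (toℕ v) xor _)} (pair-ok u v)))))

  checkedGraph : Graph n
  checkedGraph = record
    { adj = λ u v → a (toℕ u) (toℕ v)
    ; symmetric = λ u v → ¬xor-≡ (proj₁ (T-∧⇒ (pair-ok u v)))
    ; loopless = λ u → Equivalence.to Bool.T-not-≡ (proj₁ (T-∧⇒ (vertex-ok u))) }

  private
    D : Orientation checkedGraph
    D = record
      { arc = λ u v → r (toℕ u) (toℕ v)
      ; arc⇒adj = λ u v → ⇒ᵇ-elim (proj₁ (T-∧⇒ (proj₂ (T-∧⇒ {not (a (toℕ u) (toℕ v) xor _)} (pair-ok u v)))))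
      ; exactlyOne = λ u v uv → ≢-not (xor-≢ (proj₁ (T-∧⇒ (proj₂ (T-∧⇒ {s (toℕ u) xor _} (edge-ok u v uv)))))) }
    open Orientation D
    net-≡ : ∀ u → inOutDegree u ≡ ℤ.+ into (toℕ u) ℤ.- ℤ.+ out (toℕ u)
    net-≡ u = cong₂ (λ i o → ℤ.+ i ℤ.- ℤ.+ o) (count-sum {n} (λ v → r v (toℕ u)) (λ _ → refl))
                (count-sum {n} (r (toℕ u)) (λ _ → refl))
    degree-≡ : ∀ u → degree checkedGraph u ≡ degrees (toℕ u)
    degree-≡ u = count-sum {n} (a (toℕ u)) (λ _ → refl)

  checks-sound : IsSolution checkedGraph
  checks-sound =
    ((λ u → s (toℕ u)) , λ u v uv → xor-≢ (proj₁ (T-∧⇒ (edge-ok u v uv)))) ,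
    max≡3 ,
    -- A vertex of degree 3 has a neighbour, which gives the edge that `number-≤1` requires.
    number-≤1 checkedGraph (proj₂ edge) D
      (λ u v uv eq → not-T (proj₂ (T-∧⇒ {r (toℕ u) (toℕ v) xor _} (proj₂ (T-∧⇒ {s (toℕ u) xor _} (edge-ok u v uv)))))
        (≡⇒≡ᵇ _ _ (difference-≡ (into (toℕ u)) (out (toℕ u)) (into (toℕ v)) (out (toℕ v))
          (trans (sym (net-≡ u)) (trans eq (net-≡ v))))))
      (maxOver-lub λ u → let t = proj₂ (T-∧⇒ {degrees (toℕ u) ≤ᵇ 3} (proj₂ (T-∧⇒ {not (a (toℕ u) (toℕ u))} (vertex-ok u)))) in
        subst (λ i → ℤ.∣ i ∣ ≤ 1) (sym (net-≡ u)) (⇒∣difference∣≤1 (into (toℕ u)) (out (toℕ u))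
          (≤ᵇ⇒≤ _ _ (proj₁ (T-∧⇒ t))) (≤ᵇ⇒≤ _ _ (proj₂ (T-∧⇒ {into (toℕ u) ≤ᵇ _} t)))))
    where
    some-3 : ∃[ u ] degrees (toℕ {n} u) ≡ 3
    some-3 = let (i , i<n , t) = anyTo⇒ {n} (proj₂ (T-∧⇒ {allTo n (λ u → allTo n (pairCheck u))} (proj₂ (T-∧⇒ {allTo n vertexCheck} ok)))) in
      fromℕ< i<n , trans (cong degrees (Fin.toℕ-fromℕ< i<n)) (≡ᵇ⇒≡ _ 3 t)
    max≡3 : maxDegree checkedGraph ≡ 3
    max≡3 = ≤-antisym
      (maxOver-lub λ u → ≤-trans (≤-reflexive (degree-≡ u))
        (≤ᵇ⇒≤ _ 3 (proj₁ (T-∧⇒ (proj₂ (T-∧⇒ {not (a (toℕ u) (toℕ u))} (vertex-ok u)))))))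
      (≤-trans (≤-reflexive (sym (trans (degree-≡ (proj₁ some-3)) (proj₂ some-3)))) (maxOver-ub (degree checkedGraph) (proj₁ some-3)))
    positive-term : ∀ n (q : ℕ → Bool) → sumTo n (bool ∘ q) ≢ 0 → ∃[ i ] i < n × T (q i)
    positive-term zero    q ne = ⊥-elim (ne refl)
    positive-term (suc n) q ne with q 0 in eq
    ... | true  = 0 , s≤s z≤n , subst T (sym eq) tt
    ... | false = let (i , i<n , t) = positive-term n (q ∘ suc) ne in suc i , s≤s i<n , t
    edge : ∃[ v ] T (a (toℕ (proj₁ some-3)) (toℕ {n} v))
    edge = let (i , i<n , t) = positive-term n (a (toℕ (proj₁ some-3))) (λ eq → case (trans (sym eq) (proj₂ some-3))) in
      fromℕ< i<n , subst (T ∘ a _) (sym (Fin.toℕ-fromℕ< i<n)) t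
      where
      case : 0 ≡ 3 → ⊥
      case ()

-- Reading graphs and pairs from words

look-++ : ∀ xs ys i → look (xs ++ ys) (length xs + i) ≡ look ys i
look-++ []       ys i = refl
look-++ (x ∷ xs) ys i = look-++ xs ys i

look-++ˡ : ∀ xs ys i → i < length xs → look (xs ++ ys) i ≡ look xs i
look-++ˡ (x ∷ xs) ys zero    _         = refl
look-++ˡ (x ∷ xs) ys (suc i) (s≤s i<n) = look-++ˡ xs ys i i<n

look-replicate : ∀ n b i → i < n → look (replicate n b) i ≡ bool b
look-replicate (suc n) b zero    _         = refl
look-replicate (suc n) b (suc i) (s≤s i<n) = look-replicate n b i i<n

look-tabulate : ∀ {n} (f : Fin n → Bool) i → look (List.tabulate f) (toℕ i) ≡ bool (f i)
look-tabulate f fz     = refl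
look-tabulate f (fs i) = look-tabulate (f ∘ fs) i

bool-injective : ∀ {a b} → bool a ≡ bool b → a ≡ b
bool-injective {true}  {true}  _ = refl
bool-injective {false} {false} _ = refl

look-ext : ∀ xs ys → length xs ≡ length ys → (∀ i → i < length xs → look xs i ≡ look ys i) → xs ≡ ys
look-ext []       []       _   _  = refl
look-ext (x ∷ xs) (y ∷ ys) len eq = cong₂ _∷_ (bool-injective (eq 0 (s≤s z≤n)))
  (look-ext xs ys (suc-injective len) λ i i<n → eq (suc i) (s≤s i<n))

look-bit : ∀ xs i → i < length xs → bool (look xs i ≡ᵇ 1) ≡ look xs i
look-bit (true ∷ xs)  zero    _         = refl
look-bit (false ∷ xs) zero    _         = refl
look-bit (x ∷ xs)     (suc i) (s≤s i<n) = look-bit xs i i<n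

bool-≡ᵇ1 : ∀ b → (bool b ≡ᵇ 1) ≡ b
bool-≡ᵇ1 true  = refl
bool-≡ᵇ1 false = refl

matrix : ∀ {k n} → (Fin k → Fin n → Bool) → List Bool
matrix f = List.concat (List.tabulate λ u → List.tabulate (f u))

length-matrix : ∀ {k n} (f : Fin k → Fin n → Bool) → length (matrix f) ≡ k * n
length-matrix {zero}  f = refl
length-matrix {suc k} f = trans (List.length-++ (List.tabulate (f fz)))
  (cong₂ _+_ (List.length-tabulate (f fz)) (length-matrix (f ∘ fs)))

look-matrix : ∀ {k n} (f : Fin k → Fin n → Bool) u v → look (matrix f) (toℕ u * n + toℕ v) ≡ bool (f u v)
look-matrix {suc k} {n} f fz v = trans
  (look-++ˡ (List.tabulate (f fz)) _ (toℕ v) (subst (toℕ v <_) (sym (List.length-tabulate (f fz))) (Fin.toℕ<n v)))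
  (look-tabulate (f fz) v)
look-matrix {suc k} {n} f (fs u) v = trans
  (cong (look (matrix f)) (trans (+-assoc n _ _) (cong (_+ (toℕ u * n + toℕ v)) (sym (List.length-tabulate (f fz))))))
  (trans (look-++ (List.tabulate (f fz)) _ (toℕ u * n + toℕ v)) (look-matrix (f ∘ fs) u v))

module _ {n} (G : Graph n) where
  open Graph G

  length-encode : length (encode G) ≡ suc (n + n * n)
  length-encode = trans (List.length-++ (replicate n true))
    (trans (cong₂ _+_ (List.length-replicate n) (cong suc (length-matrix adj))) (+-suc n (n * n)))

  encode-ones : ∀ i → i < n → look (encode G) i ≡ 1
  encode-ones i i<n = trans
    (look-++ˡ (replicate n true) _ i (subst (i <_) (sym (List.length-replicate n)) i<n)) (look-replicate n true i i<n)

  private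
    shift : ∀ i → look (encode G) (n + i) ≡ look (false ∷ matrix adj) i
    shift i = trans (cong (λ k → look (encode G) (k + i)) (sym (List.length-replicate n)))
      (look-++ (replicate n true) _ i)

  encode-zero : look (encode G) n ≡ 0
  encode-zero = trans (cong (look (encode G)) (sym (+-identityʳ n))) (shift 0)

  encode-adj : ∀ u v → look (encode G) (suc (n + (toℕ u * n + toℕ v))) ≡ bool (adj u v)
  encode-adj u v = trans (cong (look (encode G)) (sym (+-suc n _)))
    (trans (shift (suc (toℕ u * n + toℕ v))) (look-matrix adj u v))

double : ℕ → ℕ
double zero    = zero
double (suc n) = suc (suc (double n))

double-+ : ∀ n → n + n ≡ double n
double-+ zero    = refl
double-+ (suc n) = cong suc (trans (+-suc n n) (cong suc (double-+ n)))

look-pair : ∀ x u i → i < length x → look (pair x u) (double i) ≡ look x i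
look-pair (b ∷ x) u zero    _         = refl
look-pair (b ∷ x) u (suc i) (s≤s i<n) = look-pair x u i i<n

look-pair′ : ∀ x u i → i < length x → look (pair x u) (suc (double i)) ≡ look x i
look-pair′ (b ∷ x) u zero    _         = refl
look-pair′ (b ∷ x) u (suc i) (s≤s i<n) = look-pair′ x u i i<n

look-pair-second : ∀ x u i → look (pair x u) (double (length x) + i) ≡ look (true ∷ false ∷ u) i
look-pair-second []      u i = refl
look-pair-second (b ∷ x) u i = look-pair-second x u i

length-pair : ∀ x u → length (pair x u) ≡ double (length x) + (2 + length u)
length-pair []      u = refl
length-pair (b ∷ x) u = cong (suc ∘ suc) (length-pair x u)

module _ (w : List Bool) where

  -- The separator of a pair is its first block of two unequal bits.
  firstLength : ℕ → ℕ
  firstLength l = leading l λ i → look w (double i) ≡ᵇ look w (suc (double i))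

  vertices : ℕ → ℕ
  vertices m = leading m λ i → look w (double i) ≡ᵇ 1

  -- The matrix starts behind the unary order and its separator, and bit `i` of the first component
  -- of a pair stands at position `double i`.
  adjBit : ℕ → ℕ → ℕ → Bool
  adjBit n u v = look w (double (suc (n + (u * n + v)))) ≡ᵇ 1

  -- A certificate consists of the `n` bits of a bipartition followed by the matrix of arcs. The 2
  -- skips the separator of the pair.
  sideBit : ℕ → ℕ → Bool
  sideBit m u = look w (double m + (2 + u)) ≡ᵇ 1

  arcBit : ℕ → ℕ → ℕ → ℕ → Bool
  arcBit m n u v = look w (double m + (2 + (n + (u * n + v)))) ≡ᵇ 1

  verifyWith : ℕ → ℕ → Bool
  verifyWith m n = (m ≡ᵇ suc (n + n * n)) ∧ Checks.checks n (adjBit n) (sideBit m) (arcBit m n)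

  verify : ℕ → Bool
  verify l = verifyWith (firstLength l) (vertices (firstLength l))

firstLength-pair : ∀ x u → firstLength (pair x u) (length (pair x u)) ≡ length x
firstLength-pair x u = leading-≡ (length w) (length x) _
  (≤-trans (≤-trans (m≤m+n (length x) (length x)) (≤-reflexive (double-+ (length x))))
    (≤-trans (m≤m+n _ _) (≤-reflexive (sym (length-pair x u)))))
  (λ i i<m → Equivalence.to Bool.T-≡ (≡⇒≡ᵇ _ _ (trans (look-pair x u i i<m) (sym (look-pair′ x u i i<m)))))
  (λ _ → cong₂ _≡ᵇ_ (trans (cong (look w) (sym (+-identityʳ _))) (look-pair-second x u 0))
                    (trans (cong (look w) (sym (trans (+-suc _ 0) (cong suc (+-identityʳ _))))) (look-pair-second x u 1)))
  where
  w = pair x u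

module Certificate {n} (G : Graph n) (S : Bipartite G) (D : Orientation G) where
  open Graph G
  open Orientation D

  certificate : List Bool
  certificate = List.tabulate (proj₁ S) ++ matrix arc

  length-certificate : length certificate ≤ length (encode G)
  length-certificate = begin
    length certificate                                         ≡⟨ List.length-++ (List.tabulate (proj₁ S)) ⟩
    length (List.tabulate (proj₁ S)) + length (matrix arc)     ≡⟨ cong₂ _+_ (List.length-tabulate (proj₁ S)) (length-matrix arc) ⟩
    n + n * n                                                  ≤⟨ n≤1+n _ ⟩
    suc (n + n * n)                                            ≡⟨ length-encode G ⟨
    length (encode G)                                          ∎
    where open ≤-Reasoning

  private
    x = encode G
    w = pair x certificate
    m = length x

    m≡ : m ≡ suc (n + n * n)
    m≡ = length-encode G

    n<m : n < m
    n<m = subst (n <_) (sym m≡) (s≤s (m≤m+n n _))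

    vertices≡ : vertices w m ≡ n
    vertices≡ = leading-≡ m n _ (<⇒≤ n<m)
      (λ i i<n → cong (_≡ᵇ 1) (trans (look-pair x certificate i (<-trans i<n n<m)) (encode-ones G i i<n)))
      (λ _ → cong (_≡ᵇ 1) (trans (look-pair x certificate n n<m) (encode-zero G)))

    adj-agrees : Agrees (adjBit w n) adj
    adj-agrees = agrees λ u v → sym (trans (cong (_≡ᵇ 1) (trans
      (look-pair x certificate _ (subst (_ <_) (sym m≡) (s≤s (+-monoʳ-< n
        (<-≤-trans (+-monoʳ-< (toℕ u * n) (Fin.toℕ<n v)) (≤-trans (≤-reflexive (+-comm (toℕ u * n) n)) (*-monoˡ-≤ n (Fin.toℕ<n u))))))))
      (encode-adj G u v))) (bool-≡ᵇ1 (adj u v)))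

    second : ∀ i → look w (double m + (2 + i)) ≡ look certificate i
    second i = look-pair-second x certificate (2 + i)

    arc-agrees : Agrees (arcBit w m n) arc
    arc-agrees = agrees λ u v → sym (trans (cong (_≡ᵇ 1) (trans (second (n + (toℕ u * n + toℕ v)))
      (trans (cong (λ k → look certificate (k + (toℕ u * n + toℕ v))) (sym (List.length-tabulate (proj₁ S))))
      (trans (look-++ (List.tabulate (proj₁ S)) _ _) (look-matrix arc u v))))) (bool-≡ᵇ1 (arc u v)))

    side-agrees : ∀ u → proj₁ S u ≡ sideBit w m (toℕ u)
    side-agrees u = sym (trans (cong (_≡ᵇ 1) (trans (second (toℕ u))
      (trans (look-++ˡ (List.tabulate (proj₁ S)) _ (toℕ u) (subst (toℕ u <_) (sym (List.length-tabulate (proj₁ S))) (Fin.toℕ<n u)))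
             (look-tabulate (proj₁ S) u)))) (bool-≡ᵇ1 _))

  verify-complete : InOutProper → maxDegree G ≡ 3 → maxAbsInOutDegree ≤ 1 →
    T (verify (pair (encode G) certificate) (length (pair (encode G) certificate)))
  verify-complete proper deg le
    rewrite firstLength-pair (encode G) certificate | vertices≡ =
    T-∧⇐ (≡⇒≡ᵇ m _ m≡) (checks-complete {s = sideBit w m} adj-agrees D S arc-agrees side-agrees proper deg le)

-- Acceptance must also show that `x` is an encoding. Its length is checked to be `suc (n + n * n)`,
-- so it splits into the unary order, the separator and the matrix, and in each region `x` is
-- compared with `encode H` bit by bit.
verify-sound : ∀ x u → T (verify (pair x u) (length (pair x u))) → BipartiteMaxDegree3InOut≤1 x
verify-sound x u t rewrite firstLength-pair x u =
  n , H , look-ext x (encode H) (trans m≡ (sym (length-encode H))) x≡ , checks-sound {n} {s = sideBit w (length x)} ok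
  where
  w = pair x u
  n = vertices w (length x)
  m≡ : length x ≡ suc (n + n * n)
  m≡ = ≡ᵇ⇒≡ _ _ (proj₁ (T-∧⇒ t))
  ok : T (Checks.checks n (adjBit w n) (sideBit w (length x)) (arcBit w (length x) n))
  ok = proj₂ (T-∧⇒ {length x ≡ᵇ _} t)
  H = checkedGraph {n} {s = sideBit w (length x)} ok
  n< : n < length x
  n< = subst (n <_) (sym m≡) (s≤s (m≤m+n n _))
  x≡ : ∀ i → i < length x → look x i ≡ look (encode H) i
  x≡ i i< with <-cmp i n
  ... | tri< i<n _ _ = trans (sym (look-pair x u i i<)) (trans
    (≡ᵇ⇒≡ _ 1 (Equivalence.from Bool.T-≡ (leading-< (length x) (λ i → look w (double i) ≡ᵇ 1) i i<n)))
    (sym (encode-ones H i i<n)))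
  ... | tri≈ _ refl _ = trans (sym (look-bit x i i<)) (trans
    (cong bool (trans (cong (_≡ᵇ 1) (sym (look-pair x u i i<))) (leading-fails (length x) (λ i → look w (double i) ≡ᵇ 1) i<)))
    (sym (encode-zero H)))
  ... | tri> _ _ n<i = subst (λ i → look x i ≡ look (encode H) i) index-≡
    (trans (sym (look-bit x _ index<)) (trans (cong bool (cong (_≡ᵇ 1) (sym (look-pair x u _ index<))))
      (sym (encode-adj H a b))))
    where
    k = i ∸ suc n
    k≡ : suc n + k ≡ i
    k≡ = m+[n∸m]≡n n<i
    k< : k < n * n
    k< = +-cancelˡ-< (suc n) k (n * n) (subst₂ _<_ (sym k≡) m≡ i<)
    0<n : 0 < n
    0<n = n≢0⇒n>0 λ n≡0 → n≮0 (subst (λ j → k < j * j) n≡0 k<)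
    a b : Fin n
    a = fromℕ< (quot-< k n n k<)
    b = fromℕ< (rem-< k n 0<n)
    index-≡ : suc (n + (toℕ a * n + toℕ b)) ≡ i
    index-≡ = trans (cong (λ j → suc (n + j)) (trans
      (cong₂ (λ q r → q * n + r) (Fin.toℕ-fromℕ< (quot-< k n n k<)) (Fin.toℕ-fromℕ< (rem-< k n 0<n)))
                (quot-rem k n 0<n))) k≡
    index< : suc (n + (toℕ a * n + toℕ b)) < length x
    index< = subst (_< length x) (sym index-≡) i<

variable
  fm fn fu fv : List Bool → Env α → ℕ

doubleᶜ : Comp α fm → Comp α λ w env → double (fm w env)
doubleᶜ {fm = fm} c = ext (λ w env → double-+ (fm w env)) (c ⊕ c)

adjᶜ : Comp α fn → Comp α fu → Comp α fv → Test α λ w env → adjBit w (fn w env) (fu w env) (fv w env)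
adjᶜ n u v = inp (doubleᶜ (one ⊕ (n ⊕ (u ⊗ n ⊕ v)))) ≡ᶜ one

sideᶜ : Comp α fm → Comp α fu → Test α λ w env → sideBit w (fm w env) (fu w env)
sideᶜ m u = inp (doubleᶜ m ⊕ (const 2 ⊕ u)) ≡ᶜ one

arcᶜ : Comp α fm → Comp α fn → Comp α fu → Comp α fv →
       Test α λ w env → arcBit w (fm w env) (fn w env) (fu w env) (fv w env)
arcᶜ m n u v = inp (doubleᶜ m ⊕ (const 2 ⊕ (n ⊕ (u ⊗ n ⊕ v)))) ≡ᶜ one

_xorᶜ_ : ∀ {p q : List Bool → Env α → Bool} → Test α p → Test α q → Test α λ w env → p w env xor q w env
_xorᶜ_ {p = p} {q} t t′ = test (ext (λ w env → cong bool (Bool.not-involutive (p w env xor q w env))) (comp (notᶜ (t ≡ᵗ t′))))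

verifyWithᶜ : Comp α fm → Comp α fn → Test α λ w env → verifyWith w (fm w env) (fn w env)
verifyWithᶜ {α} m n = (m ≡ᶜ one ⊕ (n ⊕ n ⊗ n)) ∧ᶜ allᶜ n vertexᶜ ∧ᶜ allᶜ n (allᶜ (wk n) pairᶜ) ∧ᶜ
    anyᶜ n (degreesᶜ ≡ᶜ const 3)
  where
  v₀ : ∀ {k} → Comp (suc k) λ _ env → env fz
  v₀ = var fz
  v₁ : ∀ {k} → Comp (suc (suc k)) λ _ env → env (fs fz)
  v₁ = var (fs fz)
  m₂ = wk (wk m)
  n₂ = wk (wk n)
  degreesᶜ = sum (wk n) (comp (adjᶜ n₂ v₁ v₀))
  intoᶜ    = sum (wk n) (comp (arcᶜ m₂ n₂ v₀ v₁))
  outᶜ     = sum (wk n) (comp (arcᶜ m₂ n₂ v₁ v₀))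
  into₂ : ∀ i → Comp (suc (suc α)) _
  into₂ i = sum n₂ (comp (arcᶜ (wk m₂) (wk n₂) v₀ (var (fs i))))
  out₂ : ∀ i → Comp (suc (suc α)) _
  out₂ i = sum n₂ (comp (arcᶜ (wk m₂) (wk n₂) (var (fs i)) v₀))
  vertexᶜ = notᶜ (adjᶜ (wk n) v₀ v₀) ∧ᶜ (degreesᶜ ≤ᶜ const 3) ∧ᶜ (intoᶜ ≤ᶜ one ⊕ outᶜ) ∧ᶜ (outᶜ ≤ᶜ one ⊕ intoᶜ)
  edgeᶜ = (sideᶜ m₂ v₁ xorᶜ sideᶜ m₂ v₀) ∧ᶜ (arcᶜ m₂ n₂ v₁ v₀ xorᶜ arcᶜ m₂ n₂ v₀ v₁) ∧ᶜ
    notᶜ (into₂ (fs fz) ⊕ out₂ fz ≡ᶜ into₂ fz ⊕ out₂ (fs fz))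
  pairᶜ = notᶜ (adjᶜ n₂ v₁ v₀ xorᶜ adjᶜ n₂ v₀ v₁) ∧ᶜ (notᶜ (arcᶜ m₂ n₂ v₁ v₀) ∨ᶜ adjᶜ n₂ v₁ v₀) ∧ᶜ
    (notᶜ (adjᶜ n₂ v₁ v₀) ∨ᶜ edgeᶜ)

verifyᶜ : Test 1 λ w env → verify w (env fz)
verifyᶜ = verifyWithᶜ m (leadingᶜ m (inp (doubleᶜ (var fz)) ≡ᶜ one))
  where
  m = leadingᶜ (var fz) (inp (doubleᶜ (var fz)) ≡ᶜ inp (one ⊕ doubleᶜ (var fz)))

problem∈NP : NP BipartiteMaxDegree3InOut≤1
-- A certificate is no longer than the encoded graph, and `poly 1 1` is the successor.
problem∈NP = _ , out-polyTime (emit (comp verifyᶜ)) , 1 , 1 , λ x → mk⇔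
  (λ { (n , G , refl , S , deg , k , ((D , proper , refl) , _) , le) →
       let open Certificate G S D in
       certificate ,
       ≤-trans length-certificate (≤-trans (≤-reflexive (sym (trans (*-identityˡ _) (^-identityʳ _)))) (m≤m+n _ 1)) ,
       cong List.[_] (trans (positive-bool _) (Equivalence.to Bool.T-≡ (verify-complete proper deg le))) })
  (λ { (u , _ , eq) → verify-sound x u
       (Equivalence.from Bool.T-≡ (trans (sym (positive-bool _)) (List.∷-injectiveˡ eq))) })

-- From not-all-equal formulas to graphs

count-cong : ∀ {n} {p q : Fin n → Bool} → (∀ i → p i ≡ q i) → count p ≡ count q
count-cong {zero}          eq = refl
count-cong {suc n} {p} {q} eq with p fz | q fz | eq fz
... | true  | _ | refl = cong suc (count-cong (eq ∘ fs))
... | false | _ | refl = count-cong (eq ∘ fs)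

count-suc : ∀ {n} (p : Fin (suc n) → Bool) → count p ≡ bool (p fz) + count (p ∘ fs)
count-suc p with p fz
... | true  = refl
... | false = refl

without : ∀ {n} → Fin n → (Fin n → Bool) → Fin n → Bool
without a p u = p u ∧ not (does (u Fin.≟ a))

count-without : ∀ {n} (p : Fin n → Bool) a → count p ≡ bool (p a) + count (without a p)
count-without p fz = trans (count-suc p) (cong (bool (p fz) +_) (sym (trans (count-suc (without fz p))
  (cong₂ _+_ (cong bool (Bool.∧-zeroʳ (p fz))) (count-cong λ i → Bool.∧-identityʳ (p (fs i)))))))
count-without p (fs a) = begin
  count p                                               ≡⟨ count-suc p ⟩
  bool (p fz) + count (p ∘ fs)                          ≡⟨ cong (bool (p fz) +_) (count-without (p ∘ fs) a) ⟩
  bool (p fz) + (bool (p (fs a)) + count (without a (p ∘ fs)))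
    ≡⟨ lemma (bool (p fz)) (bool (p (fs a))) (count (without a (p ∘ fs))) ⟩
  bool (p (fs a)) + (bool (p fz) + count (without a (p ∘ fs)))
    ≡⟨ cong (λ b → bool (p (fs a)) + (bool b + count (without a (p ∘ fs)))) (Bool.∧-identityʳ (p fz)) ⟨
  bool (p (fs a)) + (bool (p fz ∧ true) + count (without a (p ∘ fs)))
    ≡⟨ cong (bool (p (fs a)) +_) (count-suc (without (fs a) p)) ⟨
  bool (p (fs a)) + count (without (fs a) p)            ∎
  where
  open ≡-Reasoning
  lemma : ∀ a b c → a + (b + c) ≡ b + (a + c)
  lemma = solve-∀

trues : List Bool → ℕ
trues []       = 0
trues (b ∷ bs) = bool b + trues bs

-- Candidates are removed from the count one at a time; distinctness keeps each removal from
-- affecting the others, and nothing is left at the end.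
count-list : ∀ {n} (p : Fin n → Bool) {l} → Unique l → (∀ u → T (p u) → u ∈ l) → count p ≡ trues (List.map p l)
count-list {n} p [] h = none n p (λ u t → case (h u t))
  where
  case : ∀ {A : Set} {u : A} → u ∈ [] → ⊥
  case ()
  none : ∀ n (p : Fin n → Bool) → (∀ u → ¬ T (p u)) → count p ≡ 0
  none zero    p h = refl
  none (suc n) p h = trans (count-suc p) (cong₂ _+_ (cong bool (Bool.¬-not λ eq → h fz (subst T (sym eq) tt))) (none n (p ∘ fs) (h ∘ fs)))
count-list p {a ∷ l} (a≢ ∷ u) h = trans (count-without p a) (cong (bool (p a) +_)
  (trans (count-list (without a p) u rest) (cong trues (unaffected l a≢))))
  where
  rest : ∀ u → T (without a p u) → u ∈ l
  rest u t with u Fin.≟ a | h u (proj₁ (T-∧⇒ t)) | t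
  ... | no u≢a | here u≡a  | _  = ⊥-elim (u≢a u≡a)
  ... | no u≢a | there u∈l | _  = u∈l
  ... | yes _  | _         | t′ = ⊥-elim (subst T (Bool.∧-zeroʳ (p u)) t′)
  unaffected : ∀ l → All (a ≢_) l → List.map (without a p) l ≡ List.map p l
  unaffected []      []       = refl
  unaffected (b ∷ l) (a≢b ∷ r) = cong₂ _∷_
    (trans (cong (λ d → p b ∧ not d) (dec-false (b Fin.≟ a) (a≢b ∘ sym))) (Bool.∧-identityʳ (p b))) (unaffected l r)

-- The in-out-degree of a vertex in terms of its incident edges, with `true` for an edge that enters
-- it.
balance : List Bool → ℤ
balance bs = ℤ.+ trues bs ℤ.- ℤ.+ trues (List.map not bs)

module _ {n} (G : Graph n) where
  open Graph G

  record Neighbours (v : Fin n) (l : List (Fin n)) : Set where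
    field
      distinct : Unique l
      complete : ∀ u → T (adj v u) → u ∈ l
      sound    : All (λ u → T (adj v u)) l

  open Neighbours

  degree-local : ∀ {v l} → Neighbours v l → degree G v ≡ length l
  degree-local {v} N = trans (count-list (adj v) (distinct N) (complete N)) (all-true _ (sound N))
    where
    all-true : ∀ l → All (λ u → T (adj v u)) l → trues (List.map (adj v) l) ≡ length l
    all-true []      []      = refl
    all-true (u ∷ l) (t ∷ r) rewrite Equivalence.to Bool.T-≡ t = cong suc (all-true l r)

  open Orientation

  balance-local : ∀ (D : Orientation G) {v l} → Neighbours v l →
    inOutDegree D v ≡ balance (List.map (λ u → arc D u v) l)
  balance-local D {v} {l} N = cong₂ (λ i o → ℤ.+ i ℤ.- ℤ.+ o)
    (count-list (λ u → arc D u v) (distinct N) λ u t → complete N u (subst T (symmetric u v) (arc⇒adj D u v t)))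
    (trans (count-list (arc D v) (distinct N) λ u t → complete N u (arc⇒adj D v u t)) (cong trues (opposite l (sound N))))
    where
    opposite : ∀ l → All (λ u → T (adj v u)) l → List.map (arc D v) l ≡ List.map not (List.map (λ u → arc D u v) l)
    opposite []      []      = refl
    opposite (u ∷ l) (t ∷ r) = cong₂ _∷_
      (exactlyOne D u v (subst T (symmetric v u) t)) (opposite l r)

-- The graph of a not-all-equal formula

notAllEqual : Bool → Bool → Bool → Bool
notAllEqual a b c = (a xor b) ∨ (a xor c)

-- The kind is a number rather than a constructor, so that adjacency is a numerical test which a
-- `Comp` can evaluate.
data Vertex : Set where
  vertex : (kind x o : ℕ) → Vertex

pattern odd x o    = vertex 0 x o
pattern even x o   = vertex 1 x o
pattern leaf x o   = vertex 2 x o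
pattern tip x o    = vertex 3 x o
pattern clause x c = vertex 4 x c

cyclicNext : ℕ → ℕ → ℕ
cyclicNext K o = if suc o ≡ᵇ K then 0 else suc o

edgeTest : ℕ → (ℕ → ℕ) → Vertex → Vertex → Bool
edgeTest K lit (vertex k x o) (vertex k′ x′ o′) =
  ((k ≡ᵇ 0) ∧ (k′ ≡ᵇ 1) ∧ (x ≡ᵇ x′) ∧ (o ≡ᵇ o′)) ∨
  ((k ≡ᵇ 1) ∧ (k′ ≡ᵇ 0) ∧ (x ≡ᵇ x′) ∧ (o′ ≡ᵇ cyclicNext K o)) ∨
  ((k ≡ᵇ 2) ∧ (k′ ≡ᵇ 1) ∧ (x ≡ᵇ x′) ∧ (o ≡ᵇ o′)) ∨
  ((k ≡ᵇ 3) ∧ (k′ ≡ᵇ 0) ∧ (x ≡ᵇ x′) ∧ (o ≡ᵇ o′)) ∨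
  -- Every number below the order has to denote some vertex. Vertices of kind 4 that stand for no
  -- clause are isolated.
  ((k ≡ᵇ 4) ∧ (k′ ≡ᵇ 3) ∧ (x ≡ᵇ 0) ∧ (o ≡ᵇ quot o′ 3) ∧ (x′ ≡ᵇ lit o′))

decodeVertex : ℕ → ℕ → ℕ → Vertex
decodeVertex X K u = let r = rem u (X * K) in vertex (quot u (X * K)) (quot r K) (rem r K)

-- The variable gadget of x is an even cycle odd x 0, even x 0, odd x 1, even x 1, ...
-- with a pendant leaf at each even vertex.  The edge from odd x o to tip x o
-- carries the value of x to the o-th literal position; position 3 c + p belongs to clause c.
module NAEGraph (X C : ℕ) (lit : ℕ → ℕ) (0<X : 0 < X) (0<C : 0 < C) (lit< : ∀ o → o < C * 3 → lit o < X) where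

  K N : ℕ
  K = C * 3
  N = 5 * (X * K)

  1<K : 1 < K
  1<K = ≤-trans (s≤s (s≤s z≤n)) (*-monoˡ-≤ 3 0<C)

  0<K : 0 < K
  0<K = <-trans (s≤s z≤n) 1<K

  0<XK : 0 < X * K
  0<XK = *-mono-< 0<X 0<K

  next prev : ℕ → ℕ
  next     = cyclicNext K
  prev zero    = pred K
  prev (suc o) = o

  suc-pred-K : suc (pred K) ≡ K
  suc-pred-K = suc-pred K ⦃ >-nonZero 0<K ⦄

  next-last : ∀ {o} → suc o ≡ K → next o ≡ 0
  next-last eq rewrite eq | ≡ᵇ-refl K = refl

  next-suc : ∀ {o} → suc o < K → next o ≡ suc o
  next-suc lt rewrite ≢⇒≡ᵇ (<⇒≢ lt) = refl

  next-< : ∀ {o} → o < K → next o < K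
  next-< {o} o<K with m≤n⇒m<n∨m≡n o<K
  ... | inj₁ lt = subst (_< K) (sym (next-suc lt)) lt
  ... | inj₂ eq = subst (_< K) (sym (next-last eq)) 0<K

  prev-< : ∀ {o} → o < K → prev o < K
  prev-< {zero}  _   = subst (pred K <_) suc-pred-K ≤-refl
  prev-< {suc o} o<K = <-trans ≤-refl o<K

  prev-next : ∀ {o} → o < K → prev (next o) ≡ o
  prev-next {o} o<K with m≤n⇒m<n∨m≡n o<K
  ... | inj₁ lt = cong prev (next-suc lt)
  ... | inj₂ eq = trans (cong prev (next-last eq)) (cong pred (sym eq))

  next-prev : ∀ {o} → o < K → next (prev o) ≡ o
  next-prev {zero}  _   = next-last suc-pred-K
  next-prev {suc o} o<K = next-suc o<K

  -- For `K` equal to 1 the two cycle edges at a vertex would coincide; here `K` is three times a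
  -- positive number.
  next-≢ : ∀ o → next o ≢ o
  next-≢ o eq with suc o ≡ᵇ K in e
  ... | false = >⇒≢ ≤-refl eq
  ... | true  = <⇒≢ 1<K (trans (cong suc eq) (≡ᵇ-true {suc o} {K} e))

  data Edge : Vertex → Vertex → Set where
    oe : ∀ x o → Edge (odd x o) (even x o)
    eo : ∀ x o → Edge (even x o) (odd x (next o))
    le : ∀ x o → Edge (leaf x o) (even x o)
    to : ∀ x o → Edge (tip x o) (odd x o)
    ct : ∀ o → Edge (clause 0 (quot o 3)) (tip (lit o) o)

  edgeᵇ : Vertex → Vertex → Bool
  edgeᵇ = edgeTest K lit

  private
    split₄ : ∀ k l x y o p → T ((k ≡ᵇ l) ∧ (x ≡ᵇ y) ∧ o ∧ p) → k ≡ l × x ≡ y × T o × T p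
    split₄ k l x y o p t =
      let (a , t₁) = T-∧⇒ {k ≡ᵇ l} t ; (b , t₂) = T-∧⇒ {x ≡ᵇ y} t₁ ; (c , d) = T-∧⇒ {o} t₂
      in ≡ᵇ⇒≡ k l a , ≡ᵇ⇒≡ x y b , c , d

    ≡ᵇ-T : ∀ n → T (n ≡ᵇ n)
    ≡ᵇ-T n = ≡⇒≡ᵇ n n refl

    T-∨⇒ : ∀ {a b} → T (a ∨ b) → T a ⊎ T b
    T-∨⇒ = Equivalence.to Bool.T-∨

  edgeᵇ⇒ : ∀ v w → T (edgeᵇ v w) → Edge v w
  edgeᵇ⇒ (vertex k x o) (vertex k′ x′ o′) t with T-∨⇒ {(k ≡ᵇ 0) ∧ _} t
  ... | inj₁ t₁ with split₄ k 0 k′ 1 (x ≡ᵇ x′) (o ≡ᵇ o′) t₁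
  ... | refl , refl , a , b rewrite ≡ᵇ⇒≡ x x′ a | ≡ᵇ⇒≡ o o′ b = oe _ _
  edgeᵇ⇒ (vertex k x o) (vertex k′ x′ o′) t | inj₂ t₁ with T-∨⇒ {(k ≡ᵇ 1) ∧ _} t₁
  ... | inj₁ t₂ with split₄ k 1 k′ 0 (x ≡ᵇ x′) (o′ ≡ᵇ next o) t₂
  ... | refl , refl , a , b rewrite ≡ᵇ⇒≡ x x′ a | ≡ᵇ⇒≡ o′ (next o) b = eo _ _
  edgeᵇ⇒ (vertex k x o) (vertex k′ x′ o′) t | inj₂ t₁ | inj₂ t₂ with T-∨⇒ {(k ≡ᵇ 2) ∧ _} t₂
  ... | inj₁ t₃ with split₄ k 2 k′ 1 (x ≡ᵇ x′) (o ≡ᵇ o′) t₃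
  ... | refl , refl , a , b rewrite ≡ᵇ⇒≡ x x′ a | ≡ᵇ⇒≡ o o′ b = le _ _
  edgeᵇ⇒ (vertex k x o) (vertex k′ x′ o′) t | inj₂ t₁ | inj₂ t₂ | inj₂ t₃ with T-∨⇒ {(k ≡ᵇ 3) ∧ _} t₃
  ... | inj₁ t₄ with split₄ k 3 k′ 0 (x ≡ᵇ x′) (o ≡ᵇ o′) t₄
  ... | refl , refl , a , b rewrite ≡ᵇ⇒≡ x x′ a | ≡ᵇ⇒≡ o o′ b = to _ _
  edgeᵇ⇒ (vertex k x o) (vertex k′ x′ o′) t | inj₂ t₁ | inj₂ t₂ | inj₂ t₃ | inj₂ t₄ with split₄ k 4 k′ 3 (x ≡ᵇ 0) ((o ≡ᵇ quot o′ 3) ∧ (x′ ≡ᵇ lit o′)) t₄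
  ... | refl , refl , a , b with T-∧⇒ {o ≡ᵇ quot o′ 3} b
  ... | c , d rewrite ≡ᵇ⇒≡ x 0 a | ≡ᵇ⇒≡ o (quot o′ 3) c | ≡ᵇ⇒≡ x′ (lit o′) d = ct o′

  edgeᵇ⇐ : ∀ {v w} → Edge v w → T (edgeᵇ v w)
  edgeᵇ⇐ (oe x o) = Equivalence.from Bool.T-∨ (inj₁ (T-∧⇐ (≡ᵇ-T x) (≡ᵇ-T o)))
  edgeᵇ⇐ (eo x o) = Equivalence.from Bool.T-∨ (inj₁ (T-∧⇐ (≡ᵇ-T x) (≡ᵇ-T (next o))))
  edgeᵇ⇐ (le x o) = Equivalence.from Bool.T-∨ (inj₁ (T-∧⇐ (≡ᵇ-T x) (≡ᵇ-T o)))
  edgeᵇ⇐ (to x o) = Equivalence.from Bool.T-∨ (inj₁ (T-∧⇐ (≡ᵇ-T x) (≡ᵇ-T o)))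
  edgeᵇ⇐ (ct o)   = T-∧⇐ (≡ᵇ-T (quot o 3)) (≡ᵇ-T (lit o))

  edge-asym : ∀ {v w} → Edge v w → ¬ Edge w v
  edge-asym (oe x o) e = next-≢ o (sym (lemma e))
    where
    lemma : ∀ {x o o′} → Edge (even x o) (odd x o′) → o′ ≡ next o
    lemma (eo _ _) = refl
  edge-asym (eo x o) e = next-≢ o (lemma e)
    where
    lemma : ∀ {x o o′} → Edge (odd x o) (even x o′) → o ≡ o′
    lemma (oe _ _) = refl
  edge-asym (le x o) ()
  edge-asym (to x o) ()
  edge-asym (ct o) ()

  Bounded : Vertex → Set
  Bounded (vertex k x o) = k < 5 × x < X × o < K

  code : Vertex → ℕ
  code (vertex k x o) = k * (X * K) + (x * K + o)

  decode : ℕ → Vertex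
  decode = decodeVertex X K

  pair-< : ∀ {x o X} → x < X → o < K → x * K + o < X * K
  pair-< {x} {o} {X} x<X o<K = begin-strict
    x * K + o   <⟨ +-monoʳ-< (x * K) o<K ⟩
    x * K + K   ≡⟨ +-comm (x * K) K ⟩
    suc x * K   ≤⟨ *-monoˡ-≤ K x<X ⟩
    X * K       ∎
    where open ≤-Reasoning

  code-< : ∀ v → Bounded v → code v < N
  code-< (vertex k x o) (k<5 , x<X , o<K) = begin-strict
    k * (X * K) + (x * K + o) <⟨ +-monoʳ-< (k * (X * K)) (pair-< x<X o<K) ⟩
    k * (X * K) + X * K       ≡⟨ +-comm (k * (X * K)) (X * K) ⟩
    suc k * (X * K)           ≤⟨ *-monoˡ-≤ (X * K) k<5 ⟩
    N                         ∎
    where open ≤-Reasoning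

  decode-code : ∀ v → Bounded v → decode (code v) ≡ v
  decode-code (vertex k x o) (k<5 , x<X , o<K)
    rewrite rem-unique k (X * K) (x * K + o) (pair-< x<X o<K)
          | quot-unique k (X * K) (x * K + o) (pair-< x<X o<K)
          | quot-unique x K o o<K = cong (vertex k x) (m+n∸m≡n (x * K) o)

  code-decode : ∀ u → code (decode u) ≡ u
  code-decode u = trans (cong (quot u (X * K) * (X * K) +_) (quot-rem (rem u (X * K)) K 0<K)) (quot-rem u (X * K) 0<XK)

  decode-bounded : ∀ u → u < N → Bounded (decode u)
  decode-bounded u u<N =
    quot-< u 5 (X * K) u<N , quot-< _ X K (rem-< u (X * K) 0<XK) , rem-< (rem u (X * K)) K 0<K

  0<N : 0 < N
  0<N = *-mono-< {0} {5} (s≤s z≤n) 0<XK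

  -- The remainder makes `node` total; it does not change the code of a bounded vertex.
  node : Vertex → Fin N
  node v = fromℕ< (m%n<n (code v) N ⦃ >-nonZero 0<N ⦄)

  at′ : Fin N → Vertex
  at′ u = decode (toℕ u)

  at′-bounded : ∀ u → Bounded (at′ u)
  at′-bounded u = decode-bounded (toℕ u) (Fin.toℕ<n u)

  toℕ-node : ∀ {v} → Bounded v → toℕ (node v) ≡ code v
  toℕ-node {v} b = trans (Fin.toℕ-fromℕ< _) (m<n⇒m%n≡m ⦃ >-nonZero 0<N ⦄ (code-< v b))

  at′-node : ∀ {v} → Bounded v → at′ (node v) ≡ v
  at′-node {v} b = trans (cong decode (toℕ-node b)) (decode-code v b)

  node-at′ : ∀ u → node (at′ u) ≡ u
  node-at′ u = Fin.toℕ-injective (trans (toℕ-node (at′-bounded u)) (code-decode (toℕ u)))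

  Adjacent : Vertex → Vertex → Set
  Adjacent v w = Edge v w ⊎ Edge w v

  adjᵇ : Vertex → Vertex → Bool
  adjᵇ v w = edgeᵇ v w ∨ edgeᵇ w v

  adjᵇ⇒ : ∀ {v w} → T (adjᵇ v w) → Adjacent v w
  adjᵇ⇒ {v} {w} t with T-∨⇒ {edgeᵇ v w} t
  ... | inj₁ e = inj₁ (edgeᵇ⇒ v w e)
  ... | inj₂ e = inj₂ (edgeᵇ⇒ w v e)

  adjᵇ⇐ : ∀ {v w} → Adjacent v w → T (adjᵇ v w)
  adjᵇ⇐ (inj₁ e) = Equivalence.from Bool.T-∨ (inj₁ (edgeᵇ⇐ e))
  adjᵇ⇐ (inj₂ e) = Equivalence.from Bool.T-∨ (inj₂ (edgeᵇ⇐ e))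

  graph : Graph N
  graph = record
    { adj = λ u v → adjᵇ (at′ u) (at′ v)
    ; symmetric = λ u v → Bool.∨-comm (edgeᵇ (at′ u) (at′ v)) (edgeᵇ (at′ v) (at′ u))
    ; loopless = λ v → Bool.¬-not λ eq → irreflexive (adjᵇ⇒ {at′ v} {at′ v} (subst T (sym eq) tt)) }
    where
    irreflexive : ∀ {v} → ¬ Adjacent v v
    irreflexive (inj₁ e) = edge-asym e e
    irreflexive (inj₂ e) = edge-asym e e

  open Graph graph

  -- Neighbour lists, in the order in which balances are computed later. A tip is joined to a clause
  -- only if its variable occurs at its position; otherwise it is a leaf.
  data View : Vertex → List Vertex → Set where
    at-odd    : ∀ x o → View (odd x o) (even x (prev o) ∷ even x o ∷ tip x o ∷ [])
    at-even   : ∀ x o → View (even x o) (odd x o ∷ odd x (next o) ∷ leaf x o ∷ [])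
    at-leaf   : ∀ x o → View (leaf x o) (even x o ∷ [])
    at-used   : ∀ {x o} → x ≡ lit o → View (tip x o) (odd x o ∷ clause 0 (quot o 3) ∷ [])
    at-unused : ∀ {x o} → x ≢ lit o → View (tip x o) (odd x o ∷ [])
    at-clause : ∀ {c} → c < C → View (clause 0 c) (List.map (λ p → tip (lit (c * 3 + p)) (c * 3 + p)) (0 ∷ 1 ∷ 2 ∷ []))
    at-junk   : ∀ {x c} → ¬ (x ≡ 0 × c < C) → View (clause x c) []

  view : ∀ v → Bounded v → ∃[ l ] View v l
  view (odd x o)    _ = _ , at-odd x o
  view (even x o)   _ = _ , at-even x o
  view (leaf x o)   _ = _ , at-leaf x o
  view (tip x o)    _ with x ≟ lit o
  ... | yes eq = _ , at-used eq
  ... | no ne  = _ , at-unused ne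
  view (clause zero c) _ with c <? C
  ... | yes c<C = _ , at-clause c<C
  ... | no ¬c<C = _ , at-junk λ h → ¬c<C (proj₂ h)
  view (clause (suc x) c) _ = _ , at-junk λ ()
  view (vertex (suc (suc (suc (suc (suc _))))) _ _) (s≤s (s≤s (s≤s (s≤s (s≤s ())))) , _)

  view-complete : ∀ {v w l} → View v l → Bounded v → Bounded w → Adjacent v w → w ∈ l
  view-complete (at-odd x o)   _ _ (inj₁ (oe _ _)) = there (here refl)
  view-complete (at-odd x _)   _ (_ , _ , o<K) (inj₂ (eo _ o)) = here (cong (even x) (sym (prev-next o<K)))
  view-complete (at-odd x o)   _ _ (inj₂ (to _ _)) = there (there (here refl))
  view-complete (at-even x o)  _ _ (inj₁ (eo _ _)) = there (here refl)
  view-complete (at-even x o)  _ _ (inj₂ (oe _ _)) = here refl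
  view-complete (at-even x o)  _ _ (inj₂ (le _ _)) = there (there (here refl))
  view-complete (at-leaf x o)  _ _ (inj₁ (le _ _)) = here refl
  view-complete (at-used _)    _ _ (inj₁ (to _ _)) = here refl
  view-complete (at-used _)    _ _ (inj₂ (ct _))   = there (here refl)
  view-complete (at-unused _)  _ _ (inj₁ (to _ _)) = here refl
  view-complete (at-unused ne) _ _ (inj₂ (ct _))   = ⊥-elim (ne refl)
  view-complete (at-clause _)  _ _ (inj₁ (ct o))   = position {quot o 3} (rem o 3) (rem-< o 3 (s≤s z≤n)) (quot-rem o 3 (s≤s z≤n))
    where
    position : ∀ {c} p → p < 3 → c * 3 + p ≡ o →
      tip (lit o) o ∈ List.map (λ p → tip (lit (c * 3 + p)) (c * 3 + p)) (0 ∷ 1 ∷ 2 ∷ [])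
    position 0 _ refl = here refl
    position 1 _ refl = there (here refl)
    position 2 _ refl = there (there (here refl))
    position (suc (suc (suc _))) (s≤s (s≤s (s≤s ()))) _
  view-complete (at-junk j)    _ (_ , _ , o<K) (inj₁ (ct o)) = ⊥-elim (j (refl , quot-< o C 3 o<K))

  quot-position : ∀ c p → p < 3 → quot (c * 3 + p) 3 ≡ c
  quot-position c p p<3 = quot-unique c 3 p p<3

  position-< : ∀ {c p} → c < C → p < 3 → c * 3 + p < K
  position-< {c} {p} c<C p<3 = ≤-trans (+-monoʳ-< (c * 3) p<3) (≤-trans (≤-reflexive (+-comm (c * 3) 3)) (*-monoˡ-≤ 3 c<C))

  clause-edge : ∀ c p → p < 3 → Edge (clause 0 c) (tip (lit (c * 3 + p)) (c * 3 + p))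
  clause-edge c p p<3 = subst (λ c′ → Edge (clause 0 c′) (tip (lit (c * 3 + p)) (c * 3 + p))) (quot-position c p p<3) (ct (c * 3 + p))

  prev-edge : ∀ x {o} → o < K → Edge (even x (prev o)) (odd x o)
  prev-edge x {o} o<K = subst (λ o′ → Edge (even x (prev o)) (odd x o′)) (next-prev o<K) (eo x (prev o))

  view-sound : ∀ {v l} → View v l → Bounded v → All (Adjacent v) l
  view-sound (at-odd x o)  (_ , _ , o<K) = inj₂ (prev-edge x o<K) ∷ inj₁ (oe x o) ∷ inj₂ (to x o) ∷ []
  view-sound (at-even x o) _ = inj₂ (oe x o) ∷ inj₁ (eo x o) ∷ inj₂ (le x o) ∷ []
  view-sound (at-leaf x o) _ = inj₁ (le x o) ∷ []
  view-sound (at-used refl) _ = inj₁ (to _ _) ∷ inj₂ (ct _) ∷ []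
  view-sound (at-unused _) _ = inj₁ (to _ _) ∷ []
  view-sound (at-clause {c} _) _ = inj₁ (clause-edge c 0 (s≤s z≤n)) ∷ inj₁ (clause-edge c 1 (s≤s (s≤s z≤n))) ∷
    inj₁ (clause-edge c 2 ≤-refl) ∷ []
  view-sound (at-junk _)   _ = []

  -- Clause numbers are stored in the coordinate that ranges over literal positions.
  C≤K : C ≤ K
  C≤K = ≤-trans (≤-reflexive (sym (*-identityʳ C))) (*-monoʳ-≤ C (s≤s z≤n))

  view-bounded : ∀ {v l} → View v l → Bounded v → All Bounded l
  view-bounded (at-odd x o)   (_ , x<X , o<K) = (s≤s (s≤s z≤n) , x<X , prev-< o<K) ∷ (s≤s (s≤s z≤n) , x<X , o<K) ∷
    (s≤s (s≤s (s≤s (s≤s z≤n))) , x<X , o<K) ∷ []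
  view-bounded (at-even x o)  (_ , x<X , o<K) = (s≤s z≤n , x<X , o<K) ∷ (s≤s z≤n , x<X , next-< o<K) ∷
    (s≤s (s≤s (s≤s z≤n)) , x<X , o<K) ∷ []
  view-bounded (at-leaf x o)  (_ , x<X , o<K) = (s≤s (s≤s z≤n) , x<X , o<K) ∷ []
  view-bounded (at-used {o = o} _) (_ , x<X , o<K) = (s≤s z≤n , x<X , o<K) ∷
    (≤-refl , 0<X , <-≤-trans (quot-< o C 3 o<K) C≤K) ∷ []
  view-bounded (at-unused _)  (_ , x<X , o<K) = (s≤s z≤n , x<X , o<K) ∷ []
  view-bounded (at-clause {c} c<C) _ = bound 0 (s≤s z≤n) ∷ bound 1 (s≤s (s≤s z≤n)) ∷ bound 2 ≤-refl ∷ []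
    where
    bound : ∀ p → p < 3 → Bounded (tip (lit (c * 3 + p)) (c * 3 + p))
    bound p p<3 = s≤s (s≤s (s≤s (s≤s z≤n))) , lit< _ (position-< c<C p<3) , position-< c<C p<3
  view-bounded (at-junk _)    _ = []

  index : Vertex → ℕ
  index (vertex _ _ o) = o

  view-distinct : ∀ {v l} → View v l → Bounded v → Unique l
  view-distinct (at-odd x o)   (_ , _ , o<K) =
    ((λ eq → next-≢ (prev o) (trans (next-prev o<K) (sym (cong index eq)))) ∷ (λ ()) ∷ []) ∷ ((λ ()) ∷ []) ∷ [] ∷ []
  view-distinct (at-even x o)  _ = ((λ eq → next-≢ o (sym (cong index eq))) ∷ (λ ()) ∷ []) ∷ ((λ ()) ∷ []) ∷ [] ∷ []
  view-distinct (at-leaf x o)  _ = [] ∷ []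
  view-distinct (at-used _)    _ = ((λ ()) ∷ []) ∷ [] ∷ []
  view-distinct (at-unused _)  _ = [] ∷ []
  view-distinct (at-clause {c} _) _ = (differ (λ ()) ∷ differ (λ ()) ∷ []) ∷ (differ (λ ()) ∷ []) ∷ [] ∷ []
    where
    differ : ∀ {p q} → p ≢ q → tip (lit (c * 3 + p)) (c * 3 + p) ≢ tip (lit (c * 3 + q)) (c * 3 + q)
    differ {p} {q} p≢q eq = p≢q (+-cancelˡ-≡ (c * 3) p q (cong index eq))
  view-distinct (at-junk _)    _ = []

  adj⇐ : ∀ {v w} → Bounded v → Bounded w → Adjacent v w → T (adj (node v) (node w))
  adj⇐ bv bw e = adjᵇ⇐ (subst₂ Adjacent (sym (at′-node bv)) (sym (at′-node bw)) e)

  neighbours : ∀ {v l} → View v l → Bounded v → Neighbours graph (node v) (List.map node l)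
  neighbours {v} {l} vw b = record
    { distinct = unique (view-bounded vw b) (view-distinct vw b)
    ; complete = λ u t → subst (_∈ List.map node l) (node-at′ u) (∈-map⁺ node
        (view-complete vw b (at′-bounded u) (subst (λ v → Adjacent v (at′ u)) (at′-node b) (adjᵇ⇒ {at′ (node v)} {at′ u} t))))
    ; sound = All.map⁺ (sound (view-bounded vw b) (view-sound vw b)) }
    where
    node-≢ : ∀ {v w} → Bounded v → Bounded w → v ≢ w → node v ≢ node w
    node-≢ bv bw ne eq = ne (trans (sym (at′-node bv)) (trans (cong at′ eq) (at′-node bw)))
    unique : ∀ {l} → All Bounded l → Unique l → Unique (List.map node l)
    unique []       []       = []
    unique (b ∷ bs) (ne ∷ u) = All.map⁺ (apart b bs ne) ∷ unique bs u
      where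
      apart : ∀ {v l} → Bounded v → All Bounded l → All (v ≢_) l → All (λ w → node v ≢ node w) l
      apart b []         []       = []
      apart b (b′ ∷ bs′) (n ∷ ns) = node-≢ b b′ n ∷ apart b bs′ ns
    sound : ∀ {l} → All Bounded l → All (Adjacent v) l → All (λ w → T (adj (node v) (node w))) l
    sound []       []       = []
    sound (b′ ∷ bs) (e ∷ es) = adj⇐ b b′ e ∷ sound bs es

-- In-out-degrees at vertices of degree at most three

majority : Bool → Bool → Bool → Bool
majority a b c = (a ∧ b) ∨ (a ∧ c) ∨ (b ∧ c)

majority-agree : ∀ a b c d → majority a b c ≡ d → a ≡ not d → b ≡ d
majority-agree true  true  c     true  _ ()
majority-agree true  true  c     false () _
majority-agree true  false true  false () _
majority-agree true  false false false _ _ = refl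
majority-agree false true  true  true  _ _ = refl
majority-agree false true  false true  () _
majority-agree false false true  true  () _
majority-agree false false false true  () _
majority-agree false b     c     false _ ()
majority-agree true  b     c     true  _ ()

majority-split : ∀ a c → majority a (not a) c ≡ c
majority-split true  true  = refl
majority-split true  false = refl
majority-split false true  = refl
majority-split false false = refl

sign : Bool → ℤ
sign true  = ℤ.1ℤ
sign false = ℤ.-1ℤ

balance₃ : ∀ a b c → ℤ.∣ balance (a ∷ b ∷ c ∷ []) ∣ ≤ 1 → balance (a ∷ b ∷ c ∷ []) ≡ sign (majority a b c)
balance₃ true  true  true  (s≤s ())
balance₃ false false false (s≤s ())
balance₃ true  true  false _ = refl
balance₃ true  false true  _ = refl
balance₃ true  false false _ = refl
balance₃ false true  true  _ = refl
balance₃ false true  false _ = refl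
balance₃ false false true  _ = refl

balance₂ : ∀ a b → ℤ.∣ balance (a ∷ b ∷ []) ∣ ≤ 1 → b ≡ not a
balance₂ true  true  (s≤s ())
balance₂ true  false _ = refl
balance₂ false true  _ = refl
balance₂ false false (s≤s ())

-- `a` and `b` are the cycle edges at an even vertex and `c` is its pendant edge. If `a` equals `b`,
-- smallness makes `c` their negation, and then the vertex has the in-out-degree of its leaf.
pass-through : ∀ a b c → ℤ.∣ balance (a ∷ b ∷ c ∷ []) ∣ ≤ 1 →
               balance (a ∷ b ∷ c ∷ []) ≢ balance (not c ∷ []) → b ≡ not a
pass-through true  true  true  (s≤s ()) _
pass-through true  true  false _ ne = ⊥-elim (ne refl)
pass-through true  false c     _ _  = refl
pass-through false true  c     _ _  = refl
pass-through false false true  _ ne = ⊥-elim (ne refl)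
pass-through false false false (s≤s ()) _

balanced-notAllEqual : ∀ a b c → ℤ.∣ balance (not a ∷ not b ∷ not c ∷ []) ∣ ≤ 1 → T (notAllEqual a b c)
balanced-notAllEqual true  true  true  (s≤s ())
balanced-notAllEqual true  true  false _ = tt
balanced-notAllEqual true  false c     _ = tt
balanced-notAllEqual false true  c     _ = tt
balanced-notAllEqual false false true  _ = tt
balanced-notAllEqual false false false (s≤s ())

notAllEqual-balanced : ∀ a b c → T (notAllEqual a b c) → ∃[ s ] balance (not a ∷ not b ∷ not c ∷ []) ≡ sign s
notAllEqual-balanced true  true  false _ = false , refl
notAllEqual-balanced true  false true  _ = false , refl
notAllEqual-balanced true  false false _ = true , refl
notAllEqual-balanced false true  true  _ = false , refl
notAllEqual-balanced false true  false _ = true , refl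
notAllEqual-balanced false false true  _ = true , refl

sign-≤1 : ∀ b → ℤ.∣ sign b ∣ ≤ 1
sign-≤1 true  = ≤-refl
sign-≤1 false = ≤-refl

sign-≢0 : ∀ b → sign b ≢ ℤ.0ℤ
sign-≢0 true  ()
sign-≢0 false ()

sign-≢ : ∀ b → sign b ≢ sign (not b)
sign-≢ true  ()
sign-≢ false ()

sign-alternates : ∀ {a b c} → sign a ≢ sign b → sign b ≢ sign c → a ≡ c
sign-alternates {true}  {true}  ne _  = ⊥-elim (ne refl)
sign-alternates {false} {false} ne _  = ⊥-elim (ne refl)
sign-alternates {true}  {false} {true}  _ _  = refl
sign-alternates {true}  {false} {false} _ ne = ⊥-elim (ne refl)
sign-alternates {false} {true}  {true}  _ ne = ⊥-elim (ne refl)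
sign-alternates {false} {true}  {false} _ _  = refl

-- Orientations and satisfying assignments

NAESatisfied : ℕ → (ℕ → ℕ) → (ℕ → Bool) → Set
NAESatisfied C lit a = ∀ c → c < C → T (notAllEqual (a (lit (c * 3 + 0))) (a (lit (c * 3 + 1))) (a (lit (c * 3 + 2))))

module _ (X C : ℕ) (lit : ℕ → ℕ) (0<X : 0 < X) (0<C : 0 < C) (lit< : ∀ o → o < C * 3 → lit o < X) where
  open NAEGraph X C lit 0<X 0<C lit<
  open Graph graph
  open Orientation

  private
    odd-bounded : ∀ {x o} → x < X → o < K → Bounded (odd x o)
    odd-bounded x<X o<K = s≤s z≤n , x<X , o<K
    even-bounded : ∀ {x o} → x < X → o < K → Bounded (even x o)
    even-bounded x<X o<K = s≤s (s≤s z≤n) , x<X , o<K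
    leaf-bounded : ∀ {x o} → x < X → o < K → Bounded (leaf x o)
    leaf-bounded x<X o<K = s≤s (s≤s (s≤s z≤n)) , x<X , o<K
    tip-bounded : ∀ {x o} → x < X → o < K → Bounded (tip x o)
    tip-bounded x<X o<K = s≤s (s≤s (s≤s (s≤s z≤n))) , x<X , o<K
    clause-bounded : ∀ {c} → c < C → Bounded (clause 0 c)
    clause-bounded c<C = ≤-refl , 0<X , <-≤-trans c<C C≤K

  module Decode (D : Orientation graph) (proper : InOutProper D) (small : maxAbsInOutDegree D ≤ 1) where

    private
      A : Vertex → Vertex → Bool
      A v w = arc D (node v) (node w)

      flip : ∀ {v w} → Bounded v → Bounded w → Adjacent v w → A w v ≡ not (A v w)
      flip {v} {w} bv bw e = exactlyOne D (node v) (node w) (adj⇐ bv bw e)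

      net : Vertex → ℤ
      net v = inOutDegree D (node v)

      differ : ∀ {v w} → Bounded v → Bounded w → Adjacent v w → net v ≢ net w
      differ {v} {w} bv bw e = proper (node v) (node w) (adj⇐ bv bw e)

      net-≡ : ∀ {v l} → View v l → Bounded v → net v ≡ balance (List.map (λ u → arc D u (node v)) (List.map node l))
      net-≡ vw b = balance-local graph D (neighbours vw b)

      net-≤1 : ∀ {v l} → View v l → Bounded v → ℤ.∣ balance (List.map (λ u → arc D u (node v)) (List.map node l)) ∣ ≤ 1
      net-≤1 {v} vw b = subst (λ i → ℤ.∣ i ∣ ≤ 1) (net-≡ vw b)
        (≤-trans (maxOver-ub (λ v → ℤ.∣ inOutDegree D v ∣) (node v)) small)

      module _ {x} (x<X : x < X) where

        flow value major : ℕ → Bool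
        flow o  = A (odd x o) (even x o)
        value o = A (tip x o) (odd x o)
        major o = majority (flow (prev o)) (not (flow o)) (value o)

        flow-next : ∀ {o} → o < K → A (odd x (next o)) (even x o) ≡ not (flow o)
        flow-next {o} o<K = pass-through (flow o) (A (odd x (next o)) (even x o)) (A (leaf x o) (even x o)) (net-≤1 (at-even x o) be) λ eq →
          differ be bl (inj₂ (le x o)) (trans (net-≡ (at-even x o) be) (trans eq
            (trans (cong (λ b → balance (b ∷ [])) (sym (flip bl be (inj₁ (le x o))))) (sym (net-≡ (at-leaf x o) bl)))))
          where
          be = even-bounded x<X o<K
          bl = leaf-bounded x<X o<K

        flow-prev : ∀ {o} → o < K → A (even x (prev o)) (odd x o) ≡ flow (prev o)
        flow-prev {o} o<K = trans (flip (odd-bounded x<X o<K) (even-bounded x<X (prev-< o<K)) (inj₂ (prev-edge x o<K)))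
          (trans (cong not (subst (λ o′ → A (odd x o′) (even x (prev o)) ≡ not (flow (prev o))) (next-prev o<K) (flow-next (prev-< o<K))))
            (Bool.not-involutive _))

        odd-net : ∀ {o} → o < K → net (odd x o) ≡ sign (major o)
        odd-net {o} o<K = trans (net-≡ (at-odd x o) bo) (trans
          (balance₃ (A (even x (prev o)) (odd x o)) (A (even x o) (odd x o)) (value o) (net-≤1 (at-odd x o) bo))
          (cong₂ (λ a b → sign (majority a b (value o))) (flow-prev o<K)
            (flip bo (even-bounded x<X o<K) (inj₁ (oe x o)))))
          where
          bo = odd-bounded x<X o<K

        even-net : ∀ {o} → o < K → ∃[ s ] net (even x o) ≡ sign s
        even-net {o} o<K = _ , trans (net-≡ (at-even x o) be)
          (balance₃ (flow o) (A (odd x (next o)) (even x o)) (A (leaf x o) (even x o)) (net-≤1 (at-even x o) be))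
          where
          be = even-bounded x<X o<K

        -- Both odd vertices differ from the even vertex between them, and only two signs are
        -- possible.
        major-next : ∀ {o} → o < K → major (next o) ≡ major o
        major-next {o} o<K =
          let (s , eq) = even-net o<K in
          sym (sign-alternates {b = s}
            (subst₂ _≢_ (odd-net o<K) eq (differ (odd-bounded x<X o<K) (even-bounded x<X o<K) (inj₁ (oe x o))))
            (subst₂ _≢_ eq (odd-net (next-< o<K)) (differ (even-bounded x<X o<K) (odd-bounded x<X (next-< o<K)) (inj₁ (eo x o)))))

        major-≡ : ∀ o → o < K → major o ≡ major 0
        major-≡ zero    _   = refl
        major-≡ (suc o) o<K = trans (cong major (sym (next-suc o<K)))
          (trans (major-next (<-trans ≤-refl o<K)) (major-≡ o (<-trans ≤-refl o<K)))

        private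
          σ = major 0

        -- Once the flow around the cycle opposes σ, it keeps doing so; hence it never changes.
        flow-step : ∀ {o} → o < K → flow (prev o) ≡ not σ → flow o ≡ not σ
        flow-step {o} o<K eq = trans (sym (Bool.not-involutive (flow o)))
          (cong not (majority-agree (flow (prev o)) _ (value o) σ (major-≡ o o<K) eq))

        flow-onwards : ∀ {o} d → o + d < K → flow o ≡ not σ → flow (o + d) ≡ not σ
        flow-onwards {o} zero    _  eq = subst (λ j → flow j ≡ not σ) (sym (+-identityʳ o)) eq
        flow-onwards {o} (suc d) lt eq = subst (λ j → flow j ≡ not σ) (sym (+-suc o d))
          (flow-step (subst (_< K) (+-suc o d) lt) (flow-onwards d (<-trans (+-monoʳ-< o ≤-refl) lt) eq))

        -- If the last cycle edge opposes `σ`, this wraps round to position 0 and spreads to all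
        -- positions. Otherwise no position opposes `σ`, because opposition would spread to the last
        -- one.
        flow-constant : ∀ {o} → o < K → flow o ≡ flow (pred K)
        flow-constant {o} o<K with flow (pred K) Bool.≟ not σ
        ... | yes eq = trans (flow-onwards o o<K (flow-step 0<K eq)) (sym eq)
        ... | no ne  = trans (≢not (λ eq → ne (subst (λ j → flow j ≡ not σ) last≡
                         (flow-onwards (pred K ∸ o) (subst (_< K) (sym last≡) last<) eq)))) (sym (≢not ne))
          where
          o≤last : o ≤ pred K
          o≤last = s≤s⁻¹ (subst (o <_) (sym suc-pred-K) o<K)
          last≡ : o + (pred K ∸ o) ≡ pred K
          last≡ = m+[n∸m]≡n o≤last
          last< : pred K < K
          last< = prev-< {0} 0<K
          ≢not : ∀ {a b} → a ≢ not b → a ≡ b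
          ≢not {true}  {true}  _  = refl
          ≢not {false} {false} _  = refl
          ≢not {true}  {false} ne = ⊥-elim (ne refl)
          ≢not {false} {true}  ne = ⊥-elim (ne refl)

        -- With constant flow the two cycle edges at an odd vertex cancel, so the third edge decides
        -- the majority.
        value-≡ : ∀ {o} → o < K → value o ≡ σ
        value-≡ {o} o<K = trans (sym (majority-split (flow (prev o)) (value o)))
          (trans (cong (λ f → majority (flow (prev o)) (not f) (value o))
            (trans (flow-constant (prev-< o<K)) (sym (flow-constant o<K)))) (major-≡ o o<K))

    -- This is `major 0`, written out because `major` presupposes `x < X`.
    assignment : ℕ → Bool
    assignment x = majority (A (odd x (prev 0)) (even x (prev 0))) (not (A (odd x 0) (even x 0))) (A (tip x 0) (odd x 0))

    -- A used tip has degree 2 and is passed straight through: for a true literal the path runs from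
    -- the clause through the tip into the cycle.
    clause-value : ∀ {c} p → c < C → p < 3 →
      A (tip (lit (c * 3 + p)) (c * 3 + p)) (clause 0 c) ≡ not (assignment (lit (c * 3 + p)))
    clause-value {c} p c<C p<3 = trans (flip bc bt (inj₁ (clause-edge c p p<3))) (cong not
      (trans (balance₂ (A (odd x o) (tip x o)) _
               (subst (λ c′ → ℤ.∣ balance (A (odd x o) (tip x o) ∷ A (clause 0 c′) (tip x o) ∷ []) ∣ ≤ 1)
                 (quot-position c p p<3) (net-≤1 (at-used refl) bt)))
        (trans (sym (flip (odd-bounded x<X o<K) bt (inj₂ (to x o)))) (value-≡ x<X o<K))))
      where
      o = c * 3 + p
      x = lit o
      o<K = position-< c<C p<3
      x<X = lit< o o<K
      bc = clause-bounded c<C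
      bt = tip-bounded x<X o<K

    assignment-satisfies : NAESatisfied C lit assignment
    assignment-satisfies c c<C = balanced-notAllEqual (assignment (lit (c * 3 + 0))) (assignment (lit (c * 3 + 1))) (assignment (lit (c * 3 + 2)))
      (subst (λ bs → ℤ.∣ balance bs ∣ ≤ 1)
        (cong₂ _∷_ (clause-value 0 c<C (s≤s z≤n)) (cong₂ _∷_ (clause-value 1 c<C (s≤s (s≤s z≤n)))
          (cong (_∷ []) (clause-value 2 c<C ≤-refl))))
        (net-≤1 (at-clause c<C) (clause-bounded c<C)))

  module Encode (a : ℕ → Bool) (satisfied : NAESatisfied C lit a) where

    -- The direction of an edge v w: true if it is oriented from v to w.
    forwards : Vertex → Vertex → Bool
    forwards (odd _ _)      _              = true
    forwards (even _ _)     _              = true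
    forwards (leaf x _)     _              = not (a x)
    forwards (tip x _)      _              = a x
    forwards (vertex _ _ _) (vertex _ x _) = a x

    arcᵇ : Vertex → Vertex → Bool
    arcᵇ v w = (edgeᵇ v w ∧ forwards v w) ∨ (edgeᵇ w v ∧ not (forwards w v))

    private
      no-edge : ∀ {v w} → ¬ Edge v w → edgeᵇ v w ≡ false
      no-edge {v} {w} ne = Bool.¬-not λ eq → ne (edgeᵇ⇒ v w (subst T (sym eq) tt))

      yes-edge : ∀ {v w} → Edge v w → edgeᵇ v w ≡ true
      yes-edge e = Equivalence.to Bool.T-≡ (edgeᵇ⇐ e)

    arc-forwards : ∀ {v w} → Edge v w → arcᵇ v w ≡ forwards v w
    arc-forwards {v} {w} e rewrite yes-edge e | no-edge (edge-asym e) = Bool.∨-identityʳ _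

    arc-backwards : ∀ {v w} → Edge v w → arcᵇ w v ≡ not (forwards v w)
    arc-backwards {v} {w} e rewrite yes-edge e | no-edge (edge-asym e) = refl

    orientation : Orientation graph
    orientation = record
      { arc = λ u v → arcᵇ (at′ u) (at′ v)
      ; arc⇒adj = λ u v → arc⇒adjᵇ (at′ u) (at′ v)
      ; exactlyOne = λ u v t → exact (adjᵇ⇒ {at′ u} {at′ v} t) }
      where
      arc⇒adjᵇ : ∀ v w → T (arcᵇ v w) → T (adjᵇ v w)
      arc⇒adjᵇ v w t with edgeᵇ v w | edgeᵇ w v
      ... | true  | _    = tt
      ... | false | true = tt
      exact : ∀ {v w} → Adjacent v w → arcᵇ w v ≡ not (arcᵇ v w)
      exact (inj₁ e) = trans (arc-backwards e) (cong not (sym (arc-forwards e)))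
      exact (inj₂ e) = trans (arc-forwards e) (trans (sym (Bool.not-involutive _)) (cong not (sym (arc-backwards e))))

    flags : ∀ {v l} → View v l → List Bool
    flags (at-odd x o)        = true ∷ false ∷ a x ∷ []
    flags (at-even x o)       = true ∷ false ∷ not (a x) ∷ []
    flags (at-leaf x o)       = not (not (a x)) ∷ []
    flags (at-used {x} _)     = not (a x) ∷ a x ∷ []
    flags (at-unused {x} _)   = not (a x) ∷ []
    flags (at-clause {c} c<C) = not (a (lit (c * 3 + 0))) ∷ not (a (lit (c * 3 + 1))) ∷ not (a (lit (c * 3 + 2))) ∷ []
    flags (at-junk _)         = []

    flags-≡ : ∀ {v l} (vw : View v l) → Bounded v → List.map (λ w → arcᵇ w v) l ≡ flags vw
    flags-≡ (at-odd x o) (_ , _ , o<K) = cong₂ _∷_ (arc-forwards (prev-edge x o<K))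
      (cong₂ _∷_ (arc-backwards (oe x o)) (cong₂ _∷_ (arc-forwards (to x o)) refl))
    flags-≡ (at-even x o) _ = cong₂ _∷_ (arc-forwards (oe x o))
      (cong₂ _∷_ (arc-backwards (eo x o)) (cong₂ _∷_ (arc-forwards (le x o)) refl))
    flags-≡ (at-leaf x o) _ = cong₂ _∷_ (arc-backwards (le x o)) refl
    flags-≡ (at-used {x} {o} refl) _ = cong₂ _∷_ (arc-backwards (to x o)) (cong₂ _∷_ (arc-forwards (ct o)) refl)
    flags-≡ (at-unused {x} {o} _) _ = cong₂ _∷_ (arc-backwards (to x o)) refl
    flags-≡ (at-clause {c} _) _ = cong₂ _∷_ (arc-backwards (clause-edge c 0 (s≤s z≤n)))
      (cong₂ _∷_ (arc-backwards (clause-edge c 1 (s≤s (s≤s z≤n)))) (cong₂ _∷_ (arc-backwards (clause-edge c 2 ≤-refl)) refl))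
    flags-≡ (at-junk _) _ = refl

    net-flags : ∀ {v l} (vw : View v l) → Bounded v → inOutDegree orientation (node v) ≡ balance (flags vw)
    net-flags {v} {l} vw b = trans (balance-local graph orientation (neighbours vw b))
      (cong balance (trans (at-nodes l (view-bounded vw b)) (flags-≡ vw b)))
      where
      at-nodes : ∀ l → All Bounded l → List.map (λ u → arcᵇ (at′ u) (at′ (node v))) (List.map node l) ≡ List.map (λ w → arcᵇ w v) l
      at-nodes []      []         = refl
      at-nodes (w ∷ l) (bw ∷ bs) = cong₂ _∷_ (cong₂ arcᵇ (at′-node bw) (at′-node b)) (at-nodes l bs)

    clause-sign : ∀ {c} → c < C → ∃[ s ]
      balance (not (a (lit (c * 3 + 0))) ∷ not (a (lit (c * 3 + 1))) ∷ not (a (lit (c * 3 + 2))) ∷ []) ≡ sign s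
    clause-sign {c} c<C = notAllEqual-balanced (a (lit (c * 3 + 0))) (a (lit (c * 3 + 1))) (a (lit (c * 3 + 2))) (satisfied c c<C)

    balance-odd : ∀ b → balance (true ∷ false ∷ b ∷ []) ≡ sign b
    balance-odd true  = refl
    balance-odd false = refl

    balance-pendant : ∀ b → balance (b ∷ []) ≡ sign b
    balance-pendant true  = refl
    balance-pendant false = refl

    balance-used : ∀ b → balance (not b ∷ b ∷ []) ≡ ℤ.0ℤ
    balance-used true  = refl
    balance-used false = refl

    flags-≤1 : ∀ {v l} (vw : View v l) → ℤ.∣ balance (flags vw) ∣ ≤ 1
    flags-≤1 (at-odd x o)        = subst (λ i → ℤ.∣ i ∣ ≤ 1) (sym (balance-odd (a x))) (sign-≤1 (a x))
    flags-≤1 (at-even x o)       = subst (λ i → ℤ.∣ i ∣ ≤ 1) (sym (balance-odd (not (a x)))) (sign-≤1 (not (a x)))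
    flags-≤1 (at-leaf x o)       = subst (λ i → ℤ.∣ i ∣ ≤ 1) (sym (balance-pendant (not (not (a x))))) (sign-≤1 (not (not (a x))))
    flags-≤1 (at-used {x} _)     = subst (λ i → ℤ.∣ i ∣ ≤ 1) (sym (balance-used (a x))) z≤n
    flags-≤1 (at-unused {x} _)   = subst (λ i → ℤ.∣ i ∣ ≤ 1) (sym (balance-pendant (not (a x)))) (sign-≤1 (not (a x)))
    flags-≤1 (at-clause {c} c<C) = let (s , eq) = clause-sign c<C in
      subst (λ i → ℤ.∣ i ∣ ≤ 1) (sym eq) (sign-≤1 s)
    flags-≤1 (at-junk _)         = z≤n

    orientation-small : maxAbsInOutDegree orientation ≤ 1
    orientation-small = maxOver-lub λ u → subst (λ u → ℤ.∣ inOutDegree orientation u ∣ ≤ 1) (node-at′ u)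
      (let (_ , vw) = view (at′ u) (at′-bounded u) in
       subst (λ i → ℤ.∣ i ∣ ≤ 1) (sym (net-flags vw (at′-bounded u))) (flags-≤1 vw))

    edge-proper : ∀ {v w} → Bounded v → Bounded w → Edge v w →
      inOutDegree orientation (node v) ≢ inOutDegree orientation (node w)
    edge-proper bv bw (oe x o) = subst₂ _≢_ (sym (trans (net-flags (at-odd x o) bv) (balance-odd (a x))))
      (sym (trans (net-flags (at-even x o) bw) (balance-odd (not (a x))))) (sign-≢ (a x))
    edge-proper bv bw (eo x o) = subst₂ _≢_ (sym (trans (net-flags (at-even x o) bv) (balance-odd (not (a x)))))
      (sym (trans (net-flags (at-odd x (next o)) bw) (balance-odd (a x)))) (≢-sym (sign-≢ (a x)))
    edge-proper bv bw (le x o) = subst₂ _≢_ (sym (trans (net-flags (at-leaf x o) bv) (balance-pendant _)))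
      (sym (trans (net-flags (at-even x o) bw) (balance-odd (not (a x))))) (≢-sym (sign-≢ (not (a x))))
    edge-proper bv bw (to x o) with x ≟ lit o
    ... | yes eq = subst₂ _≢_ (sym (trans (net-flags (at-used eq) bv) (balance-used (a x))))
      (sym (trans (net-flags (at-odd x o) bw) (balance-odd (a x)))) (≢-sym (sign-≢0 (a x)))
    ... | no ne  = subst₂ _≢_ (sym (trans (net-flags (at-unused ne) bv) (balance-pendant _)))
      (sym (trans (net-flags (at-odd x o) bw) (balance-odd (a x)))) (≢-sym (sign-≢ (a x)))
    edge-proper bv bw@(_ , _ , o<K) (ct o) =
      let c<C = quot-< o C 3 o<K ; (s , eq) = clause-sign c<C in
      subst₂ _≢_ (sym (trans (net-flags (at-clause c<C) bv) eq))
        (sym (trans (net-flags (at-used refl) bw) (balance-used (a (lit o))))) (sign-≢0 s)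

    orientation-proper : InOutProper orientation
    orientation-proper u v t eq with adjᵇ⇒ {at′ u} {at′ v} t
    ... | inj₁ e = edge-proper (at′-bounded u) (at′-bounded v) e
      (subst₂ (λ u v → inOutDegree orientation u ≡ inOutDegree orientation v) (sym (node-at′ u)) (sym (node-at′ v)) eq)
    ... | inj₂ e = edge-proper (at′-bounded v) (at′-bounded u) e
      (subst₂ (λ u v → inOutDegree orientation u ≡ inOutDegree orientation v) (sym (node-at′ v)) (sym (node-at′ u)) (sym eq))

  graph-bipartite : Bipartite graph
  graph-bipartite = (λ u → side (at′ u)) , λ u v t → alternates (adjᵇ⇒ {at′ u} {at′ v} t)
    where
    side : Vertex → Bool
    side (odd _ _)  = true
    side (leaf _ _) = true
    side (vertex 4 _ _) = true
    side _          = false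
    alternate : ∀ {v w} → Edge v w → side v ≢ side w
    alternate (oe _ _) ()
    alternate (eo _ _) ()
    alternate (le _ _) ()
    alternate (to _ _) ()
    alternate (ct _)   ()
    alternates : ∀ {v w} → Adjacent v w → side v ≢ side w
    alternates (inj₁ e) = alternate e
    alternates (inj₂ e) = ≢-sym (alternate e)

  graph-maxDegree : maxDegree graph ≡ 3
  graph-maxDegree = ≤-antisym
    (maxOver-lub λ u → subst (λ u → degree graph u ≤ 3) (node-at′ u)
      (let (_ , vw) = view (at′ u) (at′-bounded u) in
       ≤-trans (≤-reflexive (degree-local graph (neighbours vw (at′-bounded u)))) (short vw)))
    (≤-trans (≤-reflexive (sym (degree-local graph (neighbours (at-odd 0 0) (odd-bounded 0<X 0<K)))))
      (maxOver-ub (degree graph) (node (odd 0 0))))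
    where
    short : ∀ {v l} → View v l → length (List.map node l) ≤ 3
    short (at-odd _ _)  = ≤-refl
    short (at-even _ _) = ≤-refl
    short (at-leaf _ _) = s≤s z≤n
    short (at-used _)   = s≤s (s≤s z≤n)
    short (at-unused _) = s≤s z≤n
    short (at-clause _) = ≤-refl
    short (at-junk _)   = z≤n

  graph-complete : ∀ a → NAESatisfied C lit a → IsSolution graph
  graph-complete a sat = graph-bipartite , graph-maxDegree ,
    number-≤1 graph {node (odd 0 0)} {node (even 0 0)} (adj⇐ (odd-bounded 0<X 0<K) (even-bounded 0<X 0<K) (inj₁ (oe 0 0)))
      orientation orientation-proper orientation-small
    where open Encode a sat

  -- Membership yields some graph with the same encoding, so its order and adjacency are read back
  -- from the word before its orientation can be transported. The order is recovered with `vertices`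
  -- from the verifier, applied to a pair with an empty certificate.
  encode-graph-sound : BipartiteMaxDegree3InOut≤1 (encode graph) → ∃[ a ] NAESatisfied C lit a
  encode-graph-sound (n , G , eq , _ , _ , k , ((D , proper , refl) , _) , small) = transport n G n≡ eq D proper small
    where
    ones : ∀ {n} (G : Graph n) → vertices (pair (encode G) []) (length (encode G)) ≡ n
    ones {n} G = leading-≡ (length (encode G)) n _ (<⇒≤ n<)
      (λ i i<n → cong (_≡ᵇ 1) (trans (look-pair (encode G) [] i (<-trans i<n n<)) (encode-ones G i i<n)))
      (λ _ → cong (_≡ᵇ 1) (trans (look-pair (encode G) [] n n<) (encode-zero G)))
      where
      n< : n < length (encode G)
      n< = subst (n <_) (sym (length-encode G)) (s≤s (m≤m+n n _))
    n≡ : N ≡ n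
    n≡ = trans (sym (ones graph)) (trans (cong (λ w → vertices (pair w []) (length w)) eq) (ones G))
    transport : ∀ n (G : Graph n) → N ≡ n → encode graph ≡ encode G → (D : Orientation G) → InOutProper D →
                maxAbsInOutDegree D ≤ 1 → ∃[ a ] NAESatisfied C lit a
    transport _ G refl eq D proper small = assignment , assignment-satisfies
      where
      same : ∀ u v → adj u v ≡ Graph.adj G u v
      same u v = bool-injective (trans (sym (encode-adj graph u v))
        (trans (cong (λ w → look w (suc (N + (toℕ u * N + toℕ v)))) eq) (encode-adj G u v)))
      D′ : Orientation graph
      D′ = record
        { arc = arc D
        ; arc⇒adj = λ u v t → subst T (sym (same u v)) (arc⇒adj D u v t)
        ; exactlyOne = λ u v t → exactlyOne D u v (subst T (same u v) t) }
      open Decode D′ (λ u v t → proper u v (subst T (same u v) t)) small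

-- The encoding as a printed word

tabulate-concatTo : ∀ n (f : ℕ → Bool) → List.tabulate {n = n} (f ∘ toℕ) ≡ concatTo n λ i → f i ∷ []
tabulate-concatTo zero    f = refl
tabulate-concatTo (suc n) f = cong (f 0 ∷_) (tabulate-concatTo n (f ∘ suc))

concat-concatTo : ∀ n (f : ℕ → List Bool) → List.concat (List.tabulate {n = n} (f ∘ toℕ)) ≡ concatTo n f
concat-concatTo zero    f = refl
concat-concatTo (suc n) f = cong (f 0 ++_) (concat-concatTo n (f ∘ suc))

replicate-concatTo : ∀ n b → replicate n b ≡ concatTo n λ _ → b ∷ []
replicate-concatTo zero    b = refl
replicate-concatTo (suc n) b = cong (b ∷_) (replicate-concatTo n b)

concatTo-cong : ∀ n {f g} → (∀ i → f i ≡ g i) → concatTo n f ≡ concatTo n g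
concatTo-cong zero    eq = refl
concatTo-cong (suc n) eq = cong₂ _++_ (eq 0) (concatTo-cong n (eq ∘ suc))

edgeBetween : ℕ → ℕ → (ℕ → ℕ) → ℕ → ℕ → Bool
edgeBetween X K lit u v = edgeTest K lit (decodeVertex X K u) (decodeVertex X K v)

matrixWord : ℕ → (ℕ → ℕ → Bool) → List Bool
matrixWord N f = concatTo N (λ _ → true ∷ []) ++ false ∷ concatTo N λ u → concatTo N λ v → f u v ∷ []

encode-matrixWord : ∀ {N} (G : Graph N) f → (∀ u v → Graph.adj G u v ≡ f (toℕ u) (toℕ v)) → encode G ≡ matrixWord N f
encode-matrixWord {N} G f eq = cong₂ (λ ones matrix → ones ++ false ∷ matrix) (replicate-concatTo N true)
  (trans (cong List.concat (List.tabulate-cong λ u → trans (List.tabulate-cong (eq u)) (tabulate-concatTo N (f (toℕ u)))))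
    (concat-concatTo N λ u → concatTo N λ v → f u v ∷ []))

-- Opaque, since otherwise comparing words of this symbolic length unrolls them.
opaque
  order : ℕ → ℕ → ℕ
  order X C = 5 * (X * (C * 3))

  adjacency : ℕ → ℕ → (ℕ → ℕ) → ℕ → ℕ → Bool
  adjacency X C lit u v = edgeBetween X (C * 3) lit u v ∨ edgeBetween X (C * 3) lit v u

graphWord : ℕ → ℕ → (ℕ → ℕ) → List Bool
graphWord X C lit = matrixWord (order X C) (adjacency X C lit)

module _ (X C : ℕ) (lit : ℕ → ℕ) (0<X : 0 < X) (0<C : 0 < C) (lit< : ∀ o → o < C * 3 → lit o < X) where

  private
    opaque
      unfolding order adjacency
      encode-graph : encode (NAEGraph.graph X C lit 0<X 0<C lit<) ≡ graphWord X C lit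
      encode-graph = encode-matrixWord (NAEGraph.graph X C lit 0<X 0<C lit<) (adjacency X C lit) λ _ _ → refl

  graphWord-complete : ∀ a → NAESatisfied C lit a → BipartiteMaxDegree3InOut≤1 (graphWord X C lit)
  graphWord-complete a sat = _ , NAEGraph.graph X C lit 0<X 0<C lit< , sym encode-graph ,
    graph-complete X C lit 0<X 0<C lit< a sat

  graphWord-sound : BipartiteMaxDegree3InOut≤1 (graphWord X C lit) → ∃[ a ] NAESatisfied C lit a
  graphWord-sound h = encode-graph-sound X C lit 0<X 0<C lit< (subst BipartiteMaxDegree3InOut≤1 (sym encode-graph) h)

-- From clauses to not-all-equal formulas

-- The literals v and ¬ v are numbered 2 v and 2 v + 1.
literal : (ℕ → Bool) → ℕ → Bool
literal a zero          = a 0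
literal a (suc zero)    = not (a 0)
literal a (suc (suc q)) = literal (a ∘ suc) q

literal-pos : ∀ a v → literal a (double v) ≡ a v
literal-pos a zero    = refl
literal-pos a (suc v) = literal-pos (a ∘ suc) v

literal-neg : ∀ a v → literal a (suc (double v)) ≡ not (a v)
literal-neg a zero    = refl
literal-neg a (suc v) = literal-neg (a ∘ suc) v

literal-unique : ∀ a V (ν : ℕ → Bool) → (∀ v → v < V → ν (double v) ≡ a v) → (∀ v → v < V → ν (suc (double v)) ≡ not (a v)) →
                 ∀ q → q < double V → literal a q ≡ ν q
literal-unique a (suc V) ν pos neg zero          _              = sym (pos 0 (s≤s z≤n))
literal-unique a (suc V) ν pos neg (suc zero)    _              = sym (neg 0 (s≤s z≤n))
literal-unique a (suc V) ν pos neg (suc (suc q)) (s≤s (s≤s lt)) =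
  literal-unique (a ∘ suc) V (ν ∘ suc ∘ suc) (λ v lt → pos (suc v) (s≤s lt)) (λ v lt → neg (suc v) (s≤s lt)) q lt

literal-cong : ∀ {a a′} V → (∀ v → v < V → a′ v ≡ a v) → ∀ q → q < double V → literal a′ q ≡ literal a q
literal-cong {a} {a′} V eq q lt = sym (literal-unique a V (literal a′) (λ v v< → trans (literal-pos a′ v) (eq v v<))
  (λ v v< → trans (literal-neg a′ v) (cong not (eq v v<))) q lt)

double-mono-< : ∀ {m n} → m < n → suc (double m) < double n
double-mono-< {zero}  (s≤s _)  = s≤s (s≤s z≤n)
double-mono-< {suc m} (s≤s lt) = s≤s (s≤s (double-mono-< lt))

some : ℕ → (ℕ → Bool) → Bool
some zero    f = false
some (suc k) f = some k f ∨ f k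

some-true : ∀ k f → some k f ≡ true → ∃[ i ] i < k × f i ≡ true
some-true (suc k) f eq with some k f in eq′
... | true  = let (i , i<k , t) = some-true k f eq′ in i , m<n⇒m<1+n i<k , t
... | false = k , ≤-refl , eq

some-false : ∀ k f → some k f ≡ false → ∀ i → i < k → f i ≡ false
some-false (suc k) f eq i i<k with some k f in eq′ | m≤n⇒m<n∨m≡n (s≤s⁻¹ i<k)
... | false | inj₁ lt   = some-false k f eq′ i lt
... | false | inj₂ refl = eq

some-intro : ∀ k f i → i < k → f i ≡ true → some k f ≡ true
some-intro k f i i<k t with some k f in eq
... | true  = refl
... | false = trans (sym (some-false k f eq i i<k)) t

-- Literal r of the list of all literals of R / L clauses with L literals each; V is the number of variables.
-- Variable 0 of the not-all-equal instance stands for falsity, then come the V given variables, and then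
-- variable y r, which is false exactly if a literal of the clause of r up to r itself is true.
chainLiteral : (V L : ℕ) → (ℕ → ℕ) → ℕ → ℕ → ℕ
chainLiteral V L l r p =
  if p ≡ᵇ 0 then (if rem r L ≡ᵇ 0 then 0 else suc (double (V + r))) else
  if p ≡ᵇ 1 then 2 + l r else
  (if rem (suc r) L ≡ᵇ 0 then 0 else double (suc (V + r)))

-- Not-all-equal constraints have no negation here: the two literals of a variable become two
-- variables of the instance. The first `suc (V + R)` clauses contain one of them once and the other
-- twice, and thereby make them complementary.
naeLiteral : (V R L : ℕ) → (ℕ → ℕ) → ℕ → ℕ → ℕ
naeLiteral V R L l c p =
  if c <ᵇ suc (V + R) then (if p ≡ᵇ 0 then double c else suc (double c)) else chainLiteral V L l (c ∸ suc (V + R)) p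

naeLit : (V R L : ℕ) → (ℕ → ℕ) → ℕ → ℕ
naeLit V R L l o = naeLiteral V R L l (quot o 3) (rem o 3)

CNFSatisfied : (M L : ℕ) → (ℕ → ℕ) → (ℕ → Bool) → Set
CNFSatisfied M L l a = ∀ m → m < M → ∃[ i ] i < L × literal a (l (m * L + i)) ≡ true

module WideClauses (V M L : ℕ) (l : ℕ → ℕ) (0<L : 0 < L) (l< : ∀ r → r < M * L → l r < double V) where

  R B C X : ℕ
  R = M * L
  B = suc (V + R)
  C = B + R
  X = double B

  lit : ℕ → ℕ
  lit = naeLit V R L l

  0<C : 0 < C
  0<C = s≤s z≤n

  0<X : 0 < X
  0<X = s≤s z≤n

  private
    lit-≡ : ∀ c p → p < 3 → lit (c * 3 + p) ≡ naeLiteral V R L l c p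
    lit-≡ c p p<3 = cong₂ (naeLiteral V R L l) (quot-unique c 3 p p<3) (rem-unique c 3 p p<3)

    complement-≡ : ∀ {c} p → c < B → naeLiteral V R L l c p ≡ (if p ≡ᵇ 0 then double c else suc (double c))
    complement-≡ {c} p c<B with c <ᵇ B | <⇒<ᵇ c<B
    ... | true | _ = refl

    chain-≡ : ∀ r p → naeLiteral V R L l (B + r) p ≡ chainLiteral V L l r p
    chain-≡ r p with (B + r) <ᵇ B in eq
    ... | true  = ⊥-elim (m+n≮m B r (<ᵇ⇒< (B + r) B (subst T (sym eq) tt)))
    ... | false = cong (λ r → chainLiteral V L l r p) (m+n∸m≡n B r)

    row-< : ∀ {m i} → m < M → i < L → m * L + i < R
    row-< {m} {i} m<M i<L = ≤-trans (+-monoʳ-< (m * L) i<L) (≤-trans (≤-reflexive (+-comm (m * L) L)) (*-monoˡ-≤ L m<M))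

    chainLiteral-< : ∀ r p → r < R → chainLiteral V L l r p < X
    chainLiteral-< r zero r<R with rem r L ≡ᵇ 0
    ... | true  = s≤s z≤n
    ... | false = double-mono-< (m<n⇒m<1+n (+-monoʳ-< V r<R))
    chainLiteral-< r (suc zero) r<R = s≤s (s≤s (<-≤-trans (l< r r<R) (double-mono-≤ (m≤m+n V R))))
      where
      double-mono-≤ : ∀ {m n} → m ≤ n → double m ≤ double n
      double-mono-≤ z≤n      = z≤n
      double-mono-≤ (s≤s le) = s≤s (s≤s (double-mono-≤ le))
    chainLiteral-< r (suc (suc p)) r<R with rem (suc r) L ≡ᵇ 0
    ... | true  = s≤s z≤n
    ... | false = <-trans ≤-refl (double-mono-< (s≤s (+-monoʳ-< V r<R)))

    cases : ∀ {c} {A : Set} → c < C → (c < B → A) → (∀ r → r < R → c ≡ B + r → A) → A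
    cases {c} c<C f g with c <? B
    ... | yes c<B = f c<B
    ... | no  c≮B = g (c ∸ B) (+-cancelˡ-< B _ _ (subst (_< C) eq c<C)) eq
      where
      eq : c ≡ B + (c ∸ B)
      eq = sym (m+[n∸m]≡n (≮⇒≥ c≮B))

  lit-< : ∀ o → o < C * 3 → lit o < X
  lit-< o o< = cases (quot-< o C 3 o<)
    (λ c<B → subst (_< X) (sym (complement-≡ (rem o 3) c<B)) (below (rem o 3) c<B))
    (λ r r<R eq → subst (_< X) (sym (trans (cong (λ c → naeLiteral V R L l c (rem o 3)) eq) (chain-≡ r (rem o 3))))
      (chainLiteral-< r (rem o 3) r<R))
    where
    below : ∀ {c} p → c < B → (if p ≡ᵇ 0 then double c else suc (double c)) < X
    below zero    c<B = <-trans ≤-refl (double-mono-< c<B)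
    below (suc p) c<B = double-mono-< c<B

  private
    start-≡ : ∀ m → rem (m * L + 0) L ≡ 0
    start-≡ m = rem-unique m L 0 0<L

    middle-≢ : ∀ m {i} → suc i < L → rem (m * L + suc i) L ≡ suc i
    middle-≢ m lt = rem-unique m L _ lt

    end-≡ : ∀ m {i} → suc i ≡ L → rem (suc (m * L + i)) L ≡ 0
    end-≡ m {i} eq = trans (cong (λ r → rem r L) (trans (sym (+-suc (m * L) i))
      (trans (cong (m * L +_) eq) (trans (+-comm (m * L) L) (sym (+-identityʳ (suc m * L))))))) (start-≡ (suc m))

    inner-≡ : ∀ m {i} → suc i < L → rem (suc (m * L + i)) L ≡ suc i
    inner-≡ m {i} lt = trans (cong (λ r → rem r L) (sym (+-suc (m * L) i))) (middle-≢ m lt)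

    first-start : ∀ m → chainLiteral V L l (m * L + 0) 0 ≡ 0
    first-start m rewrite start-≡ m = refl

    first-middle : ∀ m {i} → suc i < L → chainLiteral V L l (m * L + suc i) 0 ≡ suc (double (suc (V + (m * L + i))))
    first-middle m {i} lt rewrite middle-≢ m lt = cong (suc ∘ double) (trans (cong (V +_) (+-suc (m * L) i)) (+-suc V _))

    third-end : ∀ m {i} → suc i ≡ L → chainLiteral V L l (m * L + i) 2 ≡ 0
    third-end m eq rewrite end-≡ m eq = refl

    third-inner : ∀ m {i} → suc i < L → chainLiteral V L l (m * L + i) 2 ≡ double (suc (V + (m * L + i)))
    third-inner m lt rewrite inner-≡ m lt = refl

  module ToNAE (a : ℕ → Bool) (sat : CNFSatisfied M L l a) where

    private
      value : ℕ → ℕ → Bool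
      value m i = literal a (l (m * L + i))

      extended : ℕ → Bool
      extended zero    = false
      extended (suc n) = if n <ᵇ V then a n else
        (let r = n ∸ V in not (some (suc (rem r L)) (value (quot r L))))

    naeAssignment : ℕ → Bool
    naeAssignment = literal extended

    private
      b : ℕ → Bool
      b = naeAssignment

      given : ∀ {r} → r < R → b (2 + l r) ≡ literal a (l r)
      given {r} r<R = literal-cong V same (l r) (l< r r<R)
        where
        same : ∀ v → v < V → extended (suc v) ≡ a v
        same v v<V with v <ᵇ V | <⇒<ᵇ v<V
        ... | true | _ = refl

      link : ∀ m i → i < L → extended (suc (V + (m * L + i))) ≡ not (some (suc i) (value m))
      link m i i<L with (V + (m * L + i)) <ᵇ V in eq
      ... | true  = ⊥-elim (m+n≮m V _ (<ᵇ⇒< (V + (m * L + i)) V (subst T (sym eq) tt)))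
      ... | false = cong not (cong₂ (λ k j → some (suc j) (value k))
        (trans (cong (λ r → quot r L) (m+n∸m≡n V (m * L + i))) (quot-unique m L i i<L))
        (trans (cong (λ r → rem r L) (m+n∸m≡n V (m * L + i))) (rem-unique m L i i<L)))

      first : ∀ m i → i < L → b (chainLiteral V L l (m * L + i) 0) ≡ some i (value m)
      first m zero    i<L = cong b (first-start m)
      first m (suc i) i<L = trans (cong b (first-middle m i<L)) (trans (literal-neg extended (suc (V + (m * L + i))))
        (trans (cong not (link m i (<-trans ≤-refl i<L))) (Bool.not-involutive _)))

      third : ∀ m i → m < M → i < L → b (chainLiteral V L l (m * L + i) 2) ≡ not (some (suc i) (value m))
      third m i m<M i<L with m≤n⇒m<n∨m≡n i<L
      ... | inj₁ lt = trans (cong b (third-inner m lt)) (trans (literal-pos extended (suc (V + (m * L + i)))) (link m i i<L))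
      -- Satisfaction enters here: at the end of a clause the third place is falsity instead of a
      -- new variable, and this is the right value because some literal of the clause is true.
      ... | inj₂ eq = let (j , j<L , t) = sat m m<M in
        trans (cong b (third-end m eq)) (cong not (sym (some-intro (suc i) (value m) j (subst (j <_) (sym eq) j<L) t)))

      -- `p` says that an earlier literal of the clause is true and `x` is the current one. The
      -- third entry, the negation of `p ∨ x`, is what the next link uses in negated form.
      chain-holds : ∀ p x → T (notAllEqual p x (not (p ∨ x)))
      chain-holds true  x     = Equivalence.from (Bool.T-∨ {not x}) (inj₂ tt)
      chain-holds false true  = tt
      chain-holds false false = tt

      complement-holds : ∀ x → T (notAllEqual x (not x) (not x))
      complement-holds true  = tt
      complement-holds false = tt

    nae-satisfied : NAESatisfied C lit naeAssignment
    nae-satisfied c c<C = subst T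
      (sym (cong₂ (λ u v → (u xor proj₁ v) ∨ (u xor proj₂ v)) (cong b (lit-≡ c 0 (s≤s z≤n)))
        (cong₂ _,_ (cong b (lit-≡ c 1 (s≤s (s≤s z≤n)))) (cong b (lit-≡ c 2 ≤-refl)))))
      (cases {c} c<C complementary chained)
      where
      Goal : Set
      Goal = T (notAllEqual (b (naeLiteral V R L l c 0)) (b (naeLiteral V R L l c 1)) (b (naeLiteral V R L l c 2)))
      complementary : c < B → Goal
      complementary c<B rewrite complement-≡ 0 c<B | complement-≡ 1 c<B | complement-≡ 2 c<B
        | literal-pos extended c | literal-neg extended c = complement-holds (extended c)
      chained : ∀ r → r < R → c ≡ B + r → Goal
      chained r r<R refl rewrite chain-≡ r 0 | chain-≡ r 1 | chain-≡ r 2 =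
        subst (λ r → T (notAllEqual (b (chainLiteral V L l r 0)) (b (2 + l r)) (b (chainLiteral V L l r 2))))
          (quot-rem r L 0<L) holds
        where
        m = quot r L
        i = rem r L
        i<L = rem-< r L 0<L
        m<M = quot-< r M L r<R
        holds : T (notAllEqual (b (chainLiteral V L l (m * L + i) 0)) (b (2 + l (m * L + i))) (b (chainLiteral V L l (m * L + i) 2)))
        holds rewrite first m i i<L | third m i m<M i<L | given (row-< m<M i<L) = chain-holds (some i (value m)) (value m i)

  module FromNAE (b : ℕ → Bool) (sat : NAESatisfied C lit b) where

    private
      ν : ℕ → Bool
      ν q = b q xor b 0

      -- Not-all-equal constraints are invariant under complementing all values, so the variable for
      -- falsity may be normalised to false.
      xor-shift : ∀ k x y z → T (notAllEqual x y z) → T (notAllEqual (x xor k) (y xor k) (z xor k))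
      xor-shift true  true  true  false _ = tt
      xor-shift true  true  false true  _ = tt
      xor-shift true  true  false false _ = tt
      xor-shift true  false true  true  _ = tt
      xor-shift true  false true  false _ = tt
      xor-shift true  false false true  _ = tt
      xor-shift false true  true  false _ = tt
      xor-shift false true  false true  _ = tt
      xor-shift false true  false false _ = tt
      xor-shift false false true  true  _ = tt
      xor-shift false false true  false _ = tt
      xor-shift false false false true  _ = tt

      holds : ∀ c → c < C → T (notAllEqual (ν (naeLiteral V R L l c 0)) (ν (naeLiteral V R L l c 1)) (ν (naeLiteral V R L l c 2)))
      holds c c<C = xor-shift (b 0) (b (naeLiteral V R L l c 0)) (b (naeLiteral V R L l c 1)) (b (naeLiteral V R L l c 2)) (subst T
        (cong₂ (λ u v → (u xor proj₁ v) ∨ (u xor proj₂ v)) (cong b (lit-≡ c 0 (s≤s z≤n)))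
          (cong₂ _,_ (cong b (lit-≡ c 1 (s≤s (s≤s z≤n)))) (cong b (lit-≡ c 2 ≤-refl)))) (sat c c<C))

      falsity : ν 0 ≡ false
      falsity with b 0
      ... | true  = refl
      ... | false = refl

      complement-elim : ∀ x y → T (notAllEqual x y y) → y ≡ not x
      complement-elim true  false _ = refl
      complement-elim false true  _ = refl

      ν-neg : ∀ v → v < B → ν (suc (double v)) ≡ not (ν (double v))
      ν-neg v v<B = complement-elim _ _ (subst T
        (cong₂ (λ u w → (u xor proj₁ w) ∨ (u xor proj₂ w)) (cong ν (complement-≡ {v} 0 v<B))
          (cong₂ _,_ (cong ν (complement-≡ {v} 1 v<B)) (cong ν (complement-≡ {v} 2 v<B))))
        (holds v (<-≤-trans v<B (m≤m+n B R))))

    assignment : ℕ → Bool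
    assignment v = ν (double (suc v))

    private
      given : ∀ r → r < R → literal assignment (l r) ≡ ν (2 + l r)
      given r r<R = literal-unique assignment V (ν ∘ suc ∘ suc) (λ v _ → refl)
        (λ v v<V → ν-neg (suc v) (s≤s (<-≤-trans v<V (m≤m+n V R)))) (l r) (l< r r<R)

      third-true : ∀ {x y z} → T (notAllEqual x y z) → x ≡ false → y ≡ false → z ≡ true
      third-true {z = true} _ refl refl = refl

      chain : ∀ r → r < R → T (notAllEqual (ν (chainLiteral V L l r 0)) (ν (2 + l r)) (ν (chainLiteral V L l r 2)))
      chain r r<R = subst T
        (cong₂ (λ u w → (u xor proj₁ w) ∨ (u xor proj₂ w)) (cong ν (chain-≡ r 0))
          (cong₂ _,_ (cong ν (chain-≡ r 1)) (cong ν (chain-≡ r 2))))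
        (holds (B + r) (+-monoʳ-< B r<R))

    -- If all literals of a clause were false, each link would start with false and thus end with
    -- true, by induction along the chain; but the last link ends with falsity.
    cnf-satisfied : CNFSatisfied M L l assignment
    cnf-satisfied m m<M with some L (λ i → literal assignment (l (m * L + i))) in eq
    ... | true  = some-true L _ eq
    ... | false = ⊥-elim (contradiction (pred L) last≡)
      where
      all-false : ∀ i → i < L → ν (2 + l (m * L + i)) ≡ false
      all-false i i<L = trans (sym (given _ (row-< m<M i<L))) (some-false L _ eq i i<L)
      last≡ : suc (pred L) ≡ L
      last≡ = suc-pred L ⦃ >-nonZero 0<L ⦄
      first-false : ∀ i → i < L → ν (chainLiteral V L l (m * L + i) 0) ≡ false
      third-is-true : ∀ i → i < L → ν (chainLiteral V L l (m * L + i) 2) ≡ true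
      first-false zero    i<L = trans (cong ν (first-start m)) falsity
      first-false (suc i) i<L = trans (cong ν (first-middle m i<L)) (trans
        (ν-neg (suc (V + (m * L + i))) (s≤s (+-monoʳ-< V (row-< m<M (<-trans ≤-refl i<L)))))
        (cong not (trans (cong ν (sym (third-inner m i<L))) (third-is-true i (<-trans ≤-refl i<L)))))
      third-is-true i i<L = third-true (chain _ (row-< m<M i<L)) (first-false i i<L) (all-false i i<L)
      contradiction : ∀ i → suc i ≡ L → ⊥
      contradiction i e with trans (sym (third-is-true i (subst (i <_) e ≤-refl))) (trans (cong ν (third-end m e)) falsity)
      ... | ()

-- The Cook–Levin theorem

variable
  A A′ : Set

All-concatMap⁺ : ∀ {P : A′ → Set} {f : A → List A′} xs → (∀ x → All P (f x)) → All P (List.concatMap f xs)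
All-concatMap⁺ []       h = []
All-concatMap⁺ (x ∷ xs) h = All.++⁺ (h x) (All-concatMap⁺ xs h)

All-concatMap⁻ : ∀ {P : A′ → Set} {f : A → List A′} {xs x} → All P (List.concatMap f xs) → x ∈ xs → All P (f x)
All-concatMap⁻ {f = f} {y ∷ _} h (here refl)  = All.++⁻ˡ (f y) h
All-concatMap⁻ {f = f} {y ∷ _} h (there x∈xs) = All-concatMap⁻ (All.++⁻ʳ (f y) h) x∈xs

module _ {m : ℕ} where

  _≟ˢ_ : DecidableEquality (Symbol m)
  blank  ≟ˢ blank  = yes refl
  blank  ≟ˢ bit _  = no λ ()
  blank  ≟ˢ mark _ = no λ ()
  bit _  ≟ˢ blank  = no λ ()
  bit a  ≟ˢ bit b  = map′ (cong bit) (λ { refl → refl }) (a Bool.≟ b)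
  bit _  ≟ˢ mark _ = no λ ()
  mark _ ≟ˢ blank  = no λ ()
  mark _ ≟ˢ bit _  = no λ ()
  mark i ≟ˢ mark j = map′ (cong mark) (λ { refl → refl }) (i Fin.≟ j)

  symbols : List (Symbol m)
  symbols = blank ∷ bit false ∷ bit true ∷ List.map mark (List.allFin m)

  ∈-symbols : ∀ a → a ∈ symbols
  ∈-symbols blank       = here refl
  ∈-symbols (bit false) = there (here refl)
  ∈-symbols (bit true)  = there (there (here refl))
  ∈-symbols (mark i)    = there (there (there (∈-map⁺ mark (∈-allFin i))))

  vectors : ∀ k → List (Vec (Symbol m) k)
  vectors zero    = [] ∷ []
  vectors (suc k) = List.concatMap (λ a → List.map (a ∷_) (vectors k)) symbols

  ∈-vectors : ∀ {k} (as : Vec (Symbol m) k) → as ∈ vectors k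
  ∈-vectors []       = here refl
  ∈-vectors (a ∷ as) = ∈-concatMap⁺ (λ a → List.map (a ∷_) (vectors _))
    (Any.map (λ { refl → ∈-map⁺ (a ∷_) (∈-vectors as) }) (∈-symbols a))

  get : List (Symbol m) → ℕ → Symbol m
  get []       _       = blank
  get (x ∷ _)  zero    = x
  get (_ ∷ xs) (suc i) = get xs i

-- Tapes relative to the head

-- A tape consists of the cells L 0, L 1, ... to the left of the head, nearest first, and
-- R 0, R 1, ... from the head to the right.
data Side : Set where
  L R : Side

half : ∀ {m} → Side → Tape m → List (Symbol m)
half L t = Tape.before t
half R t = Tape.head t ∷ Tape.after t

-- Cell numbers in clause schemes: constants, or the parameter `e` of the scheme plus a constant.
data Index : Set where
  fixed shifted : ℕ → Index

indexAt : Index → ℕ → ℕ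
indexAt (fixed k)   e = k
indexAt (shifted k) e = k + e

-- The cell of the new tape that holds the symbol just written. Cells are numbered from the head, so
-- it depends on the move alone.
target : Move → Side × ℕ
target left  = R , 1
target right = L , 0
target stay  = R , 0

-- Old and new numbers of all other cells. Apart from an exception near the head the renumbering is
-- a shift on each side, so a move takes at most three clause schemes.
transfers : Move → List ((Side × Index) × (Side × Index))
transfers left  = ((L , fixed 0) , (R , fixed 0)) ∷ ((R , shifted 1) , (R , shifted 2)) ∷ ((L , shifted 1) , (L , shifted 0)) ∷ []
transfers right = ((L , shifted 0) , (L , shifted 1)) ∷ ((R , shifted 1) , (R , shifted 0)) ∷ []
transfers stay  = ((R , shifted 1) , (R , shifted 1)) ∷ ((L , shifted 0) , (L , shifted 0)) ∷ []

module _ {m : ℕ} where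

  cellAt : Side → Tape m → ℕ → Symbol m
  cellAt s t i = get (half s t) i

  get-uncons : ∀ (xs : List (Symbol m)) → proj₁ (uncons xs) ≡ get xs 0
  get-uncons []      = refl
  get-uncons (_ ∷ _) = refl

  get-rest : ∀ (xs : List (Symbol m)) i → get (proj₂ (uncons xs)) i ≡ get xs (suc i)
  get-rest []      i = refl
  get-rest (_ ∷ _) i = refl

  get-uncons∷ : ∀ (xs : List (Symbol m)) i → get (proj₁ (uncons xs) ∷ proj₂ (uncons xs)) i ≡ get xs i
  get-uncons∷ xs zero    = get-uncons xs
  get-uncons∷ xs (suc i) = get-rest xs i

  target-correct : ∀ y mv (t : Tape m) → cellAt (proj₁ (target mv)) (act (y , mv) t) (proj₂ (target mv)) ≡ y
  target-correct y left  t = refl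
  target-correct y right t = refl
  target-correct y stay  t = refl

  transfers-correct : ∀ y mv (t : Tape m) e → All (λ { ((s , i) , (s′ , i′)) →
    cellAt s′ (act (y , mv) t) (indexAt i′ e) ≡ cellAt s t (indexAt i e) }) (transfers mv)
  transfers-correct y left  (tape ls x rs) e = get-uncons ls ∷ refl ∷ get-rest ls e ∷ []
  transfers-correct y right (tape ls x rs) e = refl ∷ get-uncons∷ rs e ∷ []
  transfers-correct y stay  (tape ls x rs) e = refl ∷ refl ∷ []

-- Every cell after the move is the target or the end of a transfer from a cell that is at most one farther away.
covered : ∀ mv s i (P : Side → ℕ → Set) →
  P (proj₁ (target mv)) (proj₂ (target mv)) →
  (∀ {p} e → p ∈ transfers mv → e ≤ i → indexAt (proj₂ (proj₁ p)) e ≤ suc i →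
     P (proj₁ (proj₂ p)) (indexAt (proj₂ (proj₂ p)) e)) → P s i
covered left  L i       P h g = g i (there (there (here refl))) ≤-refl ≤-refl
covered left  R 0       P h g = g 0 (here refl) z≤n z≤n
covered left  R 1       P h g = h
covered left  R (suc (suc i)) P h g = g i (there (here refl)) (≤-trans (n≤1+n i) (n≤1+n _)) (s≤s (≤-trans (n≤1+n i) (n≤1+n _)))
covered right L 0       P h g = h
covered right L (suc i) P h g = g i (here refl) (n≤1+n i) (≤-trans (n≤1+n i) (n≤1+n _))
covered right R i       P h g = g i (there (here refl)) ≤-refl ≤-refl
covered stay  L i       P h g = g i (there (here refl)) ≤-refl (n≤1+n i)
covered stay  R 0       P h g = h
covered stay  R (suc i) P h g = g i (here refl) (n≤1+n i) (s≤s (n≤1+n i))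

-- Numbering of pairs

-- An injective polynomial: t + i is the integer square root of the value.
pairing : ℕ → ℕ → ℕ
pairing t i = (t + i) * (t + i) + i

√ : ℕ → ℕ
√ v = leading v λ k → suc k * suc k ≤ᵇ v

-- As `i ≤ t + i`, the value lies below the next square.
√-pairing : ∀ t i → √ (pairing t i) ≡ t + i
√-pairing t i = leading-≡ v s _ (≤-trans (s≤s*s s) (m≤m+n (s * s) i))
  (λ k k<s → Equivalence.to Bool.T-≡ (≤⇒≤ᵇ (≤-trans (*-mono-≤ k<s k<s) (m≤m+n (s * s) i))))
  (λ _ → Bool.¬-not λ eq → <⇒≱ too-big (≤ᵇ⇒≤ (suc s * suc s) v (Equivalence.from Bool.T-≡ eq)))
  where
  s = t + i
  v = pairing t i
  s≤s*s : ∀ s → s ≤ s * s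
  s≤s*s zero    = z≤n
  s≤s*s (suc s) = m≤m*n (suc s) (suc s)
  too-big : v < suc s * suc s
  too-big = ≤-trans (s≤s (+-monoʳ-≤ (s * s) (≤-trans (m≤n+m i t) (m≤m+n s s)))) (≤-reflexive (lemma s))
    where
    lemma : ∀ s → suc (s * s + (s + s)) ≡ suc s * suc s
    lemma = solve-∀

unpair : ℕ → ℕ × ℕ
unpair v = let s = √ v ; i = v ∸ s * s in s ∸ i , i

unpair-pairing : ∀ t i → unpair (pairing t i) ≡ (t , i)
unpair-pairing t i rewrite √-pairing t i | m+n∸m≡n ((t + i) * (t + i)) i = cong (_, i) (m+n∸n≡m t i)

pairingᶜ : ∀ {n} {f g : List Bool → Env n → ℕ} → Comp n f → Comp n g → Comp n λ w env → pairing (f w env) (g w env)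
pairingᶜ t i = (t ⊕ i) ⊗ (t ⊕ i) ⊕ i

-- The clauses of a computation

module CookLevin (M : TM) (c k c′ k′ : ℕ) where
  open TM M

  tapes : ℕ
  tapes = suc work

  data Family : Set where
    inState : Fin states → Family
    shows  : Side → Fin tapes → Symbol marks → Family

  #families : ℕ
  #families = states + 2 * (tapes * (3 + marks))

  private
    symbolIndex : Symbol marks → Fin (3 + marks)
    symbolIndex blank       = fz
    symbolIndex (bit false) = fs fz
    symbolIndex (bit true)  = fs (fs fz)
    symbolIndex (mark i)    = fs (fs (fs i))

    indexSymbol : Fin (3 + marks) → Symbol marks
    indexSymbol fz               = blank
    indexSymbol (fs fz)          = bit false
    indexSymbol (fs (fs fz))     = bit true
    indexSymbol (fs (fs (fs i))) = mark i

    indexSymbol-symbolIndex : ∀ a → indexSymbol (symbolIndex a) ≡ a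
    indexSymbol-symbolIndex blank       = refl
    indexSymbol-symbolIndex (bit false) = refl
    indexSymbol-symbolIndex (bit true)  = refl
    indexSymbol-symbolIndex (mark i)    = refl

    sideIndex : Side → Fin 2
    sideIndex L = fz
    sideIndex R = fs fz

    indexSide : Fin 2 → Side
    indexSide fz      = L
    indexSide (fs fz) = R

    indexSide-sideIndex : ∀ s → indexSide (sideIndex s) ≡ s
    indexSide-sideIndex L = refl
    indexSide-sideIndex R = refl

  familyIndex : Family → Fin #families
  familyIndex (inState q)    = Fin.join states _ (inj₁ q)
  familyIndex (shows s j a) = Fin.join states _ (inj₂ (Fin.combine (sideIndex s) (Fin.combine j (symbolIndex a))))

  private
    indexShows : Fin 2 → Fin tapes × Fin (3 + marks) → Family
    indexShows s (j , a) = shows (indexSide s) j (indexSymbol a)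

    indexCell : Fin 2 × Fin (tapes * (3 + marks)) → Family
    indexCell (s , ja) = indexShows s (Fin.remQuot (3 + marks) ja)

  indexFamily : Fin #families → Family
  indexFamily f = Sum.[ inState , (λ r → indexCell (Fin.remQuot (tapes * (3 + marks)) r)) ] (Fin.splitAt states f)

  indexFamily-familyIndex : ∀ f → indexFamily (familyIndex f) ≡ f
  indexFamily-familyIndex (inState q) = cong Sum.[ inState , _ ] (Fin.splitAt-join states _ (inj₁ q))
  indexFamily-familyIndex (shows s j a) = begin
    indexFamily (familyIndex (shows s j a))
      ≡⟨ cong Sum.[ inState , _ ] (Fin.splitAt-join states (2 * (tapes * (3 + marks))) (inj₂ sja)) ⟩
    indexCell (Fin.remQuot (tapes * (3 + marks)) sja)
      ≡⟨ cong indexCell (Fin.remQuot-combine (sideIndex s) (Fin.combine j (symbolIndex a))) ⟩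
    indexShows (sideIndex s) (Fin.remQuot (3 + marks) (Fin.combine j (symbolIndex a)))
      ≡⟨ cong (indexShows (sideIndex s)) (Fin.remQuot-combine j (symbolIndex a)) ⟩
    shows (indexSide (sideIndex s)) j (indexSymbol (symbolIndex a))
      ≡⟨ cong₂ (λ s a → shows s j a) (indexSide-sideIndex s) (indexSymbol-symbolIndex a) ⟩
    shows s j a ∎
    where
    open ≡-Reasoning
    sja = Fin.combine (sideIndex s) (Fin.combine j (symbolIndex a))

  variableCode : Family → ℕ → ℕ → ℕ
  variableCode f t i = pairing t i * #families + toℕ (familyIndex f)

  -- Atoms depend on the input and the numbers e, t, n, where n is the length of the input.
  record Atom : Set where
    field
      {familyOf}     : List Bool → Env 3 → Family
      {time index}   : List Bool → Env 3 → ℕ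
      codeᶜ          : Comp 3 λ w env → variableCode (familyOf w env) (time w env) (index w env)

  Literal : Set
  Literal = Bool × Atom

  Clause : Set
  Clause = Literal × List Literal

  at_⟨_,_⟩ : Family → ∀ {time index} → Comp 3 time → Comp 3 index → Atom
  at_⟨_,_⟩ f {time} {index} t i = record
    { familyOf = λ _ _ → f ; time = time ; index = index
    ; codeᶜ = pairingᶜ t i ⊗ const #families ⊕ const (toℕ (familyIndex f)) }

  -- Clauses are schemes that do not depend on the input, so the input bits have to act inside an
  -- atom.
  select : ∀ {p} → Test 3 p → Atom → Atom → Atom
  select {p} t a b = record
    { familyOf = λ w env → if p w env then familyOf a w env else familyOf b w env
    ; time     = λ w env → if p w env then time a w env else time b w env
    ; index    = λ w env → if p w env then index a w env else index b w env
    ; codeᶜ    = ext (λ w env → lemma (p w env)) (ifᶜ t (codeᶜ a) (codeᶜ b)) }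
    where
    open Atom
    lemma : ∀ b {f f′ t t′ i i′} → (if b then variableCode f t i else variableCode f′ t′ i′) ≡
            variableCode (if b then f else f′) (if b then t else t′) (if b then i else i′)
    lemma true  = refl
    lemma false = refl

  _⇒_ : List Atom → Atom → Clause
  ps ⇒ a = (true , a) , List.map (false ,_) ps

  fact never : Atom → Clause
  fact a  = [] ⇒ a
  never a = (false , a) , []

  eᶜ : Comp 3 λ _ env → env fz
  eᶜ = var fz
  tᶜ : Comp 3 λ _ env → env (fs fz)
  tᶜ = var (fs fz)
  nᶜ : Comp 3 λ _ env → env (fs (fs fz))
  nᶜ = var (fs (fs fz))

  -- `steps` is the time bound at the greatest possible length of a pair, so the machine has halted
  -- by then for every admissible certificate. At that time the cells 0 and 1 decide acceptance;
  -- hence the 2 in `range`, the extent of the described region at time 0.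
  certificateBound steps range : ℕ → ℕ
  certificateBound n = poly c′ k′ n
  steps n            = poly c k (double n + (2 + certificateBound n))
  range n            = 2 + steps n

  module _ {n} {f : List Bool → Env n → ℕ} (cᶠ : Comp n f) where

    certificateBoundᶜ : Comp n λ w env → certificateBound (f w env)
    certificateBoundᶜ = polyᶜ c′ k′ cᶠ

    stepsᶜ : Comp n λ w env → steps (f w env)
    stepsᶜ = polyᶜ c k (doubleᶜ cᶠ ⊕ (const 2 ⊕ certificateBoundᶜ))

    rangeᶜ : Comp n λ w env → range (f w env)
    rangeᶜ = const 2 ⊕ stepsᶜ

  indexᶜ : (i : Index) → Comp 3 λ _ env → indexAt i (env fz)
  indexᶜ (fixed k)   = const k
  indexᶜ (shifted k) = const k ⊕ eᶜ

  -- A halted machine is made to run on without changing anything.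
  next-step : Fin states → Vec (Symbol marks) tapes → Fin states × Vec (Symbol marks × Move) tapes
  next-step q as = Maybe.fromMaybe (q , Vec.map (_, stay) as) (δ q as)

  start-cell : Symbol marks → ∀ {index} → Comp 3 index → Atom
  start-cell a i = at shows R fz a ⟨ const 0 , i ⟩

  certificateᶜ : Comp 3 λ _ env → double (env (fs (fs fz))) + (2 + env fz)
  certificateᶜ = doubleᶜ nᶜ ⊕ (const 2 ⊕ eᶜ)

  -- Beyond the end of the input the chosen atom is the start state, a fact in any case, so the
  -- scheme can be instantiated at every `e`.
  input-cell : ∀ {index} → Comp 3 index → Atom
  input-cell i = select (inp eᶜ ≡ᶜ const 0) (start-cell (bit false) i)
    (select (inp eᶜ ≡ᶜ const 1) (start-cell (bit true) i) (at inState start ⟨ const 0 , const 0 ⟩))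

  guess : Clause
  guess = (true , start-cell blank certificateᶜ) ,
    (true , start-cell (bit false) certificateᶜ) ∷ (true , start-cell (bit true) certificateᶜ) ∷ []

  leftClauses : Fin tapes → List Clause
  leftClauses j = fact (at shows L j blank ⟨ const 0 , eᶜ ⟩) ∷ []

  otherClauses : Fin work → List Clause
  otherClauses j = fact (at shows R (fs j) blank ⟨ const 0 , eᶜ ⟩) ∷ []

  initialClauses : List Clause
  initialClauses =
    fact (at inState start ⟨ const 0 , const 0 ⟩) ∷
    fact (input-cell (doubleᶜ eᶜ)) ∷
    fact (input-cell (one ⊕ doubleᶜ eᶜ)) ∷
    fact (start-cell (bit true) (doubleᶜ nᶜ ⊕ const 0)) ∷
    fact (start-cell (bit false) (doubleᶜ nᶜ ⊕ const 1)) ∷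
    guess ∷
    -- Blanks persist, and the next clause forces them from the length bound on: a word of
    -- admissible length, followed by blanks, can be read from every model.
    ((start-cell blank certificateᶜ ∷ []) ⇒ start-cell blank (doubleᶜ nᶜ ⊕ (const 2 ⊕ (one ⊕ eᶜ)))) ∷
    fact (start-cell blank (doubleᶜ nᶜ ⊕ (const 2 ⊕ (certificateBoundᶜ nᶜ ⊕ eᶜ)))) ∷
    List.concatMap leftClauses (List.allFin tapes) ++ List.concatMap otherClauses (List.allFin work)

  premises : Fin states → Vec (Symbol marks) tapes → List Atom
  premises q as = at inState q ⟨ tᶜ , const 0 ⟩ ∷
    List.map (λ j → at shows R j (Vec.lookup as j) ⟨ tᶜ , const 0 ⟩) (List.allFin tapes)

  transferClause : List Atom → Fin tapes → Symbol marks → (Side × Index) × (Side × Index) → Clause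
  transferClause ps j a ((s , i) , (s′ , i′)) =
    (at shows s j a ⟨ tᶜ , indexᶜ i ⟩ ∷ ps) ⇒ at shows s′ j a ⟨ one ⊕ tᶜ , indexᶜ i′ ⟩

  tapeClauses : List Atom → Fin tapes → Symbol marks × Move → List Clause
  tapeClauses ps j (y , mv) =
    (ps ⇒ at shows (proj₁ (target mv)) j y ⟨ one ⊕ tᶜ , const (proj₂ (target mv)) ⟩) ∷
    List.concatMap (λ a → List.map (transferClause ps j a) (transfers mv)) symbols

  ruleClauses : Fin states → Vec (Symbol marks) tapes → List Clause
  ruleClauses q as = let (q′ , acts) = next-step q as ; ps = premises q as in
    (ps ⇒ at inState q′ ⟨ one ⊕ tᶜ , const 0 ⟩) ∷
    List.concatMap (λ j → tapeClauses ps j (Vec.lookup acts j)) (List.allFin tapes)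

  stateClauses : Fin states → List Clause
  stateClauses q = List.concatMap (ruleClauses q) (vectors tapes)

  headClauses : Symbol marks → List Clause
  headClauses a = if ⌊ a ≟ˢ bit true ⌋ then [] else never (at shows R fz a ⟨ stepsᶜ nᶜ , const 0 ⟩) ∷ []

  -- Acceptance in negative form. A model contains at least the symbols that the run produces, so it
  -- is enough to forbid every symbol except `bit true` at the head and both bits in the next cell.
  finalClauses : List Clause
  finalClauses = List.concatMap headClauses symbols ++
    List.map (λ b → never (at shows R fz (bit b) ⟨ stepsᶜ nᶜ , const 1 ⟩)) (false ∷ true ∷ [])

  clauses : List Clause
  clauses = initialClauses ++
    List.concatMap stateClauses (List.allFin states) ++ finalClauses

-- Models of the clauses and accepting runs

decodeSymbol : ∀ {m} → ℕ → Symbol m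
decodeSymbol 0 = bit false
decodeSymbol 1 = bit true
decodeSymbol _ = blank

get-word : ∀ {m} w i → get {m} (List.map bit w) i ≡ decodeSymbol (look w i)
get-word []          i       = refl
get-word (true ∷ w)  zero    = refl
get-word (false ∷ w) zero    = refl
get-word (_ ∷ w)     (suc i) = get-word w i

data Digit : ℕ → Set where
  zero : Digit 0
  one  : Digit 1
  none : Digit 2

digit : ∀ w i → Digit (look w i)
digit []          i       = none
digit (true ∷ w)  zero    = one
digit (false ∷ w) zero    = zero
digit (_ ∷ w)     (suc i) = digit w i

look-end : ∀ w i → length w ≤ i → look w i ≡ 2
look-end []      i       _        = refl
look-end (_ ∷ w) (suc i) (s≤s le) = look-end w i le

look-inside : ∀ w i → look w i ≢ 2 → i < length w
look-inside w i ne with i <? length w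
... | yes lt = lt
... | no ¬lt = ⊥-elim (ne (look-end w i (≮⇒≥ ¬lt)))

look-end-suc : ∀ w i → look w i ≡ 2 → look w (suc i) ≡ 2
look-end-suc []          i       eq = refl
look-end-suc (true ∷ w)  zero    ()
look-end-suc (false ∷ w) zero    ()
look-end-suc (_ ∷ w)     (suc i) eq = look-end-suc w i eq

decode-blank : ∀ {m n} → Digit n → decodeSymbol {m} n ≡ blank → n ≡ 2
decode-blank none _ = refl
decode-blank zero ()
decode-blank one ()

T-⌊⌋⇒ : ∀ {A : Set} {a? : Dec A} → T ⌊ a? ⌋ → A
T-⌊⌋⇒ {a? = yes a} _ = a

T-⌊⌋⇐ : ∀ {A : Set} {a? : Dec A} → A → T ⌊ a? ⌋
T-⌊⌋⇐ {a? = yes _} _ = tt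
T-⌊⌋⇐ {a? = no ¬a} a = ⊥-elim (¬a a)

vec-ext : ∀ {A : Set} {n} {xs ys : Vec A n} → (∀ i → Vec.lookup xs i ≡ Vec.lookup ys i) → xs ≡ ys
vec-ext {xs = xs} {ys} eq = trans (sym (Vec.tabulate∘lookup xs)) (trans (Vec.tabulate-cong eq) (Vec.tabulate∘lookup ys))

poly-mono : ∀ c k {m n} → m ≤ n → poly c k m ≤ poly c k n
poly-mono c k m≤n = +-monoˡ-≤ c (*-monoʳ-≤ c (^-monoˡ-≤ k m≤n))

run-suc : ∀ M t c → run M (suc t) c ≡ step M (run M t c)
run-suc M zero    c = refl
run-suc M (suc t) c = run-suc M t (step M c)

halve : ∀ i → ∃[ e ] (i ≡ double e ⊎ i ≡ suc (double e))
halve zero = 0 , inj₁ refl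
halve (suc i) with halve i
... | e , inj₁ eq = e , inj₂ (cong suc eq)
... | e , inj₂ eq = suc e , inj₁ (cong suc eq)

double-cancel-< : ∀ {m n} → double m < double n → m < n
double-cancel-< {zero}  {suc n} _ = s≤s z≤n
double-cancel-< {suc m} {suc n} (s≤s (s≤s lt)) = s≤s (double-cancel-< lt)

m≤double : ∀ m → m ≤ double m
m≤double zero    = z≤n
m≤double (suc m) = s≤s (m≤n⇒m≤1+n (m≤double m))

leading-accepts : ∀ {m} (t : Tape m) → cellAt R t 0 ≡ bit true → (∀ b → cellAt R t 1 ≢ bit b) → outputTape t ≡ true ∷ []
leading-accepts (tape _ _ rs) refl ne = cong (true ∷_) (stop rs ne)
  where
  stop : ∀ {m} (rs : List (Symbol m)) → (∀ b → get rs 0 ≢ bit b) → leadingBits rs ≡ []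
  stop []           ne = refl
  stop (blank ∷ _)  ne = refl
  stop (mark _ ∷ _) ne = refl
  stop (bit b ∷ _)  ne = ⊥-elim (ne b refl)

accepts-head : ∀ {m} (t : Tape m) → outputTape t ≡ true ∷ [] → cellAt R t 0 ≡ bit true
accepts-head (tape _ (bit true) _) _ = refl

accepts-next : ∀ {m} (t : Tape m) → outputTape t ≡ true ∷ [] → ∀ b → cellAt R t 1 ≢ bit b
accepts-next (tape _ (bit true) (bit _ ∷ _)) () _ _
accepts-next (tape _ (bit true) [])           _ _ ()
accepts-next (tape _ (bit true) (blank ∷ _))  _ _ ()
accepts-next (tape _ (bit true) (mark _ ∷ _)) _ _ ()

environment : ℕ → ℕ → ℕ → Env 3
environment e t n = e ◂ t ◂ n ◂ λ ()

module CookLevinCorrect (M : TM) (c k c′ k′ : ℕ)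
  (halts : ∀ w → Halted M (run M (poly c k (length w)) (initial M w))) where

  open TM M
  open CookLevin M c k c′ k′

  Truth : Set
  Truth = Family → ℕ → ℕ → Bool

  module _ (τ : Truth) (w : List Bool) (env : Env 3) where

    true-atom : Atom → Bool
    true-atom a = τ (Atom.familyOf a w env) (Atom.time a w env) (Atom.index a w env)

    true-select : ∀ {p} (t : Test 3 p) a b →
      true-atom (select t a b) ≡ (if p w env then true-atom a else true-atom b)
    true-select {p} t a b = lemma (p w env)
      where
      lemma : ∀ b {f f′ t t′ i i′} → τ (if b then f else f′) (if b then t else t′) (if b then i else i′) ≡
              (if b then τ f t i else τ f′ t′ i′)
      lemma true  = refl
      lemma false = refl

    inputTruth : ℕ → ℕ → Bool
    inputTruth d i = if d ≡ᵇ 0 then τ (shows R fz (bit false)) 0 i else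
      if d ≡ᵇ 1 then τ (shows R fz (bit true)) 0 i else τ (inState start) 0 0

    true-input : ∀ {index} (i : Comp 3 index) → true-atom (input-cell i) ≡ inputTruth (look w (env fz)) (index w env)
    true-input {index} i = trans
      (true-select (inp eᶜ ≡ᶜ const 0) (start-cell (bit false) i)
        (select (inp eᶜ ≡ᶜ const 1) (start-cell (bit true) i) (at inState start ⟨ const 0 , const 0 ⟩)))
      (cong (if look w (env fz) ≡ᵇ 0 then τ (shows R fz (bit false)) 0 (index w env) else_)
        (true-select (inp eᶜ ≡ᶜ const 1) (start-cell (bit true) i) (at inState start ⟨ const 0 , const 0 ⟩)))

    Holds : Literal → Set
    Holds (s , a) = T (if s then true-atom a else not (true-atom a))

    Satisfies : Clause → Set
    Satisfies (l , ls) = Any Holds (l ∷ ls)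

    ⇒-intro : ∀ {ps a} → (All (T ∘ true-atom) ps → T (true-atom a)) → Satisfies (ps ⇒ a)
    ⇒-intro {ps} h with decide ps
      where
      decide : ∀ ps → All (T ∘ true-atom) ps ⊎ Any Holds (List.map (false ,_) ps)
      decide []       = inj₁ []
      decide (p ∷ ps) with true-atom p in eq | decide ps
      ... | false | _       = inj₂ (here (subst (T ∘ not) (sym eq) tt))
      ... | true  | inj₁ ts = inj₁ (subst T (sym eq) tt ∷ ts)
      ... | true  | inj₂ f  = inj₂ (there f)
    ... | inj₁ ts = here (h ts)
    ... | inj₂ f  = there f

    ⇒-elim : ∀ {ps a} → Satisfies (ps ⇒ a) → All (T ∘ true-atom) ps → T (true-atom a)
    ⇒-elim (here t)  ts = t
    ⇒-elim (there f) ts = ⊥-elim (clash f ts)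
      where
      clash : ∀ {ps} → Any Holds (List.map (false ,_) ps) → All (T ∘ true-atom) ps → ⊥
      clash {p ∷ _} (here f)  (t ∷ _)  = not-T f t
      clash {_ ∷ _} (there f) (_ ∷ ts) = clash f ts

  Model : Truth → List Bool → Set
  Model τ x = ∀ t e → t < range (length x) → e < range (length x) →
              All (Satisfies τ x (environment e t (length x))) clauses

  Accepts : List Bool → Set
  Accepts x = ∃[ u ] length u ≤ certificateBound (length x) ×
    output M (run M (poly c k (length (pair x u))) (initial M (pair x u))) ≡ true ∷ []

  -- The machine halts within its bound for the actual length, which is at most `steps`, and a
  -- halted configuration no longer changes.
  final-run : ∀ x u → length u ≤ certificateBound (length x) →
    run M (steps (length x)) (initial M (pair x u)) ≡ run M (poly c k (length (pair x u))) (initial M (pair x u))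
  final-run x u le = run-halted M refl (halts (pair x u))
    (poly-mono c k (≤-trans (≤-reflexive (length-pair x u)) (+-monoʳ-≤ (double (length x)) (s≤s (s≤s le)))))

  step-next : ∀ q ts → let (q′ , acts) = next-step q (Vec.map Tape.head ts) in
    proj₁ (step M (q , ts)) ≡ q′ ×
    (∀ j → Vec.lookup (proj₂ (step M (q , ts))) j ≡ act (Vec.lookup acts j) (Vec.lookup ts j))
  step-next q ts with δ q (Vec.map Tape.head ts)
  ... | just (q′ , acts) = refl , λ j → Vec.lookup-zipWith act j acts ts
  ... | nothing = refl , λ j → sym (trans
      (cong (λ a → act a (Vec.lookup ts j)) (Vec.lookup-map j (_, stay) (Vec.map Tape.head ts)))
      (cong (λ h → act (h , stay) (Vec.lookup ts j)) (Vec.lookup-map j Tape.head ts)))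

  module Trace (w : List Bool) where

    at-time : ℕ → Config M
    at-time t = run M t (initial M w)

    stateAt : ℕ → Fin states
    stateAt t = proj₁ (at-time t)

    tapeAt : ℕ → Fin tapes → Tape marks
    tapeAt t j = Vec.lookup (proj₂ (at-time t)) j

    headsAt : ℕ → Vec (Symbol marks) tapes
    headsAt t = Vec.map Tape.head (proj₂ (at-time t))

    heads-cell : ∀ t j → Vec.lookup (headsAt t) j ≡ cellAt R (tapeAt t j) 0
    heads-cell t j = Vec.lookup-map j Tape.head (proj₂ (at-time t))

    state-suc : ∀ t → stateAt (suc t) ≡ proj₁ (next-step (stateAt t) (headsAt t))
    state-suc t = trans (cong proj₁ (run-suc M t (initial M w))) (proj₁ (step-next (stateAt t) (proj₂ (at-time t))))

    tape-suc : ∀ t j → tapeAt (suc t) j ≡ act (Vec.lookup (proj₂ (next-step (stateAt t) (headsAt t))) j) (tapeAt t j)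
    tape-suc t j = trans (cong (λ c → Vec.lookup (proj₂ c) j) (run-suc M t (initial M w)))
      (proj₂ (step-next (stateAt t) (proj₂ (at-time t))) j)

    input-cells : ∀ i → cellAt R (tapeAt 0 fz) i ≡ decodeSymbol (look w i)
    input-cells i = trans (get-uncons∷ (List.map bit w) i) (get-word w i)

    left-cells : ∀ j i → cellAt L (tapeAt 0 j) i ≡ blank
    left-cells fz     i = refl
    left-cells (fs j) i = cong (λ t → cellAt L t i) (Vec.lookup-replicate j blankTape)

    other-cells : ∀ j i → cellAt R (tapeAt 0 (fs j)) i ≡ blank
    other-cells j i = trans (cong (λ t → cellAt R t i) (Vec.lookup-replicate j blankTape)) (blank-cell i)
      where
      blank-cell : ∀ i → get {marks} (blank ∷ []) i ≡ blank
      blank-cell zero    = refl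
      blank-cell (suc i) = refl

  module Sound (x u : List Bool) (short : length u ≤ certificateBound (length x))
    (accepted : output M (run M (poly c k (length (pair x u))) (initial M (pair x u))) ≡ true ∷ []) where

    n = length x
    w = pair x u
    open Trace w

    -- The atoms that are true of the run; they satisfy the clauses at all `t` and `e`, not only
    -- within `range`.
    τ : Truth
    τ (inState q)   t i = ⌊ q Fin.≟ stateAt t ⌋
    τ (shows s j a) t i = ⌊ a ≟ˢ cellAt s (tapeAt t j) i ⌋

    shown : ∀ {s j a t i} → cellAt s (tapeAt t j) i ≡ a → T (τ (shows s j a) t i)
    shown eq = T-⌊⌋⇐ (sym eq)

    showing : ∀ {s j a t i} → T (τ (shows s j a) t i) → cellAt s (tapeAt t j) i ≡ a
    showing {s} {j} {a} {t} {i} h = sym (T-⌊⌋⇒ {a? = a ≟ˢ cellAt s (tapeAt t j) i} h)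

    in-word : ∀ {a i} → decodeSymbol (look w i) ≡ a → T (τ (shows R fz a) 0 i)
    in-word {i = i} eq = shown {R} {fz} {_} {0} {i} (trans (input-cells i) eq)

    module _ (t e : ℕ) where

      env = environment e t n

      private
        Sat = Satisfies τ x env

        input-true : ∀ {i d} → Digit d → look x e ≡ d → (e < n → look w i ≡ look x e) → T (inputTruth τ x env d i)
        input-true zero d≡ eq = in-word (cong decodeSymbol (trans (eq (look-inside x e λ e≡ → 0≢2 (trans (sym d≡) e≡))) d≡))
          where
          0≢2 : 0 ≢ 2
          0≢2 ()
        input-true one  d≡ eq = in-word (cong decodeSymbol (trans (eq (look-inside x e λ e≡ → 1≢2 (trans (sym d≡) e≡))) d≡))
          where
          1≢2 : 1 ≢ 2
          1≢2 ()
        input-true none d≡ eq = T-⌊⌋⇐ {a? = start Fin.≟ start} refl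

        input-fact : ∀ {index} (i : Comp 3 index) → (e < n → look w (index x env) ≡ look x e) → Sat (fact (input-cell i))
        input-fact i eq = here (subst T (sym (true-input τ x env i)) (input-true (digit x e) refl eq))

        second : ∀ i → look w (double n + (2 + i)) ≡ look u i
        second i = look-pair-second x u (2 + i)

        guess-holds : Sat guess
        guess-holds with look u e in eq | digit u e
        ... | .0 | zero = there (here (in-word (cong decodeSymbol (trans (second e) eq))))
        ... | .1 | one  = there (there (here (in-word (cong decodeSymbol (trans (second e) eq)))))
        ... | .2 | none = here (in-word (cong decodeSymbol (trans (second e) eq)))

      initial-satisfied : All Sat initialClauses
      initial-satisfied =
        here (T-⌊⌋⇐ {a? = start Fin.≟ start} refl) ∷
        input-fact (doubleᶜ eᶜ) (look-pair x u e) ∷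
        input-fact (one ⊕ doubleᶜ eᶜ) (look-pair′ x u e) ∷
        here (in-word (cong decodeSymbol (look-pair-second x u 0))) ∷
        here (in-word (cong decodeSymbol (look-pair-second x u 1))) ∷
        guess-holds ∷
        ⇒-intro τ x env (λ { (h ∷ []) → in-word (cong decodeSymbol (trans (second (suc e)) (look-end-suc u e
          (trans (sym (second e)) (decode-blank (digit w (double n + (2 + e)))
            (trans (sym (input-cells (double n + (2 + e)))) (showing {R} {fz} {blank} {0} {double n + (2 + e)} h))))))) }) ∷
        here (in-word (cong decodeSymbol (trans (second (certificateBound n + e)) (look-end u _ (≤-trans short (m≤m+n _ e)))))) ∷
        All.++⁺ (All-concatMap⁺ (List.allFin tapes) λ j → here (shown {L} {j} {blank} {0} {e} (left-cells j e)) ∷ [])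
          (All-concatMap⁺ (List.allFin work) λ j → here (shown {R} {fs j} {blank} {0} {e} (other-cells j e)) ∷ [])

      private
        module _ {q as} (ts : All (T ∘ true-atom τ x env) (premises q as)) where

          premise-state : q ≡ stateAt t
          premise-state = T-⌊⌋⇒ {a? = q Fin.≟ stateAt t} (All.head ts)

          premise-heads : as ≡ headsAt t
          premise-heads = vec-ext λ j → trans
            (sym (showing {R} {j} {Vec.lookup as j} {t} {0} (All.tabulate⁻ {f = id} (All.map⁻ (All.tail ts)) j))) (sym (heads-cell t j))

          next-≡ : next-step q as ≡ next-step (stateAt t) (headsAt t)
          next-≡ = cong₂ next-step premise-state premise-heads

          tape-next : ∀ j → tapeAt (suc t) j ≡ act (Vec.lookup (proj₂ (next-step q as)) j) (tapeAt t j)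
          tape-next j = trans (tape-suc t j) (cong (λ p → act (Vec.lookup (proj₂ p) j) (tapeAt t j)) (sym next-≡))

        module _ (q : Fin states) (as : Vec (Symbol marks) tapes) (j : Fin tapes) where

          y  = proj₁ (Vec.lookup (proj₂ (next-step q as)) j)
          mv = proj₂ (Vec.lookup (proj₂ (next-step q as)) j)

          target-satisfied : Sat (premises q as ⇒ at shows (proj₁ (target mv)) j y ⟨ one ⊕ tᶜ , const (proj₂ (target mv)) ⟩)
          target-satisfied = ⇒-intro τ x env λ ts → shown {proj₁ (target mv)} {j} {y} {suc t} {proj₂ (target mv)}
            (trans (cong (λ tp → cellAt (proj₁ (target mv)) tp (proj₂ (target mv))) (tape-next ts j))
              (target-correct y mv (tapeAt t j)))

          transfer-satisfied : ∀ b {p} →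
            (cellAt (proj₁ (proj₂ p)) (act (y , mv) (tapeAt t j)) (indexAt (proj₂ (proj₂ p)) e) ≡
             cellAt (proj₁ (proj₁ p)) (tapeAt t j) (indexAt (proj₂ (proj₁ p)) e)) →
            Sat (transferClause (premises q as) j b p)
          transfer-satisfied b {(s , i) , (s′ , i′)} eq = ⇒-intro τ x env λ { (h ∷ ts) →
            shown {s′} {j} {b} {suc t} {indexAt i′ e} (trans (cong (λ tp → cellAt s′ tp (indexAt i′ e)) (tape-next ts j))
              (trans eq (showing {s} {j} {b} {t} {indexAt i e} h))) }

          tape-satisfied : All Sat (tapeClauses (premises q as) j (y , mv))
          tape-satisfied = target-satisfied ∷ All-concatMap⁺ symbols λ b →
            All.map⁺ (All.map (λ {p} → transfer-satisfied b {p}) (transfers-correct y mv (tapeAt t j) e))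

      rule-satisfied : ∀ q as → All Sat (ruleClauses q as)
      rule-satisfied q as =
        ⇒-intro τ x env (λ ts → T-⌊⌋⇐ {a? = proj₁ (next-step q as) Fin.≟ stateAt (suc t)}
          (sym (trans (state-suc t) (cong proj₁ (sym (next-≡ ts)))))) ∷
        All-concatMap⁺ (List.allFin tapes) (tape-satisfied q as)

      private
        accepted′ : outputTape (tapeAt (steps n) fz) ≡ true ∷ []
        accepted′ = trans (cong (outputTape) (sym (head-lookup (proj₂ (at-time (steps n)))))) (trans (cong (output M) (final-run x u short)) accepted)
          where
          head-lookup : (ts : Vec (Tape marks) tapes) → Vec.head ts ≡ Vec.lookup ts fz
          head-lookup (_ ∷ _) = refl

      final-satisfied : All Sat finalClauses
      final-satisfied = All.++⁺ (All-concatMap⁺ symbols head-ok)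
        (here (T-not λ h → accepts-next (tapeAt (steps n) fz) accepted′ false (showing {R} {fz} {bit false} {steps n} {1} h)) ∷
         here (T-not λ h → accepts-next (tapeAt (steps n) fz) accepted′ true (showing {R} {fz} {bit true} {steps n} {1} h)) ∷ [])
        where
        head-ok : ∀ a → All Sat (headClauses a)
        head-ok a with a ≟ˢ bit true
        ... | yes _ = []
        ... | no ne = here (T-not λ h → ne (trans (sym (showing {R} {fz} {a} {steps n} {0} h)) (accepts-head (tapeAt (steps n) fz) accepted′))) ∷ []

      satisfied : All Sat clauses
      satisfied = All.++⁺ initial-satisfied (All.++⁺
        (All-concatMap⁺ (List.allFin states) λ q → All-concatMap⁺ (vectors tapes) (rule-satisfied q)) final-satisfied)

    model : Model τ x
    model t e _ _ = satisfied t e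

  module Reconstruct (x : List Bool) (τ : Truth) (model : Model τ x) where

    private
      n = length x
      B = range n

      Sat : ℕ → ℕ → Clause → Set
      Sat t e = Satisfies τ x (environment e t n)

      initial-clauses : ∀ e → e < B → All (Sat 0 e) initialClauses
      initial-clauses e e<B = All.++⁻ˡ initialClauses (model 0 e (s≤s z≤n) e<B)

      drop : ∀ {P : Clause → Set} k {cs} → All P cs → All P (List.drop k cs)
      drop k h = All.drop⁺ k h

      rule-clauses : ∀ t e → t < B → e < B → ∀ q as → All (Sat t e) (ruleClauses q as)
      rule-clauses t e t<B e<B q as = All-concatMap⁻ {f = ruleClauses q} (All-concatMap⁻ {f = stateClauses}
        (All.++⁻ˡ (List.concatMap stateClauses (List.allFin states))
          (All.++⁻ʳ initialClauses (model t e t<B e<B))) (∈-allFin q)) (∈-vectors as)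

      final-clauses : All (Sat 0 0) finalClauses
      final-clauses = All.++⁻ʳ (List.concatMap stateClauses (List.allFin states))
        (All.++⁻ʳ initialClauses (model 0 0 (s≤s z≤n) (s≤s z≤n)))

      fact-true : ∀ {t e a} → Sat t e (fact a) → T (true-atom τ x (environment e t n) a)
      fact-true s = ⇒-elim τ x _ s []

      Start : Symbol marks → ℕ → Set
      Start a i = T (τ (shows R fz a) 0 i)

      certificateCell : ℕ → ℕ
      certificateCell e = double n + (2 + e)

      isBlankAt : ℕ → Bool
      isBlankAt e = τ (shows R fz blank) 0 (certificateCell e)

      -- A model may show several symbols at one cell. Reading stops at the first cell that shows a
      -- blank and otherwise prefers `true`; `guess` ensures that the chosen symbol is indeed shown.
      read : ℕ → ℕ → List Bool
      read zero    e = []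
      read (suc f) e = if isBlankAt e then [] else τ (shows R fz (bit true)) 0 (certificateCell e) ∷ read f (suc e)

      length-read : ∀ f e → length (read f e) ≤ f
      length-read zero    e = z≤n
      length-read (suc f) e with isBlankAt e
      ... | true  = z≤n
      ... | false = s≤s (length-read f (suc e))

      blank-next : ∀ e → e < B → T (isBlankAt e) → T (isBlankAt (suc e))
      -- The numbers passed to `drop` are positions in `initialClauses`.
      blank-next e e<B h with drop 6 (initial-clauses e e<B)
      ... | s ∷ _ = ⇒-elim τ x (environment e 0 n) s (h ∷ [])

      blank-on : ∀ d {e} → e + d < B → T (isBlankAt e) → T (isBlankAt (e + d))
      blank-on zero    {e} _  h = subst (T ∘ isBlankAt) (sym (+-identityʳ e)) h
      blank-on (suc d) {e} lt h = subst (T ∘ isBlankAt) (sym (+-suc e d))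
        (blank-next (e + d) lt′ (blank-on d lt′ h))
        where
        lt′ : e + d < B
        lt′ = <-trans (+-monoʳ-< e ≤-refl) lt

      bit-guessed : ∀ e → e < B → isBlankAt e ≡ false →
        Start (bit (τ (shows R fz (bit true)) 0 (certificateCell e))) (certificateCell e)
      bit-guessed e e<B nb with τ (shows R fz (bit true)) 0 (certificateCell e) in eq | drop 5 (initial-clauses e e<B)
      ... | true  | _ = subst T (sym eq) tt
      ... | false | here h ∷ _                 = ⊥-elim (subst T nb h)
      ... | false | there (here h) ∷ _         = h
      ... | false | there (there (here h)) ∷ _ = ⊥-elim (subst T eq h)

      read-correct : ∀ f e d → e + f ≡ certificateBound n → e + d < B →
        Start (decodeSymbol (look (read f e) d)) (certificateCell (e + d))
      read-correct zero e d e≡ lt with drop 7 (initial-clauses d (≤-<-trans (m≤n+m d e) lt))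
      ... | s ∷ _ = subst (λ b → Start blank (certificateCell (b + d))) (trans (sym e≡) (+-identityʳ e)) (fact-true {0} {d} s)
      read-correct (suc f) e d e≡ lt with isBlankAt e in eq
      ... | true = blank-on d lt (subst T (sym eq) tt)
      read-correct (suc f) e zero e≡ lt | false =
        subst (Start (decodeSymbol (bool (τ (shows R fz (bit true)) 0 (certificateCell e)))) ∘ certificateCell) (sym (+-identityʳ e))
        (decoded (τ (shows R fz (bit true)) 0 (certificateCell e)) (bit-guessed e (subst (_< B) (+-identityʳ e) lt) eq))
        where
        decoded : ∀ b {i} → Start (bit b) i → Start (decodeSymbol (bool b)) i
        decoded true  h = h
        decoded false h = h
      read-correct (suc f) e (suc d) e≡ lt | false = subst (Start (decodeSymbol (look (read f (suc e)) d)) ∘ certificateCell) (sym (+-suc e d))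
        (read-correct f (suc e) d (trans (sym (+-suc e f)) e≡) (subst (_< B) (+-suc e d) lt))

    certificate : List Bool
    certificate = read (certificateBound n) 0

    private
      w = pair x certificate
      open Trace w

      input-bit : ∀ {e i} → e < n → look w i ≡ look x e → T (inputTruth τ x (environment e 0 n) (look x e) i) →
                  Start (decodeSymbol (look w i)) i
      input-bit {e} {i} e<n eq h rewrite eq with look x e in eq′ | digit x e
      ... | .0 | zero = h
      ... | .1 | one  = h
      ... | .2 | none = ⊥-elim (inside x e e<n eq′)
        where
        inside : ∀ x e → e < length x → look x e ≢ 2
        inside (true ∷ _)  zero    _        ()
        inside (false ∷ _) zero    _        ()
        inside (_ ∷ x)     (suc e) (s≤s lt) eq = inside x e lt eq

      first-part : ∀ i → i < double n → i < B → Start (decodeSymbol (look w i)) i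
      first-part i i< i<B with halve i
      ... | e , inj₁ refl = input-bit e<n (look-pair x certificate e e<n)
          (subst T (true-input τ x (environment e 0 n) (doubleᶜ eᶜ))
            (fact-true {0} {e} (All.head (drop 1 (initial-clauses e (≤-<-trans (m≤double e) i<B))))))
        where
        e<n = double-cancel-< i<
      ... | e , inj₂ refl = input-bit e<n (look-pair′ x certificate e e<n)
          (subst T (true-input τ x (environment e 0 n) (one ⊕ doubleᶜ eᶜ)) (fact-true {0} {e}
            (All.head (drop 2 (initial-clauses e (≤-<-trans (≤-trans (m≤double e) (n≤1+n _)) i<B))))))
        where
        e<n = double-cancel-< (<-trans ≤-refl i<)

      second-part : ∀ d → double n + d < B → Start (decodeSymbol (look w (double n + d))) (double n + d)
      second-part 0 lt = subst (λ s → Start s (double n + 0)) (cong decodeSymbol (sym (look-pair-second x certificate 0)))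
        (fact-true {0} {0} (All.head (drop 3 (initial-clauses 0 (s≤s z≤n)))))
      second-part 1 lt = subst (λ s → Start s (double n + 1)) (cong decodeSymbol (sym (look-pair-second x certificate 1)))
        (fact-true {0} {0} (All.head (drop 4 (initial-clauses 0 (s≤s z≤n)))))
      second-part (suc (suc d)) lt = subst (λ s → Start s (certificateCell d))
        (cong decodeSymbol (sym (look-pair-second x certificate (2 + d))))
        (read-correct (certificateBound n) 0 d refl
          (≤-<-trans (≤-trans (n≤1+n d) (≤-trans (n≤1+n _) (m≤n+m _ (double n)))) lt))

      input-correct : ∀ i → i < B → Start (decodeSymbol (look w i)) i
      input-correct i i<B with i <? double n
      ... | yes lt = first-part i lt i<B
      ... | no ¬lt = subst (λ i → Start (decodeSymbol (look w i)) i) (m+[n∸m]≡n (≮⇒≥ ¬lt))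
        (second-part (i ∸ double n) (subst (_< B) (sym (m+[n∸m]≡n (≮⇒≥ ¬lt))) i<B))

      -- The model describes the run correctly on a region that shrinks by one cell in each step.
      record Correct (t : ℕ) : Set where
        field
          in-state : T (τ (inState (stateAt t)) t 0)
          on-tape  : ∀ j s i → i + t < B → T (τ (shows s j (cellAt s (tapeAt t j) i)) t i)

      open Correct

      correct-0 : Correct 0
      correct-0 .in-state = fact-true {0} {0} (All.head (initial-clauses 0 (s≤s z≤n)))
      correct-0 .on-tape j L i lt = subst (λ a → T (τ (shows L j a) 0 i)) (sym (left-cells j i))
        (fact-true {0} {i} (All.head (All-concatMap⁻ {f = leftClauses}
          (All.++⁻ˡ (List.concatMap leftClauses (List.allFin tapes))
            (drop 8 (initial-clauses i (subst (_< B) (+-identityʳ i) lt)))) (∈-allFin j))))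
      correct-0 .on-tape fz R i lt = subst (λ a → Start a i) (sym (input-cells i)) (input-correct i (subst (_< B) (+-identityʳ i) lt))
      correct-0 .on-tape (fs j) R i lt = subst (λ a → T (τ (shows R (fs j) a) 0 i)) (sym (other-cells j i))
        (fact-true {0} {i} (All.head (All-concatMap⁻ {f = otherClauses}
          (All.++⁻ʳ (List.concatMap leftClauses (List.allFin tapes))
            (drop 8 (initial-clauses i (subst (_< B) (+-identityʳ i) lt)))) (∈-allFin j))))

      module _ {t} (t< : suc t < B) (C : Correct t) where

        private
          q = stateAt t
          as = headsAt t
          ps = premises q as
          t<B : t < B
          t<B = <-trans ≤-refl t<

          premises-true : ∀ e → All (T ∘ true-atom τ x (environment e t n)) ps
          premises-true e = in-state C ∷ All.map⁺ (All.tabulate⁺ {f = id} λ j →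
            subst (λ a → T (τ (shows R j a) t 0)) (sym (heads-cell t j)) (on-tape C j R 0 t<B))

          module _ (j : Fin tapes) where

            y  = proj₁ (Vec.lookup (proj₂ (next-step q as)) j)
            mv = proj₂ (Vec.lookup (proj₂ (next-step q as)) j)

            Now : Side → ℕ → Set
            Now s i = i + suc t < B → T (τ (shows s j (cellAt s (act (y , mv) (tapeAt t j)) i)) (suc t) i)

            clauses-of : ∀ e → e < B → All (Sat t e) (tapeClauses ps j (y , mv))
            clauses-of e e<B = All-concatMap⁻ {f = λ j → tapeClauses ps j (Vec.lookup (proj₂ (next-step q as)) j)}
              (All.tail (rule-clauses t e t<B e<B q as)) (∈-allFin j)

            target-now : T (τ (shows (proj₁ (target mv)) j (cellAt (proj₁ (target mv)) (act (y , mv) (tapeAt t j)) (proj₂ (target mv))))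
              (suc t) (proj₂ (target mv)))
            target-now = subst (λ a → T (τ (shows (proj₁ (target mv)) j a) (suc t) (proj₂ (target mv))))
              (sym (target-correct y mv (tapeAt t j)))
              (⇒-elim τ x (environment 0 t n) (All.head (clauses-of 0 (s≤s z≤n))) (premises-true 0))

            transfer-now : ∀ i {p} e → p ∈ transfers mv → e ≤ i → indexAt (proj₂ (proj₁ p)) e ≤ suc i → i + suc t < B →
              T (τ (shows (proj₁ (proj₂ p)) j (cellAt (proj₁ (proj₂ p)) (act (y , mv) (tapeAt t j)) (indexAt (proj₂ (proj₂ p)) e)))
                   (suc t) (indexAt (proj₂ (proj₂ p)) e))
            transfer-now i {(s , k) , (s′ , k′)} e p∈ e≤i k≤ lt =
              subst (λ a → T (τ (shows s′ j a) (suc t) (indexAt k′ e))) (sym (All.lookup (transfers-correct y mv (tapeAt t j) e) p∈))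
                (⇒-elim τ x (environment e t n) instantiated (on-tape C j s (indexAt k e) source< ∷ premises-true e))
              where
              a = cellAt s (tapeAt t j) (indexAt k e)
              -- The source is at most one cell farther out, and the region at time `t` is one cell
              -- larger than at the next step.
              source< : indexAt k e + t < B
              source< = ≤-<-trans (+-monoˡ-≤ t k≤) (subst (_< B) (+-suc i t) lt)
              e<B : e < B
              e<B = ≤-<-trans e≤i (≤-<-trans (m≤m+n i (suc t)) lt)
              instantiated : Sat t e (transferClause ps j a ((s , k) , (s′ , k′)))
              instantiated = All.lookup (All.map⁻ (All-concatMap⁻ {f = λ a → List.map (transferClause ps j a) (transfers mv)}
                (All.tail (clauses-of e e<B)) (∈-symbols a))) p∈

            now : ∀ s i → Now s i
            now s i lt = covered mv s i (λ s′ i′ → i′ ≡ i → T (τ (shows s′ j (cellAt s′ (act (y , mv) (tapeAt t j)) i′)) (suc t) i′))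
              (λ _ → target-now)
              (λ e p∈ e≤i k≤ _ → transfer-now i e p∈ e≤i k≤ lt) refl

        correct-suc : Correct (suc t)
        correct-suc .in-state = subst (λ q → T (τ (inState q) (suc t) 0)) (sym (state-suc t))
          (⇒-elim τ x (environment 0 t n) (All.head (rule-clauses t 0 t<B (s≤s z≤n) q as)) (premises-true 0))
        correct-suc .on-tape j s i lt = subst (λ tp → T (τ (shows s j (cellAt s tp i)) (suc t) i)) (sym (tape-suc t j)) (now j s i lt)

      correct : ∀ t → t < B → Correct t
      correct zero    _   = correct-0
      correct (suc t) t<B = correct-suc t<B (correct t (<-trans ≤-refl t<B))

      last : Correct (steps n)
      last = correct (steps n) (s≤s (n≤1+n _))

      head-true : cellAt R (tapeAt (steps n) fz) 0 ≡ bit true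
      head-true with cellAt R (tapeAt (steps n) fz) 0 ≟ˢ bit true | All-concatMap⁻ {f = headClauses}
                       (All.++⁻ˡ (List.concatMap headClauses symbols) final-clauses) (∈-symbols (cellAt R (tapeAt (steps n) fz) 0))
      ... | yes eq | _ = eq
      ... | no _   | here h ∷ _ = ⊥-elim (not-T h (on-tape last fz R 0 (s≤s (n≤1+n _))))

      next-nonbit : ∀ b → cellAt R (tapeAt (steps n) fz) 1 ≢ bit b
      next-nonbit b eq = refute b (All.++⁻ʳ (List.concatMap headClauses symbols) final-clauses)
        -- At time `steps n` the region has shrunk to the cells 0 and 1, so the bound is tight here.
        (subst (λ a → T (τ (shows R fz a) (steps n) 1)) eq (on-tape last fz R 1 ≤-refl))
        where
        refute : ∀ b → All (Sat 0 0) (List.map (λ b → never (at shows R fz (bit b) ⟨ stepsᶜ nᶜ , const 1 ⟩)) (false ∷ true ∷ [])) →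
                 ¬ T (τ (shows R fz (bit b)) (steps n) 1)
        refute false (here h ∷ _)     = not-T h
        refute true  (_ ∷ here h ∷ _) = not-T h

    accepts : Accepts x
    accepts = certificate , length-read (certificateBound n) 0 ,
      trans (cong (output M) (sym (final-run x certificate (length-read (certificateBound n) 0))))
        (trans (cong outputTape (head-lookup (proj₂ (at-time (steps n))))) (leading-accepts (tapeAt (steps n) fz) head-true next-nonbit))
      where
      head-lookup : (ts : Vec (Tape marks) tapes) → Vec.head ts ≡ Vec.lookup ts fz
      head-lookup (_ ∷ _) = refl

-- The reduction

variable
  fe ft fl : List Bool → Env α → ℕ

-- Substitution of three computed arguments. The environment built by nested `letᶜ` equals
-- `environment` only pointwise, hence `comp-cong`.
callᶜ : {f : List Bool → Env 3 → ℕ} → Comp 3 f → Comp α fe → Comp α ft → Comp α fl →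
        Comp α λ w env → f w (environment (fe w env) (ft w env) (fl w env))
callᶜ {f = f} c e t n =
  ext (λ w env → comp-cong c w λ { fz → refl ; (fs fz) → refl ; (fs (fs fz)) → refl })
    (letᶜ n (letᶜ (wk t) (letᶜ (wk (wk e)) (ren (λ { fz → fz ; (fs fz) → fs fz ; (fs (fs fz)) → fs (fs fz) }) c))))

≤-sumTo : ∀ n f r → r < n → f r ≤ sumTo n f
≤-sumTo (suc n) f zero    _         = m≤m+n (f 0) _
≤-sumTo (suc n) f (suc r) (s≤s r<n) = ≤-trans (≤-sumTo n (f ∘ suc) r r<n) (m≤n+m _ (f 0))

n≤double : ∀ n → n ≤ double n
n≤double n = ≤-trans (m≤m+n n n) (≤-reflexive (double-+ n))

module Reduction (M : TM) (c k c′ k′ : ℕ)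
  (halts : ∀ w → Halted M (run M (poly c k (length w)) (initial M w))) where

  open CookLevin M c k c′ k′
  open CookLevinCorrect M c k c′ k′ halts

  atomCode : Atom → List Bool → Env 3 → ℕ
  atomCode a w env = variableCode (Atom.familyOf a w env) (Atom.time a w env) (Atom.index a w env)

  signed : Bool → ℕ → ℕ
  signed s v = if s then double v else suc (double v)

  literalCode : Literal → List Bool → Env 3 → ℕ
  literalCode (s , a) w env = signed s (atomCode a w env)

  -- Clauses are padded to a common length by repeating the last literal.
  literalAt : Literal → List Literal → ℕ → List Bool → Env 3 → ℕ
  literalAt l []        i       = literalCode l
  literalAt l (l′ ∷ ls) zero    = literalCode l
  literalAt l (l′ ∷ ls) (suc i) = literalAt l′ ls i

  clauseAt : List Clause → ℕ → ℕ → List Bool → Env 3 → ℕ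
  clauseAt []             κ       i w env = 0
  clauseAt ((l , ls) ∷ _) zero    i w env = literalAt l ls i w env
  clauseAt (_ ∷ cs)       (suc κ) i w env = clauseAt cs κ i w env

  literalCodeᶜ : ∀ l → Comp 3 (literalCode l)
  literalCodeᶜ (true , a)  = doubleᶜ (Atom.codeᶜ a)
  literalCodeᶜ (false , a) = one ⊕ doubleᶜ (Atom.codeᶜ a)

  module _ (e : Comp α fe) (t : Comp α ft) (n : Comp α fl) where

    literalAtᶜ : ∀ l ls {fi} → Comp α fi →
      Comp α λ w env → literalAt l ls (fi w env) w (environment (fe w env) (ft w env) (fl w env))
    literalAtᶜ l []            i = callᶜ (literalCodeᶜ l) e t n
    literalAtᶜ l (l′ ∷ ls) {fi} i =
      ext (λ w env → lemma (fi w env) w _) (ifᶜ (i ≡ᶜ const 0) (callᶜ (literalCodeᶜ l) e t n) (literalAtᶜ l′ ls (i ⊖ one)))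
      where
      lemma : ∀ i w env → (if i ≡ᵇ 0 then literalCode l w env else literalAt l′ ls (i ∸ 1) w env) ≡ literalAt l (l′ ∷ ls) i w env
      lemma zero    w env = refl
      lemma (suc i) w env = refl

    clauseAtᶜ : ∀ cs {fκ fi} → Comp α fκ → Comp α fi →
      Comp α λ w env → clauseAt cs (fκ w env) (fi w env) w (environment (fe w env) (ft w env) (fl w env))
    clauseAtᶜ []              κ i = const 0
    clauseAtᶜ ((l , ls) ∷ cs) {fκ} {fi} κ i =
      ext (λ w env → lemma (fκ w env) (fi w env) w _) (ifᶜ (κ ≡ᶜ const 0) (literalAtᶜ l ls i) (clauseAtᶜ cs (κ ⊖ one) i))
      where
      lemma : ∀ κ i w env → (if κ ≡ᵇ 0 then literalAt l ls i w env else clauseAt cs (κ ∸ 1) i w env) ≡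
              clauseAt ((l , ls) ∷ cs) κ i w env
      lemma zero    i w env = refl
      lemma (suc κ) i w env = refl

  #clauses width : ℕ
  #clauses = length clauses
  width    = suc (List.foldr _⊔_ 0 (List.map (length ∘ proj₂) clauses))

  #instances #literals : ℕ → ℕ
  #instances n = range n * range n * #clauses
  #literals n  = #instances n * width

  -- Literal number r belongs to literal position i of the clause κ instantiated at e and t,
  -- where r = ((t * range n + e) * #clauses + κ) * width + i.
  cnfLiteral : List Bool → ℕ → ℕ → ℕ
  cnfLiteral w n r =
    let m = quot r width ; te = quot m #clauses in
    clauseAt clauses (rem m #clauses) (rem r width) w (environment (rem te (range n)) (quot te (range n)) n)

  -- The sum of all literal numbers bounds each of them and is at once a `Comp`, unlike a maximum.
  #variables : List Bool → ℕ → ℕ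
  #variables w n = suc (sumTo (#literals n) (cnfLiteral w n))

  opaque
    variables #nae : List Bool → ℕ → ℕ
    variables w n = double (suc (#variables w n + #literals n))
    #nae w n      = suc (#variables w n + #literals n) + #literals n

    naeLiterals : List Bool → ℕ → ℕ → ℕ
    naeLiterals w n = naeLit (#variables w n) (#literals n) width (cnfLiteral w n)

  module _ (x : List Bool) where

    private
      n : ℕ
      n = length x

    0<range : 0 < range n
    0<range = s≤s z≤n

    0<#clauses : 0 < #clauses
    0<#clauses = s≤s z≤n

    cnfLiteral-< : ∀ r → r < #instances n * width → cnfLiteral x n r < double (#variables x n)
    cnfLiteral-< r r< = <-≤-trans (s≤s (≤-sumTo (#literals n) (cnfLiteral x n) r r<)) (n≤double _)

    module Wide = WideClauses (#variables x n) (#instances n) width (cnfLiteral x n) (s≤s z≤n) cnfLiteral-<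
    reduced : List Bool
    reduced = graphWord (variables x n) (#nae x n) (naeLiterals x n)

    private
      instance-< : ∀ {t e κ} → t < range n → e < range n → κ < #clauses → (t * range n + e) * #clauses + κ < #instances n
      instance-< t< e< κ< = digits-< (range n * range n) #clauses (digits-< (range n) (range n) t< e<) κ<
        where
        digits-< : ∀ a b {p q} → p < a → q < b → p * b + q < a * b
        digits-< a b {p} {q} p<a q<b = ≤-trans (+-monoʳ-< (p * b) q<b) (≤-trans (≤-reflexive (+-comm (p * b) b)) (*-monoˡ-≤ b p<a))

      cnfLiteral-≡ : ∀ t {e κ i} → e < range n → κ < #clauses → i < width →
        cnfLiteral x n (((t * range n + e) * #clauses + κ) * width + i) ≡ clauseAt clauses κ i x (environment e t n)
      cnfLiteral-≡ t {e} {κ} {i} e< κ< i< = trans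
        (cong₂ (λ m i → clauseAt clauses (rem m #clauses) i x (environment (rem (quot m #clauses) (range n)) (quot (quot m #clauses) (range n)) n))
          (quot-unique m width i i<) (rem-unique m width i i<))
        (trans (cong₂ (λ κ te → clauseAt clauses κ i x (environment (rem te (range n)) (quot te (range n)) n))
            (rem-unique te #clauses κ κ<) (quot-unique te #clauses κ κ<))
          (cong₂ (λ e t → clauseAt clauses κ i x (environment e t n)) (rem-unique t (range n) e e<) (quot-unique t (range n) e e<)))
        where
        te = t * range n + e
        m = te * #clauses + κ

      literal-code : ∀ {τ : Truth} {a w env} (l : Literal) →
        (∀ f t i → a (variableCode f t i) ≡ τ f t i) → literal a (literalCode l w env) ≡ true → Holds τ w env l
      literal-code {τ} {a} {w} {env} (true , A) eq h =
        Equivalence.from Bool.T-≡ (trans (sym (eq _ _ _)) (trans (sym (literal-pos a (atomCode A w env))) h))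
      literal-code {τ} {a} {w} {env} (false , A) eq h =
        Equivalence.from Bool.T-≡ (trans (cong not (sym (eq _ _ _))) (trans (sym (literal-neg a (atomCode A w env))) h))

      code-literal : ∀ {τ : Truth} {a w env} (l : Literal) →
        (∀ f t i → a (variableCode f t i) ≡ τ f t i) → Holds τ w env l → literal a (literalCode l w env) ≡ true
      code-literal {τ} {a} {w} {env} (true , A) eq h =
        trans (literal-pos a (atomCode A w env)) (trans (eq _ _ _) (Equivalence.to Bool.T-≡ h))
      code-literal {τ} {a} {w} {env} (false , A) eq h =
        trans (literal-neg a (atomCode A w env)) (trans (cong not (eq _ _ _)) (Equivalence.to Bool.T-≡ h))

      module _ {τ : Truth} {a : ℕ → Bool} (eq : ∀ f t i → a (variableCode f t i) ≡ τ f t i) {w : List Bool} {env : Env 3} where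

        position : ∀ l ls → Any (Holds τ w env) (l ∷ ls) → ∃[ i ] i ≤ length ls × literal a (literalAt l ls i w env) ≡ true
        position l []        (here h)  = 0 , z≤n , code-literal {τ} {a} l eq h
        position l (l′ ∷ ls) (here h)  = 0 , z≤n , code-literal {τ} {a} l eq h
        position l (l′ ∷ ls) (there h) = let (i , i≤ , t) = position l′ ls h in suc i , s≤s i≤ , t

        holding : ∀ l ls i → literal a (literalAt l ls i w env) ≡ true → Any (Holds τ w env) (l ∷ ls)
        holding l []        i       h = here (literal-code {τ} {a} l eq h)
        holding l (l′ ∷ ls) zero    h = here (literal-code {τ} {a} l eq h)
        holding l (l′ ∷ ls) (suc i) h = there (holding l′ ls i h)

        positions : ∀ cs κ → κ < length cs → All (Satisfies τ w env) cs →
          ∃[ i ] i ≤ List.foldr _⊔_ 0 (List.map (length ∘ proj₂) cs) × literal a (clauseAt cs κ i w env) ≡ true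
        positions ((l , ls) ∷ cs) zero    _        (s ∷ _)  =
          let (i , i≤ , t) = position l ls s in i , ≤-trans i≤ (m≤m⊔n (length ls) _) , t
        positions ((l , ls) ∷ cs) (suc κ) (s≤s κ<) (_ ∷ ss) =
          let (i , i≤ , t) = positions cs κ κ< ss in i , ≤-trans i≤ (m≤n⊔m (length ls) _) , t

        holdings : ∀ cs → (∀ κ → κ < length cs → ∃[ i ] literal a (clauseAt cs κ i w env) ≡ true) → All (Satisfies τ w env) cs
        holdings []              h = []
        holdings ((l , ls) ∷ cs) h =
          let (i , t) = h 0 (s≤s z≤n) in holding l ls i t ∷ holdings cs λ κ κ< → h (suc κ) (s≤s κ<)

      -- Inverts `variableCode`; on numbers that are no codes the value is arbitrary.
      fromTruth : Truth → ℕ → Bool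
      fromTruth τ v with rem v #families <? #families
      ... | yes lt = let (t , i) = unpair (quot v #families) in τ (indexFamily (fromℕ< lt)) t i
      ... | no  _  = false

      fromTruth-code : ∀ τ f t i → fromTruth τ (variableCode f t i) ≡ τ f t i
      fromTruth-code τ f t i with rem (variableCode f t i) #families <? #families
      ... | no ¬lt = ⊥-elim (¬lt (subst (_< #families)
        (sym (rem-unique (pairing t i) #families _ (Fin.toℕ<n (familyIndex f)))) (Fin.toℕ<n (familyIndex f))))
      ... | yes lt = cong₂ (λ f ti → τ f (proj₁ ti) (proj₂ ti))
        (trans (cong indexFamily (Fin.toℕ-injective (trans (Fin.toℕ-fromℕ< lt)
            (rem-unique (pairing t i) #families _ (Fin.toℕ<n (familyIndex f))))))
          (indexFamily-familyIndex f))
        (trans (cong unpair (quot-unique (pairing t i) #families _ (Fin.toℕ<n (familyIndex f)))) (unpair-pairing t i))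

    model⇒cnf : ∀ τ → Model τ x → CNFSatisfied (#instances n) width (cnfLiteral x n) (fromTruth τ)
    model⇒cnf τ model m m< =
      let (i , i≤ , h) = positions {τ} {fromTruth τ} (fromTruth-code τ) clauses κ κ< (model t e t< e<) in
      i , s≤s i≤ , trans (cong (literal (fromTruth τ)) (trans
        (cong (λ m → cnfLiteral x n (m * width + i)) (sym m≡)) (cnfLiteral-≡ t e< κ< (s≤s i≤)))) h
      where
      te = quot m #clauses
      κ = rem m #clauses
      t = quot te (range n)
      e = rem te (range n)
      κ< = rem-< m #clauses 0<#clauses
      e< = rem-< te (range n) 0<range
      t< = quot-< te (range n) (range n) (quot-< m (range n * range n) #clauses m<)
      m≡ : (t * range n + e) * #clauses + κ ≡ m
      m≡ = trans (cong (λ te → te * #clauses + κ) (quot-rem te (range n) 0<range)) (quot-rem m #clauses 0<#clauses)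

    -- An assignment is read at the codes of the atoms. Injectivity of the numbering is used in the
    -- other direction, by `fromTruth-code`.
    cnf⇒model : ∀ a → CNFSatisfied (#instances n) width (cnfLiteral x n) a → Model (λ f t i → a (variableCode f t i)) x
    cnf⇒model a sat t e t< e< = holdings {a = a} (λ _ _ _ → refl) clauses λ κ κ< →
      let (i , i< , h) = sat ((t * range n + e) * #clauses + κ) (instance-< t< e< κ<) in
      i , trans (cong (literal a) (sym (cnfLiteral-≡ t e< κ< i<))) h

    accepts⇒cnf : Accepts x → ∃[ a ] CNFSatisfied (#instances n) width (cnfLiteral x n) a
    accepts⇒cnf (u , short , accepted) = fromTruth (Sound.τ x u short accepted) ,
      model⇒cnf (Sound.τ x u short accepted) (Sound.model x u short accepted)

    cnf⇒accepts : ∀ a → CNFSatisfied (#instances n) width (cnfLiteral x n) a → Accepts x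
    cnf⇒accepts a sat = Reconstruct.accepts x (λ f t i → a (variableCode f t i)) (cnf⇒model a sat)

    opaque
      unfolding variables #nae naeLiterals

      reduction-complete : Accepts x → BipartiteMaxDegree3InOut≤1 reduced
      reduction-complete acc = let (a , sat) = accepts⇒cnf acc in
        graphWord-complete (variables x n) (#nae x n) (naeLiterals x n) Wide.0<X Wide.0<C Wide.lit-<
          (Wide.ToNAE.naeAssignment a sat) (Wide.ToNAE.nae-satisfied a sat)

      reduction-sound : BipartiteMaxDegree3InOut≤1 reduced → Accepts x
      reduction-sound h =
        let (b , sat) = graphWord-sound (variables x n) (#nae x n) (naeLiterals x n) Wide.0<X Wide.0<C Wide.lit-< h in
        cnf⇒accepts (Wide.FromNAE.assignment b sat) (Wide.FromNAE.cnf-satisfied b sat)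

-- Computability of the reduction

printed-matrixWord : ∀ N f →
  concatTo N (λ _ → true ∷ []) ++ false ∷ concatTo N (λ u → concatTo N λ v → positive (bool (f u v)) ∷ []) ≡ matrixWord N f
printed-matrixWord N f = cong (λ matrix → concatTo N (λ _ → true ∷ []) ++ false ∷ matrix)
  (concatTo-cong N λ u → concatTo-cong N λ v → cong (_∷ []) (positive-bool (f u v)))

variable
  gK gX gk gx go gk′ gx′ go′ gu gV gR gL gn gr gp gc : List Bool → Env α → ℕ
  glit : List Bool → Env α → ℕ → ℕ

module _ (K : Comp α gK) where

  edgeᶜ : Comp α gk → Comp α gx → Comp α go → Comp α gk′ → Comp α gx′ → Comp α go′ →
          Comp α (λ w env → glit w env (go′ w env)) →
          Test α λ w env → edgeTest (gK w env) (glit w env) (vertex (gk w env) (gx w env) (go w env)) (vertex (gk′ w env) (gx′ w env) (go′ w env))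
  edgeᶜ {glit = glit} k x o k′ x′ o′ lit =
    ((k ≡ᶜ const 0) ∧ᶜ (k′ ≡ᶜ const 1) ∧ᶜ (x ≡ᶜ x′) ∧ᶜ (o ≡ᶜ o′)) ∨ᶜ
    ((k ≡ᶜ const 1) ∧ᶜ (k′ ≡ᶜ const 0) ∧ᶜ (x ≡ᶜ x′) ∧ᶜ (o′ ≡ᶜ ifᶜ (one ⊕ o ≡ᶜ K) (const 0) (one ⊕ o))) ∨ᶜ
    ((k ≡ᶜ const 2) ∧ᶜ (k′ ≡ᶜ const 1) ∧ᶜ (x ≡ᶜ x′) ∧ᶜ (o ≡ᶜ o′)) ∨ᶜ
    ((k ≡ᶜ const 3) ∧ᶜ (k′ ≡ᶜ const 0) ∧ᶜ (x ≡ᶜ x′) ∧ᶜ (o ≡ᶜ o′)) ∨ᶜ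
    ((k ≡ᶜ const 4) ∧ᶜ (k′ ≡ᶜ const 3) ∧ᶜ (x ≡ᶜ const 0) ∧ᶜ (o ≡ᶜ quotᶜ o′ (const 3)) ∧ᶜ (x′ ≡ᶜ lit))

-- The literal function enters as an operation on `Comp`s, because a `Comp` takes only numbers
-- besides the word.
edgeBetweenᶜ : ∀ {gv} → Comp α gX → Comp α gK → Comp α gu → Comp α gv →
  (∀ {go} → Comp α go → Comp α λ w env → glit w env (go w env)) →
  Test α λ w env → edgeBetween (gX w env) (gK w env) (glit w env) (gu w env) (gv w env)
edgeBetweenᶜ {glit = glit} X K u v lit =
  edgeᶜ K {glit = glit} (quotᶜ u XK) (quotᶜ ru K) (remᶜ ru K) (quotᶜ v XK) (quotᶜ rv K) (remᶜ rv K) (lit (remᶜ rv K))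
  where
  XK = X ⊗ K
  ru = remᶜ u XK
  rv = remᶜ v XK

opaque
  unfolding order
  orderᶜ : Comp α gX → Comp α gc → Comp α λ w env → order (gX w env) (gc w env)
  orderᶜ X C = const 5 ⊗ (X ⊗ (C ⊗ const 3))

module _ (V : Comp α gV) (width : Comp α gL) (l : ∀ {go} → Comp α go → Comp α λ w env → glit w env (go w env)) where

  chainLiteralᶜ : Comp α gr → Comp α gp → Comp α λ w env → chainLiteral (gV w env) (gL w env) (glit w env) (gr w env) (gp w env)
  chainLiteralᶜ r p = ifᶜ (p ≡ᶜ const 0) (ifᶜ (remᶜ r width ≡ᶜ const 0) (const 0) (one ⊕ doubleᶜ (V ⊕ r)))
    (ifᶜ (p ≡ᶜ const 1) (const 2 ⊕ l r) (ifᶜ (remᶜ (one ⊕ r) width ≡ᶜ const 0) (const 0) (doubleᶜ (one ⊕ (V ⊕ r)))))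

  naeLiteralᶜ : Comp α gR → Comp α gc → Comp α gp →
    Comp α λ w env → naeLiteral (gV w env) (gR w env) (gL w env) (glit w env) (gc w env) (gp w env)
  naeLiteralᶜ total c p = ifᶜ (c <ᶜ one ⊕ (V ⊕ total)) (ifᶜ (p ≡ᶜ const 0) (doubleᶜ c) (one ⊕ doubleᶜ c))
    (chainLiteralᶜ (c ⊖ (one ⊕ (V ⊕ total))) p)

  naeLitᶜ : Comp α gR → Comp α go → Comp α λ w env → naeLit (gV w env) (gR w env) (gL w env) (glit w env) (go w env)
  naeLitᶜ total o = naeLiteralᶜ total (quotᶜ o (const 3)) (remᶜ o (const 3))

module ReductionComputable (M : TM) (c k c′ k′ : ℕ)
  (halts : ∀ w → Halted M (run M (poly c k (length w)) (initial M w))) where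

  open CookLevin M c k c′ k′
  open Reduction M c k c′ k′ halts

  module _ (n : Comp α gn) where

    #instancesᶜ : Comp α λ w env → #instances (gn w env)
    #instancesᶜ = rangeᶜ n ⊗ rangeᶜ n ⊗ const #clauses

    #literalsᶜ : Comp α λ w env → #literals (gn w env)
    #literalsᶜ = #instancesᶜ ⊗ const width

    cnfLiteralᶜ : Comp α gr → Comp α λ w env → cnfLiteral w (gn w env) (gr w env)
    cnfLiteralᶜ r = clauseAtᶜ (remᶜ te (rangeᶜ n)) (quotᶜ te (rangeᶜ n)) n clauses (remᶜ m (const #clauses)) (remᶜ r (const width))
      where
      m  = quotᶜ r (const width)
      te = quotᶜ m (const #clauses)

  module _ (n : Comp α gn) where

    #variablesᶜ : Comp α λ w env → #variables w (gn w env)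
    #variablesᶜ = one ⊕ sum (#literalsᶜ n) (cnfLiteralᶜ (wk n) (var fz))

    opaque
      unfolding variables #nae naeLiterals

      variablesᶜ : Comp α λ w env → variables w (gn w env)
      variablesᶜ = doubleᶜ (one ⊕ (#variablesᶜ ⊕ #literalsᶜ n))

      #naeᶜ : Comp α λ w env → #nae w (gn w env)
      #naeᶜ = one ⊕ (#variablesᶜ ⊕ #literalsᶜ n) ⊕ #literalsᶜ n

      naeLiteralsᶜ : Comp α go → Comp α λ w env → naeLiterals w (gn w env) (go w env)
      naeLiteralsᶜ o = naeLitᶜ {glit = λ w env → cnfLiteral w (gn w env)} #variablesᶜ (const width) (cnfLiteralᶜ n) (#literalsᶜ n) o

  module _ {gn : List Bool → Env α → ℕ} (n : Comp α gn) where

    directedᶜ : ∀ {gu gv} → Comp α gu → Comp α gv → Test α λ w env →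
      edgeBetween (variables w (gn w env)) (#nae w (gn w env) * 3) (naeLiterals w (gn w env)) (gu w env) (gv w env)
    directedᶜ {gu} {gv} u v = edgeBetweenᶜ {gX = λ w env → variables w (gn w env)} {gK = λ w env → #nae w (gn w env) * 3}
      {gu = gu} {glit = λ w env → naeLiterals w (gn w env)} {gv = gv}
      (variablesᶜ n) (#naeᶜ n ⊗ const 3) u v (naeLiteralsᶜ n)

    opaque
      unfolding adjacency

      adjacencyᶜ : ∀ {gu gv} → Comp α gu → Comp α gv → Test α λ w env →
        adjacency (variables w (gn w env)) (#nae w (gn w env)) (naeLiterals w (gn w env)) (gu w env) (gv w env)
      adjacencyᶜ u v = directedᶜ u v ∨ᶜ directedᶜ v u

  reduction : Out 1
  reduction = for N (emit one) ▷ emit {f = λ _ _ → 0} (const 0) ▷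
    for N (for (wk N) (emit (comp (adjacencyᶜ (var (fs (fs fz))) (var (fs fz)) (var fz)))))
    where
    N : Comp 1 λ w env → order (variables w (env fz)) (#nae w (env fz))
    N = orderᶜ (variablesᶜ (var fz)) (#naeᶜ (var fz))

  reduction-≡ : ∀ x → ⟦ reduction ⟧ x (λ _ → length x) ≡ reduced x
  reduction-≡ x = printed-matrixWord (order (variables x (length x)) (#nae x (length x)))
    (adjacency (variables x (length x)) (#nae x (length x)) (naeLiterals x (length x)))

  reducible : ∀ {P : Language} → (∀ x → P x ⇔ CookLevinCorrect.Accepts M c k c′ k′ halts x) → P ≤ₚ BipartiteMaxDegree3InOut≤1
  reducible iff = _ , out-polyTime reduction , λ x → mk⇔
    (λ h → subst BipartiteMaxDegree3InOut≤1 (sym (reduction-≡ x)) (reduction-complete x (Equivalence.to (iff x) h)))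
    (λ h → Equivalence.from (iff x) (reduction-sound x (subst BipartiteMaxDegree3InOut≤1 (reduction-≡ x) h)))

problem-NPHard : NPHard BipartiteMaxDegree3InOut≤1
problem-NPHard P (V , (M , c , k , computes) , c′ , k′ , iff) =
  ReductionComputable.reducible M c k c′ k′ (proj₁ ∘ computes) λ x → mk⇔
    (λ h → let (u , short , eq) = Equivalence.to (iff x) h in u , short , trans (proj₂ (computes (pair x u))) eq)
    (λ { (u , short , eq) → Equivalence.from (iff x) (u , short , trans (sym (proj₂ (computes (pair x u)))) eq) })

theorem4 : NPComplete BipartiteMaxDegree3InOut≤1
theorem4 = problem∈NP , problem-NPHard
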